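{- Uniformly in $w$ (that is, with absolute implied constants, for integers $1\le w<n$), $$nw\ln(n/w)-O(nw)\;\le\; s_w(n)\;\le\;\frac{19}{6\ln 3}\,(w+1)\,n\ln(n/w)+O(nw).$$
   Context: A graph $G$ is universal for a class of graphs $\mathcal C$ if, up to isomorphism, $G$ contains every graph in $\mathcal C$ as a (not necessarily induced) subgraph. For integers $n,w$, $s_w(n)$ denotes the minimum number of edges in an $n$-vertex graph that is universal for the class of all $n$-vertex graphs with treewidth $w$. The treewidth of a graph is the minimum, over all its tree-decompositions, of the size of the largest bag minus one. -}

module Defs where

open import Data.Bool using (Bool; true; false; T; T?)
open import Data.Empty using (⊥-elim)
open import Data.Fin as Fin using (Fin; zero; suc; inject₁; fromℕ)
import Data.Fin.Properties as Fin
open import Data.Fin.Subset using (Subset; _∈_; ∣_∣)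
open import Data.Integer as ℤ using (+_)
import Data.Integer.Properties as ℤ
open import Data.List using (List; length; filter; allFin; cartesianProduct)
open import Data.Nat as ℕ using (ℕ; zero; suc; _∸_)
import Data.Nat.Properties as ℕ
open import Data.Nat.Base using (NonZero)
open import Data.Product using (Σ; ∃; Σ-syntax; _×_; _,_; proj₁; proj₂)
open import Data.Rational as ℚ
  using (ℚ; 0ℚ; 1ℚ; ½; Positive; _/_; 1/_; _+_; _*_; _-_; -_; _≤_; _<_)
  renaming (∣_∣ to abs)
import Data.Rational.Properties as ℚ
open import Data.Rational.Solver using (module +-*-Solver)
open import Data.Sum using (inj₁; inj₂)
import Data.Vec.Functional as VF
open import Function using (_∘_)
open import Function.Definitions using (Injective)
open import Relation.Binary.Construct.Closure.ReflexiveTransitive using (Star)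
open import Relation.Binary.PropositionalEquality
  using (_≡_; _≢_; refl; sym; trans; cong; cong₂; subst; subst₂)
open import Relation.Nullary using (¬_; yes; no; contradiction)
open import Relation.Nullary.Decidable using (_×-dec_)

IsMinimum : (ℕ → Set) → ℕ → Set
IsMinimum P m = P m × (∀ k → P k → m ℕ.≤ k)

record Graph (n : ℕ) : Set where
  field
    adj       : Fin n → Fin n → Bool
    symmetric : ∀ u v → adj u v ≡ adj v u
    loopless  : ∀ u → adj u u ≡ false

  infix 4 _~_
  _~_ : Fin n → Fin n → Set
  u ~ v = T (adj u v)

  edges : List (Fin n × Fin n)
  edges = filter (λ (u , v) → (u Fin.<? v) ×-dec T? (adj u v))
                 (cartesianProduct (allFin n) (allFin n))

  edgeCount : ℕ
  edgeCount = length edges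

open Graph using (_~_; edgeCount)

-- H is isomorphic to a (not necessarily induced) subgraph of G.
infix 4 _⊑_
_⊑_ : ∀ {m n} → Graph m → Graph n → Set
_⊑_ {m} {n} H G =
  Σ[ f ∈ (Fin m → Fin n) ]
    Injective _≡_ _≡_ f × (∀ u v → _~_ H u v → _~_ G (f u) (f v))

Universal : ∀ {m n} → (Graph m → Set) → Graph n → Set
Universal C G = ∀ H → C H → H ⊑ G

Connected : ∀ {t} → Graph t → Set
Connected G = ∀ x y → Star (_~_ G) x y

record Cycle {t : ℕ} (G : Graph t) : Set where
  field
    {k}      : ℕ
    vertex   : Fin (3 ℕ.+ k) → Fin t
    distinct : Injective _≡_ _≡_ vertex
    step     : ∀ i → _~_ G (vertex (inject₁ i)) (vertex (suc i))
    close    : _~_ G (vertex (fromℕ (2 ℕ.+ k))) (vertex zero)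

record IsTree {t : ℕ} (G : Graph t) : Set where
  field
    nonempty  : NonZero t
    connected : Connected G
    acyclic   : ¬ Cycle G

record TreeDecomposition {n : ℕ} (G : Graph n) : Set where
  field
    {t}      : ℕ
    tree     : Graph t
    isTree   : IsTree tree
    bag      : Fin t → Subset n
    vertices : ∀ v → ∃ λ x → v ∈ bag x
    edges    : ∀ u v → _~_ G u v → ∃ λ x → u ∈ bag x × v ∈ bag x
    -- the nodes whose bags contain v induce a connected subgraph of the tree
    coherent : ∀ v x y → v ∈ bag x → v ∈ bag y →
               Star (λ x′ y′ → _~_ tree x′ y′ × v ∈ bag x′ × v ∈ bag y′) x y

  -- The truncation is harmless unless n ≡ 0, where the width is 0 and not -1.
  width : ℕ
  width = VF.foldr ℕ._⊔_ 0 (λ x → ∣ bag x ∣) ∸ 1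

HasTreewidth : ∀ {n} → ℕ → Graph n → Set
HasTreewidth w G =
  IsMinimum (λ k → Σ[ D ∈ TreeDecomposition G ] TreeDecomposition.width D ≡ k) w

-- IsS w n s says that s is s_w(n).
IsS : ℕ → ℕ → ℕ → Set
IsS w n = IsMinimum λ e →
  Σ[ G ∈ Graph n ] Universal {n} (HasTreewidth w) G × edgeCount G ≡ e

open ℚ.≤-Reasoning
open +-*-Solver using (solve; _:=_; _:+_; _:*_; _:-_; :-_; con)

-- By convention recip 0ℚ ≡ 0ℚ.
recip : ℚ → ℚ
recip q with q ℚ.≟ 0ℚ
... | yes _   = 0ℚ
... | no  q≢0 = (1/ q) {{ℚ.≢-nonZero q≢0}}

recip-inverseʳ : ∀ {q} → q ≢ 0ℚ → q * recip q ≡ 1ℚ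
recip-inverseʳ {q} q≢0 with q ℚ.≟ 0ℚ
... | yes q≡0 = contradiction q≡0 q≢0
... | no  q≢0 = ℚ.*-inverseʳ q {{ℚ.≢-nonZero q≢0}}

module RationalLemmas where
  >⇒≢ : ∀ {q} → 0ℚ < q → q ≢ 0ℚ
  >⇒≢ 0<q q≡0 = ℚ.<⇒≢ 0<q (sym q≡0)

  *-monoʳ : ∀ {p q} r → 0ℚ ≤ r → p ≤ q → p * r ≤ q * r
  *-monoʳ r 0≤r = ℚ.*-monoʳ-≤-nonNeg r {{ℚ.nonNegative 0≤r}}

  *-mono : ∀ p q r s → 0ℚ ≤ q → 0ℚ ≤ r → p ≤ q → r ≤ s → p * r ≤ q * s
  *-mono p q r s 0≤q 0≤r p≤q r≤s = ℚ.≤-trans (*-monoʳ r 0≤r p≤q)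
    (ℚ.*-monoˡ-≤-nonNeg q {{ℚ.nonNegative 0≤q}} r≤s)

  *-nonneg : ∀ p q → 0ℚ ≤ p → 0ℚ ≤ q → 0ℚ ≤ p * q
  *-nonneg p q 0≤p 0≤q = subst (_≤ p * q) (ℚ.*-zeroˡ q) (*-monoʳ q 0≤q 0≤p)

  *-pos : ∀ {p q} → 0ℚ < p → 0ℚ < q → 0ℚ < p * q
  *-pos {p} {q} 0<p 0<q = subst (_< p * q) (ℚ.*-zeroˡ q)
    (ℚ.*-monoˡ-<-pos q {{ℚ.positive 0<q}} 0<p)

  recip-pos : ∀ {q} → 0ℚ < q → 0ℚ < recip q
  recip-pos {q} 0<q with q ℚ.≟ 0ℚ
  ... | yes q≡0 = contradiction q≡0 (>⇒≢ 0<q)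
  ... | no  q≢0 = ℚ.positive⁻¹ _ {{ℚ.1/pos⇒pos q {{ℚ.positive 0<q}}}}

  ½>0 : 0ℚ < ½
  ½>0 = ℚ.positive⁻¹ ½

  ≤abs : ∀ p → p ≤ abs p
  ≤abs p with ℚ.≤-total 0ℚ p
  ... | inj₁ 0≤p = ℚ.≤-reflexive (sym (ℚ.0≤p⇒∣p∣≡p 0≤p))
  ... | inj₂ p≤0 = ℚ.≤-trans p≤0 (ℚ.0≤∣p∣ p)

  abs-swap : ∀ p q → abs (p - q) ≡ abs (q - p)
  abs-swap p q = trans (sym (ℚ.∣-p∣≡∣p∣ (p - q)))
    (cong abs (solve 2 (λ p q → :- (p :- q) := q :- p) refl p q))

  abs≢0 : ∀ {ε q} → 0ℚ < ε → ε ≤ abs q → q ≢ 0ℚ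
  abs≢0 0<ε ε≤ refl = ℚ.<⇒≢ (ℚ.<-≤-trans 0<ε ε≤) refl

  abs-recip : ∀ ε q → 0ℚ < ε → ε ≤ abs q → abs (recip q) ≤ recip ε
  abs-recip ε q 0<ε ε≤ = begin
    abs (recip q)                       ≡⟨ ℚ.*-identityʳ (abs (recip q)) ⟨
    abs (recip q) * 1ℚ                  ≡⟨ cong (abs (recip q) *_) (recip-inverseʳ (>⇒≢ 0<ε)) ⟨
    abs (recip q) * (ε * recip ε)       ≤⟨ *-mono (abs (recip q)) (abs (recip q))
                                             (ε * recip ε) (abs q * recip ε)
                                             (ℚ.0≤∣p∣ (recip q))
                                             (ℚ.<⇒≤ (*-pos 0<ε (recip-pos 0<ε)))
                                             ℚ.≤-refl
                                             (*-monoʳ (recip ε) (ℚ.<⇒≤ (recip-pos 0<ε)) ε≤) ⟩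
    abs (recip q) * (abs q * recip ε)   ≡⟨ solve 3 (λ a b c → a :* (b :* c) := (b :* a) :* c)
                                             refl (abs (recip q)) (abs q) (recip ε) ⟩
    (abs q * abs (recip q)) * recip ε   ≡⟨ cong (_* recip ε) (ℚ.∣p*q∣≡∣p∣*∣q∣ q (recip q)) ⟨
    abs (q * recip q) * recip ε         ≡⟨ cong (λ z → abs z * recip ε)
                                             (recip-inverseʳ (abs≢0 0<ε ε≤)) ⟩
    1ℚ * recip ε                        ≡⟨ ℚ.*-identityˡ (recip ε) ⟩
    recip ε                             ∎

  recip-diff : ∀ a b → a ≢ 0ℚ → b ≢ 0ℚ →
               recip a - recip b ≡ (b - a) * (recip a * recip b)
  recip-diff a b a≢0 b≢0 = sym (begin-equality
    (b - a) * (recip a * recip b)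
      ≡⟨ solve 4 (λ a b x y → (b :- a) :* (x :* y) := (b :* y) :* x :- (a :* x) :* y)
           refl a b (recip a) (recip b) ⟩
    (b * recip b) * recip a - (a * recip a) * recip b
      ≡⟨ cong₂ (λ s t → s * recip a - t * recip b) (recip-inverseʳ b≢0) (recip-inverseʳ a≢0) ⟩
    1ℚ * recip a - 1ℚ * recip b
      ≡⟨ cong₂ _-_ (ℚ.*-identityˡ (recip a)) (ℚ.*-identityˡ (recip b)) ⟩
    recip a - recip b ∎)

  scale-inverse : ∀ {B} ε → 0ℚ < B → B * (ε * recip B) ≡ ε
  scale-inverse {B} ε 0<B = trans
    (solve 3 (λ B e r → B :* (e :* r) := (B :* r) :* e) refl B ε (recip B))
    (trans (cong (_* ε) (recip-inverseʳ (>⇒≢ 0<B))) (ℚ.*-identityˡ ε))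

open RationalLemmas

IsCauchy : (ℕ → ℚ) → Set
IsCauchy f = ∀ ε → 0ℚ < ε →
  ∃ λ N → ∀ m n → N ℕ.≤ m → N ℕ.≤ n → abs (f m - f n) ≤ ε

-- Two such sequences x and y represent the same real number when x ≤ᴿ y and
-- y ≤ᴿ x; the equality _≡_ on ℝ is finer.
record ℝ : Set where
  constructor mkℝ
  field
    seq    : ℕ → ℚ
    cauchy : IsCauchy seq

open ℝ using (seq; cauchy)

infix 4 _≤ᴿ_
_≤ᴿ_ : ℝ → ℝ → Set
x ≤ᴿ y = ∀ ε → 0ℚ < ε → ∃ λ N → ∀ n → N ℕ.≤ n → seq x n ≤ seq y n + ε

fromℚ : ℚ → ℝ
fromℚ q = mkℝ (λ _ → q) λ ε 0<ε → 0 , λ _ _ _ _ →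
  subst (λ z → abs z ≤ ε) (sym (ℚ.+-inverseʳ q)) (ℚ.<⇒≤ 0<ε)

fromℕᴿ : ℕ → ℝ
fromℕᴿ n = fromℚ (+ n / 1)

module ArithmeticCauchy where
  halves : ∀ ε → ½ * ε + ½ * ε ≡ ε
  halves = solve 1 (λ e → con ½ :* e :+ con ½ :* e := e) refl

  +-cauchy : ∀ f g → IsCauchy f → IsCauchy g → IsCauchy (λ n → f n + g n)
  +-cauchy f g cf cg ε 0<ε
    with cf (½ * ε) (*-pos ½>0 0<ε) | cg (½ * ε) (*-pos ½>0 0<ε)
  ... | N , p | M , q = N ℕ.⊔ M , λ m n N≤m N≤n → begin
    abs ((f m + g m) - (f n + g n))
      ≡⟨ cong abs (solve 4 (λ a b c d → (a :+ b) :- (c :+ d) := (a :- c) :+ (b :- d))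
           refl (f m) (g m) (f n) (g n)) ⟩
    abs ((f m - f n) + (g m - g n))
      ≤⟨ ℚ.∣p+q∣≤∣p∣+∣q∣ (f m - f n) (g m - g n) ⟩
    abs (f m - f n) + abs (g m - g n)
      ≤⟨ ℚ.+-mono-≤ (p m n (ℕ.m⊔n≤o⇒m≤o N M N≤m) (ℕ.m⊔n≤o⇒m≤o N M N≤n))
                    (q m n (ℕ.m⊔n≤o⇒n≤o N M N≤m) (ℕ.m⊔n≤o⇒n≤o N M N≤n)) ⟩
    ½ * ε + ½ * ε
      ≡⟨ halves ε ⟩
    ε ∎

  neg-cauchy : ∀ f → IsCauchy f → IsCauchy (λ n → - f n)
  neg-cauchy f cf ε 0<ε with cf ε 0<ε
  ... | N , p = N , λ m n N≤m N≤n → subst (_≤ ε)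
    (trans (abs-swap (f m) (f n))
      (cong abs (solve 2 (λ a b → b :- a := (:- a) :- (:- b)) refl (f m) (f n))))
    (p m n N≤m N≤n)

  bounded : ∀ f → IsCauchy f →
            ∃ λ B → 0ℚ < B × ∃ λ N → ∀ n → N ℕ.≤ n → abs (f n) ≤ B
  bounded f cf with cf 1ℚ (ℚ.positive⁻¹ 1ℚ)
  ... | N , p = abs (f N) + 1ℚ
              , ℚ.+-mono-≤-< (ℚ.0≤∣p∣ (f N)) (ℚ.positive⁻¹ 1ℚ)
              , N , λ n N≤n → begin
    abs (f n)
      ≡⟨ cong abs (solve 2 (λ a b → a := b :+ (a :- b)) refl (f n) (f N)) ⟩
    abs (f N + (f n - f N))
      ≤⟨ ℚ.∣p+q∣≤∣p∣+∣q∣ (f N) (f n - f N) ⟩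
    abs (f N) + abs (f n - f N)
      ≤⟨ ℚ.+-monoʳ-≤ (abs (f N)) (p n N N≤n ℕ.≤-refl) ⟩
    abs (f N) + 1ℚ ∎

  *-estimate : ∀ (f g : ℕ → ℚ) ε B C {N₁ N₂} → 0ℚ < B → 0ℚ < C →
    (∀ n → N₁ ℕ.≤ n → abs (f n) ≤ B) → (∀ n → N₂ ℕ.≤ n → abs (g n) ≤ C) →
    (∃ λ N → ∀ m n → N ℕ.≤ m → N ℕ.≤ n → abs (f m - f n) ≤ (½ * ε) * recip C) →
    (∃ λ N → ∀ m n → N ℕ.≤ m → N ℕ.≤ n → abs (g m - g n) ≤ (½ * ε) * recip B) →
    ∃ λ N → ∀ m n → N ℕ.≤ m → N ℕ.≤ n → abs (f m * g m - f n * g n) ≤ ε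
  *-estimate f g ε B C {N₁} {N₂} 0<B 0<C b c (N₃ , p) (N₄ , q) = N , λ m n N≤m N≤n → begin
    abs (f m * g m - f n * g n)
      ≡⟨ cong abs (solve 4 (λ a b c d → a :* b :- c :* d := a :* (b :- d) :+ d :* (a :- c))
           refl (f m) (g m) (f n) (g n)) ⟩
    abs (f m * (g m - g n) + g n * (f m - f n))
      ≤⟨ ℚ.∣p+q∣≤∣p∣+∣q∣ (f m * (g m - g n)) (g n * (f m - f n)) ⟩
    abs (f m * (g m - g n)) + abs (g n * (f m - f n))
      ≡⟨ cong₂ _+_ (ℚ.∣p*q∣≡∣p∣*∣q∣ (f m) (g m - g n))
                  (ℚ.∣p*q∣≡∣p∣*∣q∣ (g n) (f m - f n)) ⟩
    abs (f m) * abs (g m - g n) + abs (g n) * abs (f m - f n)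
      ≤⟨ ℚ.+-mono-≤
           (*-mono (abs (f m)) B (abs (g m - g n)) ((½ * ε) * recip B)
             (ℚ.<⇒≤ 0<B) (ℚ.0≤∣p∣ (g m - g n)) (b m (≤₁ N≤m)) (q m n (≤₄ N≤m) (≤₄ N≤n)))
           (*-mono (abs (g n)) C (abs (f m - f n)) ((½ * ε) * recip C)
             (ℚ.<⇒≤ 0<C) (ℚ.0≤∣p∣ (f m - f n)) (c n (≤₂ N≤n)) (p m n (≤₃ N≤m) (≤₃ N≤n))) ⟩
    B * ((½ * ε) * recip B) + C * ((½ * ε) * recip C)
      ≡⟨ cong₂ _+_ (scale-inverse (½ * ε) 0<B) (scale-inverse (½ * ε) 0<C) ⟩
    ½ * ε + ½ * ε
      ≡⟨ halves ε ⟩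
    ε ∎
    where
    N = (N₁ ℕ.⊔ N₂) ℕ.⊔ (N₃ ℕ.⊔ N₄)
    ≤₁ : ∀ {m} → N ℕ.≤ m → N₁ ℕ.≤ m
    ≤₁ h = ℕ.m⊔n≤o⇒m≤o N₁ N₂ (ℕ.m⊔n≤o⇒m≤o (N₁ ℕ.⊔ N₂) (N₃ ℕ.⊔ N₄) h)
    ≤₂ : ∀ {m} → N ℕ.≤ m → N₂ ℕ.≤ m
    ≤₂ h = ℕ.m⊔n≤o⇒n≤o N₁ N₂ (ℕ.m⊔n≤o⇒m≤o (N₁ ℕ.⊔ N₂) (N₃ ℕ.⊔ N₄) h)
    ≤₃ : ∀ {m} → N ℕ.≤ m → N₃ ℕ.≤ m
    ≤₃ h = ℕ.m⊔n≤o⇒m≤o N₃ N₄ (ℕ.m⊔n≤o⇒n≤o (N₁ ℕ.⊔ N₂) (N₃ ℕ.⊔ N₄) h)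
    ≤₄ : ∀ {m} → N ℕ.≤ m → N₄ ℕ.≤ m
    ≤₄ h = ℕ.m⊔n≤o⇒n≤o N₃ N₄ (ℕ.m⊔n≤o⇒n≤o (N₁ ℕ.⊔ N₂) (N₃ ℕ.⊔ N₄) h)

  *-cauchy : ∀ f g → IsCauchy f → IsCauchy g → IsCauchy (λ n → f n * g n)
  *-cauchy f g cf cg ε 0<ε =
    combine (bounded f cf) (bounded g cg)
    where
    combine : (∃ λ B → 0ℚ < B × ∃ λ N → ∀ n → N ℕ.≤ n → abs (f n) ≤ B) →
              (∃ λ C → 0ℚ < C × ∃ λ N → ∀ n → N ℕ.≤ n → abs (g n) ≤ C) →
              ∃ λ N → ∀ m n → N ℕ.≤ m → N ℕ.≤ n → abs (f m * g m - f n * g n) ≤ ε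
    combine (B , 0<B , N₁ , b) (C , 0<C , N₂ , c) = *-estimate f g ε B C 0<B 0<C b c
      (cf ((½ * ε) * recip C) (*-pos (*-pos ½>0 0<ε) (recip-pos 0<C)))
      (cg ((½ * ε) * recip B) (*-pos (*-pos ½>0 0<ε) (recip-pos 0<B)))

open ArithmeticCauchy

infixl 6 _+ᴿ_ _-ᴿ_
infixl 7 _*ᴿ_ _÷ᴿ_
infix  8 -ᴿ_

_+ᴿ_ : ℝ → ℝ → ℝ
x +ᴿ y = mkℝ (λ n → seq x n + seq y n) (+-cauchy (seq x) (seq y) (cauchy x) (cauchy y))

-ᴿ_ : ℝ → ℝ
-ᴿ x = mkℝ (λ n → - seq x n) (neg-cauchy (seq x) (cauchy x))

_-ᴿ_ : ℝ → ℝ → ℝ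
x -ᴿ y = x +ᴿ (-ᴿ y)

_*ᴿ_ : ℝ → ℝ → ℝ
x *ᴿ y = mkℝ (λ n → seq x n * seq y n) (*-cauchy (seq x) (seq y) (cauchy x) (cauchy y))

-- x is bounded away from 0; constructively this is what division by x needs.
record Apart₀ (x : ℝ) : Set where
  constructor mkApart₀
  field
    bound    : ℚ
    positive : 0ℚ < bound
    offset   : ℕ
    apart    : ∀ n → offset ℕ.≤ n → bound ≤ abs (seq x n)

module ReciprocalCauchy where
  recip-estimate : ∀ x ε δ {N₀} → 0ℚ < δ → (∀ n → N₀ ℕ.≤ n → δ ≤ abs (seq x n)) →
    (∃ λ N → ∀ m n → N ℕ.≤ m → N ℕ.≤ n →
       abs (seq x m - seq x n) ≤ ε * recip (recip δ * recip δ)) →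
    ∃ λ N → ∀ m n → N ℕ.≤ m → N ℕ.≤ n → abs (recip (seq x m) - recip (seq x n)) ≤ ε
  recip-estimate x ε δ {N₀} 0<δ a (N , p) = N₀ ℕ.⊔ N , λ m n N≤m N≤n →
    let am = a m (ℕ.m⊔n≤o⇒m≤o N₀ N N≤m)
        an = a n (ℕ.m⊔n≤o⇒m≤o N₀ N N≤n)
        c  = recip δ
        0≤c = ℚ.<⇒≤ (recip-pos 0<δ)
        xm = seq x m
        xn = seq x n
    in begin
    abs (recip xm - recip xn)
      ≡⟨ cong abs (recip-diff xm xn (abs≢0 0<δ am) (abs≢0 0<δ an)) ⟩
    abs ((xn - xm) * (recip xm * recip xn))
      ≡⟨ ℚ.∣p*q∣≡∣p∣*∣q∣ (xn - xm) (recip xm * recip xn) ⟩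
    abs (xn - xm) * abs (recip xm * recip xn)
      ≡⟨ cong (abs (xn - xm) *_) (ℚ.∣p*q∣≡∣p∣*∣q∣ (recip xm) (recip xn)) ⟩
    abs (xn - xm) * (abs (recip xm) * abs (recip xn))
      ≤⟨ *-mono (abs (xn - xm)) (ε * recip (c * c))
           (abs (recip xm) * abs (recip xn)) (c * c)
           (ℚ.≤-trans (ℚ.0≤∣p∣ (xn - xm)) (q m n N≤m N≤n))
           (*-nonneg (abs (recip xm)) (abs (recip xn)) (ℚ.0≤∣p∣ (recip xm)) (ℚ.0≤∣p∣ (recip xn)))
           (q m n N≤m N≤n)
           (*-mono (abs (recip xm)) c (abs (recip xn)) c 0≤c (ℚ.0≤∣p∣ (recip xn))
             (abs-recip δ xm 0<δ am) (abs-recip δ xn 0<δ an)) ⟩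
    (ε * recip (c * c)) * (c * c)
      ≡⟨ ℚ.*-comm (ε * recip (c * c)) (c * c) ⟩
    (c * c) * (ε * recip (c * c))
      ≡⟨ scale-inverse ε (*-pos (recip-pos 0<δ) (recip-pos 0<δ)) ⟩
    ε ∎
    where
    q : ∀ m n → N₀ ℕ.⊔ N ℕ.≤ m → N₀ ℕ.⊔ N ℕ.≤ n →
        abs (seq x n - seq x m) ≤ ε * recip (recip δ * recip δ)
    q m n N≤m N≤n = p n m (ℕ.m⊔n≤o⇒n≤o N₀ N N≤n) (ℕ.m⊔n≤o⇒n≤o N₀ N N≤m)

  recip-cauchy : ∀ x → Apart₀ x → IsCauchy (λ n → recip (seq x n))
  recip-cauchy x (mkApart₀ δ 0<δ N₀ a) ε 0<ε = recip-estimate x ε δ 0<δ a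
    (cauchy x (ε * recip (recip δ * recip δ))
      (*-pos 0<ε (recip-pos (*-pos (recip-pos 0<δ) (recip-pos 0<δ)))))

open ReciprocalCauchy

-- Only finitely many terms of y can vanish, so the convention for recip 0ℚ
-- does not affect the quotient.
_÷ᴿ_ : (x y : ℝ) → {{Apart₀ y}} → ℝ
_÷ᴿ_ x y {{y#0}} = x *ᴿ mkℝ (λ n → recip (seq y n)) (recip-cauchy y y#0)

-- The right-endpoint Riemann sum of 1/t for the partition of [a , b] into
-- 2 ^ k intervals of equal length; the sign is reversed when b < a.
riemann : ℚ → ℚ → ℕ → ℚ
riemann a b zero    = (b - a) * recip b
riemann a b (suc k) = riemann a (½ * (a + b)) k + riemann (½ * (a + b)) b k

module LogarithmCauchy where
  pow½ : ℕ → ℚ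
  pow½ zero    = 1ℚ
  pow½ (suc k) = ½ * pow½ k

  pow½-pos : ∀ k → 0ℚ < pow½ k
  pow½-pos zero    = ℚ.positive⁻¹ 1ℚ
  pow½-pos (suc k) = *-pos ½>0 (pow½-pos k)

  nat : ℕ → ℚ
  nat zero    = 0ℚ
  nat (suc n) = 1ℚ + nat n

  nat-nonneg : ∀ n → 0ℚ ≤ nat n
  nat-nonneg zero    = ℚ.≤-refl
  nat-nonneg (suc n) = ℚ.+-mono-≤ (ℚ.<⇒≤ (ℚ.positive⁻¹ 1ℚ)) (nat-nonneg n)

  pow½-nat : ∀ k → pow½ k * nat (suc k) ≤ 1ℚ
  pow½-nat zero    = ℚ.≤-refl
  pow½-nat (suc k) = begin
    (½ * pow½ k) * (1ℚ + (1ℚ + nat k))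
      ≤⟨ ℚ.≤-reflexive (sym (ℚ.+-identityʳ _)) ⟩
    (½ * pow½ k) * (1ℚ + (1ℚ + nat k)) + 0ℚ
      ≤⟨ ℚ.+-monoʳ-≤ ((½ * pow½ k) * (1ℚ + (1ℚ + nat k)))
           (*-nonneg (½ * pow½ k) (nat k) (ℚ.<⇒≤ (pow½-pos (suc k))) (nat-nonneg k)) ⟩
    (½ * pow½ k) * (1ℚ + (1ℚ + nat k)) + (½ * pow½ k) * nat k
      ≡⟨ solve 2 (λ p n → (con ½ :* p) :* (con 1ℚ :+ (con 1ℚ :+ n)) :+ (con ½ :* p) :* n
                          := p :* (con 1ℚ :+ n)) refl (pow½ k) (nat k) ⟩
    pow½ k * (1ℚ + nat k)
      ≤⟨ pow½-nat k ⟩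
    1ℚ ∎

  +/1≡nat : ∀ n → + n / 1 ≡ nat n
  +/1≡nat zero    = refl
  +/1≡nat (suc n) = trans (ℚ.toℚᵘ-injective eq) (cong (λ z → 1ℚ + z) (+/1≡nat n))
    where
    open import Data.Rational.Unnormalised as ℚᵘ using (ℚᵘ; mkℚᵘ; *≡*)
    import Data.Rational.Unnormalised.Properties as ℚᵘ
    eq : ℚ.toℚᵘ (+ suc n / 1) ℚᵘ.≃ ℚ.toℚᵘ (1ℚ + (+ n / 1))
    eq = ℚᵘ.≃-trans (ℚ.toℚᵘ-fromℚᵘ (mkℚᵘ (+ suc n) 0))
      (ℚᵘ.≃-trans (*≡* (cong (λ z → (+ 1 ℤ.+ z) ℤ.* + 1) (sym (ℤ.*-identityʳ (+ n)))))
        (ℚᵘ.≃-sym (ℚᵘ.≃-trans (ℚ.toℚᵘ-homo-+ 1ℚ (+ n / 1))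
          (ℚᵘ.+-congʳ (ℚ.toℚᵘ 1ℚ) (ℚ.toℚᵘ-fromℚᵘ (mkℚᵘ (+ n) 0))))))

  archimedean : ∀ q → ∃ λ n → q ≤ nat n
  archimedean q@(ℚ.mkℚ i d _) = ℤ.∣ i ∣ , subst (q ≤_) (+/1≡nat ℤ.∣ i ∣)
    (ℚ.toℚᵘ-cancel-≤ (ℚᵘ.≤-respʳ-≃ (ℚᵘ.≃-sym (ℚ.toℚᵘ-fromℚᵘ (mkℚᵘ (+ ℤ.∣ i ∣) 0)))
      (*≤* (lem i))))
    where
    open import Data.Rational.Unnormalised as ℚᵘ using (mkℚᵘ; *≤*)
    import Data.Rational.Unnormalised.Properties as ℚᵘ
    lem : ∀ i → i ℤ.* + 1 ℤ.≤ + ℤ.∣ i ∣ ℤ.* + suc d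
    lem (+ n)         = subst₂ ℤ._≤_ (ℤ.pos-* n 1) (ℤ.pos-* n (suc d))
      (ℤ.+≤+ (ℕ.*-monoʳ-≤ n (ℕ.s≤s ℕ.z≤n)))
    lem ℤ.-[1+ n ]    = ℤ.-≤+

  pow½-small : ∀ K ε → 0ℚ ≤ K → 0ℚ < ε → ∃ λ N → K * pow½ N ≤ ε
  pow½-small K ε 0≤K 0<ε with archimedean (K * recip ε)
  ... | N , K/ε≤N = N , (begin
    K * pow½ N
      ≡⟨ cong (_* pow½ N) (sym (trans (ℚ.*-comm (K * recip ε) ε) (scale-inverse K 0<ε))) ⟩
    ((K * recip ε) * ε) * pow½ N
      ≤⟨ *-monoʳ _ (ℚ.<⇒≤ (pow½-pos N)) (*-monoʳ ε (ℚ.<⇒≤ 0<ε)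
           (ℚ.≤-trans K/ε≤N N≤1+N)) ⟩
    (nat (suc N) * ε) * pow½ N
      ≡⟨ solve 3 (λ a e p → (a :* e) :* p := (p :* a) :* e) refl (nat (suc N)) ε (pow½ N) ⟩
    (pow½ N * nat (suc N)) * ε
      ≤⟨ *-monoʳ ε (ℚ.<⇒≤ 0<ε) (pow½-nat N) ⟩
    1ℚ * ε
      ≡⟨ ℚ.*-identityˡ ε ⟩
    ε ∎)
    where
    N≤1+N : nat N ≤ nat (suc N)
    N≤1+N = subst (_≤ 1ℚ + nat N) (ℚ.+-identityˡ (nat N))
      (ℚ.+-monoˡ-≤ (nat N) (ℚ.<⇒≤ (ℚ.positive⁻¹ 1ℚ)))

  module _ (f : ℕ → ℚ) (K : ℚ) (0≤K : 0ℚ ≤ K)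
           (step : ∀ k → abs (f (suc k) - f k) ≤ K * pow½ k) where

    K₂ : ℚ
    K₂ = K + K

    tail : ∀ N j → abs (f (j ℕ.+ N) - f N) ≤ K₂ * pow½ N - K₂ * pow½ (j ℕ.+ N)
    tail N zero    = ℚ.≤-reflexive (trans (cong abs (ℚ.+-inverseʳ (f N)))
                                          (sym (ℚ.+-inverseʳ (K₂ * pow½ N))))
    tail N (suc j) = let M = j ℕ.+ N in begin
      abs (f (suc M) - f N)
        ≡⟨ cong abs (solve 3 (λ a b c → a :- c := (a :- b) :+ (b :- c))
             refl (f (suc M)) (f M) (f N)) ⟩
      abs ((f (suc M) - f M) + (f M - f N))
        ≤⟨ ℚ.∣p+q∣≤∣p∣+∣q∣ (f (suc M) - f M) (f M - f N) ⟩
      abs (f (suc M) - f M) + abs (f M - f N)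
        ≤⟨ ℚ.+-mono-≤ (step M) (tail N j) ⟩
      K * pow½ M + (K₂ * pow½ N - K₂ * pow½ M)
        ≡⟨ solve 3 (λ k p q → k :* p :+ ((k :+ k) :* q :- (k :+ k) :* p)
                            := (k :+ k) :* q :- (k :+ k) :* (con ½ :* p))
             refl K (pow½ M) (pow½ N) ⟩
      K₂ * pow½ N - K₂ * pow½ (suc M) ∎

    0≤K₂ : 0ℚ ≤ K₂
    0≤K₂ = ℚ.+-mono-≤ 0≤K 0≤K

    tail′ : ∀ N m → N ℕ.≤ m → abs (f m - f N) ≤ K₂ * pow½ N
    tail′ N m N≤m = begin
      abs (f m - f N)
        ≡⟨ cong (λ z → abs (f z - f N)) (ℕ.m∸n+n≡m N≤m) ⟨
      abs (f (j ℕ.+ N) - f N)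
        ≤⟨ tail N j ⟩
      K₂ * pow½ N - K₂ * pow½ (j ℕ.+ N)
        ≤⟨ ℚ.+-monoʳ-≤ (K₂ * pow½ N)
             (ℚ.neg-antimono-≤ (*-nonneg K₂ (pow½ (j ℕ.+ N)) 0≤K₂ (ℚ.<⇒≤ (pow½-pos (j ℕ.+ N))))) ⟩
      K₂ * pow½ N + 0ℚ
        ≡⟨ ℚ.+-identityʳ _ ⟩
      K₂ * pow½ N ∎
      where j = m ∸ N

    geometric-estimate : ∀ ε → (∃ λ N → (K₂ + K₂) * pow½ N ≤ ε) →
      ∃ λ N → ∀ m n → N ℕ.≤ m → N ℕ.≤ n → abs (f m - f n) ≤ ε
    geometric-estimate ε (N , small) = N , λ m n N≤m N≤n → begin
      abs (f m - f n)
        ≡⟨ cong abs (solve 3 (λ a b c → a :- b := (a :- c) :+ (c :- b))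
             refl (f m) (f n) (f N)) ⟩
      abs ((f m - f N) + (f N - f n))
        ≤⟨ ℚ.∣p+q∣≤∣p∣+∣q∣ (f m - f N) (f N - f n) ⟩
      abs (f m - f N) + abs (f N - f n)
        ≡⟨ cong (λ z → abs (f m - f N) + z) (abs-swap (f N) (f n)) ⟩
      abs (f m - f N) + abs (f n - f N)
        ≤⟨ ℚ.+-mono-≤ (tail′ N m N≤m) (tail′ N n N≤n) ⟩
      K₂ * pow½ N + K₂ * pow½ N
        ≡⟨ ℚ.*-distribʳ-+ (pow½ N) K₂ K₂ ⟨
      (K₂ + K₂) * pow½ N
        ≤⟨ small ⟩
      ε ∎

    geometric-cauchy : IsCauchy f
    geometric-cauchy ε 0<ε = geometric-estimate ε
      (pow½-small (K₂ + K₂) ε (ℚ.+-mono-≤ 0≤K₂ 0≤K₂) 0<ε)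

  mid : ℚ → ℚ → ℚ
  mid a b = ½ * (a + b)

  mid-≥ : ∀ {μ a b} → μ ≤ a → μ ≤ b → μ ≤ mid a b
  mid-≥ {μ} {a} {b} μ≤a μ≤b = begin
    μ             ≡⟨ solve 1 (λ m → m := con ½ :* (m :+ m)) refl μ ⟩
    ½ * (μ + μ)   ≤⟨ ℚ.*-monoˡ-≤-nonNeg ½ (ℚ.+-mono-≤ μ≤a μ≤b) ⟩
    mid a b       ∎

  mid-≤ : ∀ {μ a b} → a ≤ μ → b ≤ μ → mid a b ≤ μ
  mid-≤ {μ} {a} {b} a≤μ b≤μ = begin
    mid a b       ≤⟨ ℚ.*-monoˡ-≤-nonNeg ½ (ℚ.+-mono-≤ a≤μ b≤μ) ⟩
    ½ * (μ + μ)   ≡⟨ solve 1 (λ m → m := con ½ :* (m :+ m)) refl μ ⟨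
    μ             ∎

  module _ (μ : ℚ) (0<μ : 0ℚ < μ) where

    private
      c : ℚ
      c = recip μ

    rate : ℚ → ℚ → ℚ
    rate a b = abs ((½ * (b - a)) * (½ * (b - a))) * (c * c)

    ≤abs-of : ∀ {a} → μ ≤ a → μ ≤ abs a
    ≤abs-of {a} μ≤a = ℚ.≤-trans μ≤a (≤abs a)

    rate-half : ∀ {a b a′ b′} → b′ - a′ ≡ ½ * (b - a) →
                rate a′ b′ ≡ (½ * ½) * rate a b
    rate-half {a} {b} {a′} {b′} eq = begin-equality
      abs ((½ * (b′ - a′)) * (½ * (b′ - a′))) * (c * c)
        ≡⟨ cong (λ z → abs ((½ * z) * (½ * z)) * (c * c)) eq ⟩
      abs ((½ * (½ * (b - a))) * (½ * (½ * (b - a)))) * (c * c)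
        ≡⟨ cong (λ z → abs z * (c * c))
             (solve 1 (λ h → (con ½ :* h) :* (con ½ :* h) := con (½ * ½) :* (h :* h))
               refl (½ * (b - a))) ⟩
      abs ((½ * ½) * ((½ * (b - a)) * (½ * (b - a)))) * (c * c)
        ≡⟨ cong (_* (c * c)) (ℚ.∣p*q∣≡∣p∣*∣q∣ (½ * ½) ((½ * (b - a)) * (½ * (b - a)))) ⟩
      ((½ * ½) * abs ((½ * (b - a)) * (½ * (b - a)))) * (c * c)
        ≡⟨ ℚ.*-assoc (½ * ½) (abs ((½ * (b - a)) * (½ * (b - a)))) (c * c) ⟩
      (½ * ½) * rate a b ∎

    riemann-step : ∀ a b k → μ ≤ a → μ ≤ b →
      abs (riemann a b (suc k) - riemann a b k) ≤ rate a b * pow½ k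
    riemann-step a b zero μ≤a μ≤b = begin
      abs (((M - a) * recip M + (b - M) * recip b) - (b - a) * recip b)
        ≡⟨ cong abs (solve 4 (λ a b x y →
             ((con ½ :* (a :+ b) :- a) :* x :+ (b :- con ½ :* (a :+ b)) :* y) :- (b :- a) :* y
             := (con ½ :* (b :- a)) :* (x :- y)) refl a b (recip M) (recip b)) ⟩
      abs (½h * (recip M - recip b))
        ≡⟨ cong (λ z → abs (½h * z)) (recip-diff M b (abs≢0 0<μ (≤abs-of μ≤M)) (abs≢0 0<μ (≤abs-of μ≤b))) ⟩
      abs (½h * ((b - M) * (recip M * recip b)))
        ≡⟨ cong abs (solve 4 (λ a b x y →
             (con ½ :* (b :- a)) :* ((b :- con ½ :* (a :+ b)) :* (x :* y))
             := ((con ½ :* (b :- a)) :* (con ½ :* (b :- a))) :* (x :* y))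
             refl a b (recip M) (recip b)) ⟩
      abs ((½h * ½h) * (recip M * recip b))
        ≡⟨ ℚ.∣p*q∣≡∣p∣*∣q∣ (½h * ½h) (recip M * recip b) ⟩
      abs (½h * ½h) * abs (recip M * recip b)
        ≡⟨ cong (abs (½h * ½h) *_) (ℚ.∣p*q∣≡∣p∣*∣q∣ (recip M) (recip b)) ⟩
      abs (½h * ½h) * (abs (recip M) * abs (recip b))
        ≤⟨ *-mono (abs (½h * ½h)) (abs (½h * ½h)) (abs (recip M) * abs (recip b)) (c * c)
             (ℚ.0≤∣p∣ (½h * ½h))
             (*-nonneg (abs (recip M)) (abs (recip b)) (ℚ.0≤∣p∣ (recip M)) (ℚ.0≤∣p∣ (recip b)))
             ℚ.≤-refl
             (*-mono (abs (recip M)) c (abs (recip b)) c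
               (ℚ.<⇒≤ (recip-pos 0<μ)) (ℚ.0≤∣p∣ (recip b))
               (abs-recip μ M 0<μ (≤abs-of μ≤M)) (abs-recip μ b 0<μ (≤abs-of μ≤b))) ⟩
      rate a b
        ≡⟨ ℚ.*-identityʳ (rate a b) ⟨
      rate a b * 1ℚ ∎
      where
      M   = mid a b
      ½h  = ½ * (b - a)
      μ≤M : μ ≤ M
      μ≤M = mid-≥ μ≤a μ≤b
    riemann-step a b (suc k) μ≤a μ≤b = begin
      abs ((riemann a M (suc k) + riemann M b (suc k)) - (riemann a M k + riemann M b k))
        ≡⟨ cong abs (solve 4 (λ a b c d → (a :+ b) :- (c :+ d) := (a :- c) :+ (b :- d)) refl
             (riemann a M (suc k)) (riemann M b (suc k)) (riemann a M k) (riemann M b k)) ⟩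
      abs ((riemann a M (suc k) - riemann a M k) + (riemann M b (suc k) - riemann M b k))
        ≤⟨ ℚ.∣p+q∣≤∣p∣+∣q∣ (riemann a M (suc k) - riemann a M k) (riemann M b (suc k) - riemann M b k) ⟩
      abs (riemann a M (suc k) - riemann a M k) + abs (riemann M b (suc k) - riemann M b k)
        ≤⟨ ℚ.+-mono-≤ (riemann-step a M k μ≤a μ≤M) (riemann-step M b k μ≤M μ≤b) ⟩
      rate a M * pow½ k + rate M b * pow½ k
        ≡⟨ cong₂ (λ x y → x * pow½ k + y * pow½ k)
             (rate-half {a} {b} {a} {M}
               (solve 2 (λ a b → con ½ :* (a :+ b) :- a := con ½ :* (b :- a)) refl a b))
             (rate-half {a} {b} {M} {b}
               (solve 2 (λ a b → b :- con ½ :* (a :+ b) := con ½ :* (b :- a)) refl a b)) ⟩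
      ((½ * ½) * rate a b) * pow½ k + ((½ * ½) * rate a b) * pow½ k
        ≡⟨ solve 2 (λ r p → (con (½ * ½) :* r) :* p :+ (con (½ * ½) :* r) :* p
                          := r :* (con ½ :* p)) refl (rate a b) (pow½ k) ⟩
      rate a b * (½ * pow½ k) ∎
      where
      M   = mid a b
      μ≤M : μ ≤ M
      μ≤M = mid-≥ μ≤a μ≤b

    riemann-cauchy : ∀ a b → μ ≤ a → μ ≤ b → IsCauchy (riemann a b)
    riemann-cauchy a b μ≤a μ≤b = geometric-cauchy (riemann a b) (rate a b)
      (*-nonneg (abs ((½ * (b - a)) * (½ * (b - a)))) (c * c)
        (ℚ.0≤∣p∣ ((½ * (b - a)) * (½ * (b - a))))
        (*-nonneg c c (ℚ.<⇒≤ (recip-pos 0<μ)) (ℚ.<⇒≤ (recip-pos 0<μ))))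
      (λ k → riemann-step a b k μ≤a μ≤b)

  ⊓-pos : ∀ {p q} → 0ℚ < p → 0ℚ < q → 0ℚ < p ℚ.⊓ q
  ⊓-pos {p} {q} 0<p 0<q with ℚ.⊓-sel p q
  ... | inj₁ eq = subst (0ℚ <_) (sym eq) 0<p
  ... | inj₂ eq = subst (0ℚ <_) (sym eq) 0<q

open LogarithmCauchy

-- ln q is the integral of 1/t from 1 to q.
ln : (q : ℚ) → .{{Positive q}} → ℝ
ln q = mkℝ (riemann 1ℚ q) (riemann-cauchy (1ℚ ℚ.⊓ q)
  (⊓-pos (ℚ.positive⁻¹ 1ℚ) (ℚ.positive⁻¹ q)) 1ℚ q (ℚ.p⊓q≤p 1ℚ q) (ℚ.p⊓q≤q 1ℚ q))

instance
  n/w-positive : ∀ {n w} .{{_ : NonZero n}} .{{_ : NonZero w}} → Positive (+ n / w)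
  n/w-positive {n} {w} = ℚ.normalize-pos n w

module LogarithmBound where
  riemann-≥ : ∀ X → 0ℚ < X → ∀ a b k → 0ℚ < a → a ≤ b → b ≤ X →
              (b - a) * recip X ≤ riemann a b k
  riemann-≥ X 0<X a b zero 0<a a≤b b≤X =
    *-mono (b - a) (b - a) (recip X) (recip b) 0≤b-a (ℚ.<⇒≤ (recip-pos 0<X)) ℚ.≤-refl
    (subst (_≤ recip b) (ℚ.0≤p⇒∣p∣≡p (ℚ.<⇒≤ (recip-pos 0<X)))
      (abs-recip b X 0<b (subst (b ≤_) (sym (ℚ.0≤p⇒∣p∣≡p (ℚ.<⇒≤ 0<X))) b≤X)))
    where
    0<b : 0ℚ < b
    0<b = ℚ.<-≤-trans 0<a a≤b
    0≤b-a : 0ℚ ≤ b - a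
    0≤b-a = subst (_≤ b - a) (ℚ.+-inverseʳ a) (ℚ.+-monoˡ-≤ (- a) a≤b)
  riemann-≥ X 0<X a b (suc k) 0<a a≤b b≤X = begin
    (b - a) * recip X
      ≡⟨ solve 3 (λ a b r → (b :- a) :* r
           := (con ½ :* (a :+ b) :- a) :* r :+ (b :- con ½ :* (a :+ b)) :* r)
           refl a b (recip X) ⟩
    (M - a) * recip X + (b - M) * recip X
      ≤⟨ ℚ.+-mono-≤ (riemann-≥ X 0<X a M k 0<a a≤M (ℚ.≤-trans M≤b b≤X))
                    (riemann-≥ X 0<X M b k (ℚ.<-≤-trans 0<a a≤M) M≤b b≤X) ⟩
    riemann a M k + riemann M b k ∎
    where
    M   = mid a b
    a≤M : a ≤ M
    a≤M = mid-≥ ℚ.≤-refl a≤b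
    M≤b : M ≤ b
    M≤b = mid-≤ a≤b ℚ.≤-refl

open LogarithmBound

instance
  6ln3-apart₀ : Apart₀ (fromℕᴿ 6 *ᴿ ln (+ 3 / 1))
  6ln3-apart₀ = mkApart₀ (+ 4 / 1) (ℚ.positive⁻¹ (+ 4 / 1)) 0 λ k _ →
    ℚ.≤-trans
      (ℚ.*-monoˡ-≤-nonNeg (+ 6 / 1)
        (riemann-≥ (+ 3 / 1) (ℚ.positive⁻¹ (+ 3 / 1)) 1ℚ (+ 3 / 1) k (ℚ.positive⁻¹ 1ℚ)
          (ℚ.≤ᵇ⇒≤ _) ℚ.≤-refl))
      (≤abs _)

{-# OPTIONS --safe #-}

-- Lower bound.  Take i groups of ⌊n/i⌋ vertices in which w hubs are joined to
-- their whole group.  If fewer than i w vertices of a universal graph have been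
-- deleted, some group of a copy has lost fewer than w vertices, so one of its
-- hubs survives with at least ⌊n/i⌋ - w surviving neighbours.  Deleting such
-- hubs one by one, w of them for each i ≤ n/(w+1), uses up w Σ (⌊n/i⌋ - w) edges.
--
-- Upper bound.  Put the n vertices on a line, let q = w + 1, and join the block
-- of q vertices at each multiple 2ᵏ⋅odd of a unit 8q to everything within about
-- 2ᵏ units.  A graph of treewidth w is laid out by placing a bag on the highest
-- block of the current interval and the parts left by the bag one after another
-- around it.  The part straddling the block must avoid it: it goes to the
-- highest remaining block, which has to reach both ends of that part.  If i
-- positions lie on one side of the block, choose the bag as deep as possible
-- with at least i vertices below it and fill that side with parts from below,
-- largest first; then twice the overhang of the straddling part on that side
-- plus its overhang on the other side is at most i.  For odd ≡ 1, 3, 5, 7 (mod 8)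
-- it follows that reaches of 8+6, 6+10, 9+6 and 6+12 quarters of 2ᵏ suffice, so
-- each of the log₂(n/w) levels costs 63/32 q n edges.  Since 3⁵ ≤ 2⁸, this is less
-- than 19/6 ⋅ 5/8 ≤ 19/(6 ln 3) ⋅ ln 2 times q n.

module Submission where

-- Origin of the reaches: let `y` be the occupied block and T the spacing of the current level, so
-- that the candidates are y - T and y + T. Their residues depend on the exponent of 2 in y / (2T),
-- and so does the known overhang bound, the spacing of the level of `y`. Exponent 0: residues 1, 5
-- left and 3, 7 right, bound 2T; an overhang of T on one side, without which the candidate there is
-- out of range, leaves T/2 on the other, so 3T/2 = 6 quarters suffice. Exponent 1: residue 3 left,
-- 5 right, bound 4T; if the right overhang is at most 3T/2, the left block is used before the right
-- one and reaches 5T/2 = 10 quarters; otherwise the left overhang is at most 5T/4, and the right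
-- block goes before and reaches 9T/4. Exponent 2 or more: the bound says nothing, each overhang may
-- be 2T; the left block, residue 7, reaches 3T = 12 quarters, after which the right one, residue 1,
-- has to reach 2T = 8. The bound itself has an exceptional case: if the largest part alone
-- overfills the side, it does so by less than q, and the two overhangs exchange their roles.

open import Data.Empty using (⊥; ⊥-elim)
open import Data.Product using (_×_; _,_; proj₁; proj₂; ∃; Σ-syntax)
open import Data.Sum as Sum using (_⊎_; inj₁; inj₂; [_,_]′)
open import Relation.Nullary using (¬_; yes; no; does; Dec)
open import Function using (_∋_; _∘_; case_of_; flip)
open import Function.Definitions using (Injective)
open import Relation.Binary.Definitions using (tri<; tri≈; tri>)
open import Relation.Binary.PropositionalEquality

-- Linear inequalities over the natural numbers by certificates.

module LinearArithmetic where
  open import Data.Fin using (Fin; zero; suc)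
  open import Data.Nat
  open import Data.Nat.Properties
  open import Data.Vec using (Vec; []; _∷_; lookup; replicate; zipWith)
  import Relation.Binary.Reflection as Reflect

  infixl 6 _:+_
  infixr 7 _:*_

  data Linear (n : ℕ) : Set where
    var  : Fin n → Linear n
    con  : ℕ → Linear n
    _:+_ : Linear n → Linear n → Linear n
    _:*_ : ℕ → Linear n → Linear n

  value : ∀ {n} → Linear n → Vec ℕ n → ℕ
  value (var i)  ρ = lookup ρ i
  value (con c)  ρ = c
  value (e :+ f) ρ = value e ρ + value f ρ
  value (c :* e) ρ = c * value e ρ

  dot : ∀ {n} → Vec ℕ n → Vec ℕ n → ℕ
  dot []       []      = 0
  dot (c ∷ cs) (x ∷ ρ) = c * x + dot cs ρ

  unit : ∀ {n} → Fin n → Vec ℕ n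
  unit zero    = 1 ∷ replicate _ 0
  unit (suc i) = 0 ∷ unit i

  scale : ∀ {n} → ℕ → Vec ℕ n → Vec ℕ n
  scale c []       = []
  scale c (d ∷ ds) = c * d ∷ scale c ds

  normal : ∀ {n} → Linear n → Vec ℕ n × ℕ
  normal (var i)  = unit i , 0
  normal (con c)  = replicate _ 0 , c
  normal (e :+ f) = let cs , c = normal e ; ds , d = normal f in zipWith _+_ cs ds , c + d
  normal (c :* e) = let ds , d = normal e in scale c ds , c * d

  normalValue : ∀ {n} → Linear n → Vec ℕ n → ℕ
  normalValue e ρ = dot (proj₁ (normal e)) ρ + proj₂ (normal e)

  dot-0 : ∀ {n} (ρ : Vec ℕ n) → dot (replicate n 0) ρ ≡ 0
  dot-0 []      = refl
  dot-0 (x ∷ ρ) = dot-0 ρ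

  dot-unit : ∀ {n} (i : Fin n) ρ → dot (unit i) ρ ≡ lookup ρ i
  dot-unit zero    (x ∷ ρ) = trans (cong (x + 0 +_) (dot-0 ρ)) (trans (+-identityʳ _) (+-identityʳ x))
  dot-unit (suc i) (x ∷ ρ) = dot-unit i ρ

  interchange : ∀ a b c d → (a + b) + (c + d) ≡ (a + c) + (b + d)
  interchange a b c d = trans (+-assoc a b (c + d))
    (trans (cong (a +_) (trans (sym (+-assoc b c d)) (trans (cong (_+ d) (+-comm b c)) (+-assoc c b d))))
           (sym (+-assoc a c (b + d))))

  dot-+ : ∀ {n} (cs ds ρ : Vec ℕ n) → dot (zipWith _+_ cs ds) ρ ≡ dot cs ρ + dot ds ρ
  dot-+ []       []       []      = refl
  dot-+ (c ∷ cs) (d ∷ ds) (x ∷ ρ) =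
    trans (cong₂ _+_ (*-distribʳ-+ x c d) (dot-+ cs ds ρ)) (interchange (c * x) (d * x) (dot cs ρ) (dot ds ρ))

  dot-scale : ∀ {n} c (ds ρ : Vec ℕ n) → dot (scale c ds) ρ ≡ c * dot ds ρ
  dot-scale c []       []      = sym (*-zeroʳ c)
  dot-scale c (d ∷ ds) (x ∷ ρ) =
    trans (cong₂ _+_ (*-assoc c d x) (dot-scale c ds ρ)) (sym (*-distribˡ-+ c (d * x) (dot ds ρ)))

  normal-correct : ∀ {n} (e : Linear n) ρ → normalValue e ρ ≡ value e ρ
  normal-correct (var i)  ρ = trans (+-identityʳ _) (dot-unit i ρ)
  normal-correct (con c)  ρ = cong (_+ c) (dot-0 ρ)
  normal-correct (e :+ f) ρ = trans
    (cong (_+ (proj₂ (normal e) + proj₂ (normal f))) (dot-+ (proj₁ (normal e)) (proj₁ (normal f)) ρ))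
    (trans (interchange (dot (proj₁ (normal e)) ρ) (dot (proj₁ (normal f)) ρ) (proj₂ (normal e)) (proj₂ (normal f)))
           (cong₂ _+_ (normal-correct e ρ) (normal-correct f ρ)))
  normal-correct (c :* e) ρ = trans
    (cong (_+ c * proj₂ (normal e)) (dot-scale c (proj₁ (normal e)) ρ))
    (trans (sym (*-distribˡ-+ c (dot (proj₁ (normal e)) ρ) (proj₂ (normal e)))) (cong (c *_) (normal-correct e ρ)))

  open Reflect (setoid ℕ) var value normalValue normal-correct public using (solve; _⊜_)

  -- Farkas certificates: x ≤ y follows from a combination A ≤ B of hypotheses
  -- when x - y ≤ A - B is an identity of linear forms with slack s.
  lin : ∀ {x y A B s} → A ≤ B → x + B + s ≡ y + A → x ≤ y
  lin {x} {y} {A} {B} {s} A≤B eq = +-cancelʳ-≤ B x y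
    (≤-trans (m≤m+n (x + B) s) (≤-trans (≤-reflexive eq) (+-monoʳ-≤ y A≤B)))

  -- Rounding: an excess of at most `m` disappears on division by `suc m`, because the values are
  -- integers.
  lin* : ∀ m {x y A B s} → A ≤ B → suc m * x + B + s ≡ suc m * y + A + m → x ≤ y
  lin* m {x} {y} {A} {B} {s} A≤B eq = s≤s⁻¹ (*-cancelˡ-< (suc m) x (suc y) (begin-strict
    suc m * x              ≤⟨ +-cancelʳ-≤ B _ _ (begin
      suc m * x + B          ≤⟨ m≤m+n _ s ⟩
      suc m * x + B + s      ≡⟨ eq ⟩
      suc m * y + A + m      ≤⟨ +-monoˡ-≤ m (+-monoʳ-≤ (suc m * y) A≤B) ⟩
      suc m * y + B + m      ≡⟨ solve 3 (λ z B m → z :+ B :+ m ⊜ z :+ m :+ B) refl (suc m * y) B m ⟩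
      suc m * y + m + B      ∎) ⟩
    suc m * y + m          <⟨ ≤-reflexive (trans (solve 2 (λ z m → con 1 :+ (z :+ m) ⊜ (con 1 :+ m) :+ z) refl (suc m * y) m) (sym (*-suc (suc m) y))) ⟩
    suc m * suc y          ∎))
    where open ≤-Reasoning

  infixl 6 _⊕_
  infixr 7 _⊗_

  _⊕_ : ∀ {a b c d} → a ≤ b → c ≤ d → a + c ≤ b + d
  _⊕_ = +-mono-≤

  _⊗_ : ∀ k {a b} → a ≤ b → k * a ≤ k * b
  _⊗_ = *-monoʳ-≤

  ≡⇒≤ : ∀ {a b : ℕ} → a ≡ b → a ≤ b
  ≡⇒≤ = ≤-reflexive

  ≡⇒≥ : ∀ {a b : ℕ} → a ≡ b → b ≤ a
  ≡⇒≥ eq = ≤-reflexive (sym eq)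

-- Free positions on a line, separations, and the gluing of placements.

module Placements where
  open import Data.Bool using (Bool; true; false; _∧_; not)
  open import Data.Fin as Fin using (Fin; zero; suc; toℕ)
  import Data.Fin.Properties as Fin
  open import Data.List using (List; length; lookup)
  open import Data.List.Membership.Propositional using (_∈_)
  open import Data.List.Relation.Unary.Any using (index)
  open import Data.List.Relation.Unary.Any.Properties using (lookup-index)
  open import Data.List.Membership.Propositional.Properties using (∈-lookup)
  open import Data.List.Relation.Unary.Unique.Propositional using (Unique)
  open import Data.Nat
  open import Data.Nat.Properties
  open import Relation.Nullary.Decidable using (dec-true; dec-false; _×-dec_)
  open LinearArithmetic

  bit : Bool → ℕ
  bit true  = 1
  bit false = 0

  -- `P` marks the free positions of the line; differences of `cnt P` measure the room in an
  -- interval.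
  cnt : (ℕ → Bool) → ℕ → ℕ
  cnt P zero    = 0
  cnt P (suc e) = bit (P e) + cnt P e

  bit≤1 : ∀ b → bit b ≤ 1
  bit≤1 true  = ≤-refl
  bit≤1 false = z≤n

  module _ (P : ℕ → Bool) where

    cnt-mono : ∀ {s e} → s ≤ e → cnt P s ≤ cnt P e
    cnt-mono {s} {e} s≤e with m≤n⇒m<n∨m≡n s≤e
    ... | inj₂ refl        = ≤-refl
    ... | inj₁ (s≤s {n = e′} s≤e′) = ≤-trans (cnt-mono s≤e′) (m≤n+m _ (bit (P e′)))

    cnt-upper : ∀ {s e} → s ≤ e → cnt P e + s ≤ cnt P s + e
    cnt-upper {s} {e} s≤e with m≤n⇒m<n∨m≡n s≤e
    ... | inj₂ refl        = ≤-refl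
    ... | inj₁ (s≤s {n = e′} s≤e′) = let b = bit≤1 (P e′) ; h = cnt-upper s≤e′ in
      ((bit (P e′) + cnt P e′ + s ≤ cnt P s + suc e′) ∋ lin (b ⊕ h)
          (solve 5 (λ b c d s e → b :+ c :+ s :+ (con 1 :+ (d :+ e)) :+ con 0
            ⊜ d :+ (con 1 :+ e) :+ (b :+ (c :+ s))) refl (bit (P e′)) (cnt P e′) (cnt P s) s e′))

    cnt-lower : ∀ {s e} → s ≤ e → (∀ x → s ≤ x → x < e → P x ≡ true) → cnt P s + e ≤ cnt P e + s
    cnt-lower {s} {e} s≤e full with m≤n⇒m<n∨m≡n s≤e
    ... | inj₂ refl        = ≤-refl
    ... | inj₁ (s≤s {n = e′} s≤e′) =
      let h = cnt-lower s≤e′ (λ x s≤x x<e → full x s≤x (m≤n⇒m≤1+n x<e))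
          b = cong bit (full e′ s≤e′ ≤-refl)
      in ((cnt P s + suc e′ ≤ bit (P e′) + cnt P e′ + s) ∋ lin (≡⇒≥ b ⊕ h)
          (solve 5 (λ b c d s e → d :+ (con 1 :+ e) :+ (b :+ (c :+ s)) :+ con 0
            ⊜ b :+ c :+ s :+ (con 1 :+ (d :+ e))) refl (bit (P e′)) (cnt P e′) (cnt P s) s e′))

    -- Discrete intermediate value theorem, as `cnt P` grows by at most 1 per step. It provides the
    -- cut points at which a part has used up its share of the free positions.
    cnt-attains : ∀ {s e} v → s ≤ e → cnt P s ≤ v → v ≤ cnt P e → ∃ λ z → s ≤ z × z ≤ e × cnt P z ≡ v
    cnt-attains {s} {e} v s≤e lo hi with m≤n⇒m<n∨m≡n s≤e
    ... | inj₂ refl        = s , ≤-refl , ≤-refl , ≤-antisym lo hi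
    ... | inj₁ (s≤s {n = e′} s≤e′) with v ≤? cnt P e′
    ...   | yes v≤ = let z , a , b , c = cnt-attains v s≤e′ lo v≤ in z , a , m≤n⇒m≤1+n b , c
    ...   | no  v≰ = suc e′ , m≤n⇒m≤1+n s≤e′ , ≤-refl ,
      ≤-antisym (≤-trans (+-monoˡ-≤ (cnt P e′) (bit≤1 (P e′))) (≰⇒> v≰)) hi

    remove : ℕ → ℕ → ℕ → Bool
    remove u x y = P y ∧ not (does ((u ≤? y) ×-dec (y <? u + x)))

    remove-below : ∀ {u x y} → y < u → remove u x y ≡ P y
    remove-below {u} {x} {y} y<u
      rewrite dec-false ((u ≤? y) ×-dec (y <? u + x)) (λ (u≤y , _) → <⇒≱ y<u u≤y) with P y
    ... | true  = refl
    ... | false = refl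

    remove-above : ∀ {u x y} → u + x ≤ y → remove u x y ≡ P y
    remove-above {u} {x} {y} ux≤y
      rewrite dec-false ((u ≤? y) ×-dec (y <? u + x)) (λ (_ , y<) → <⇒≱ y< ux≤y) with P y
    ... | true  = refl
    ... | false = refl

    remove-inside : ∀ {u x y} → u ≤ y → y < u + x → remove u x y ≡ false
    remove-inside {u} {x} {y} u≤y y<
      rewrite dec-true ((u ≤? y) ×-dec (y <? u + x)) (u≤y , y<) with P y
    ... | true  = refl
    ... | false = refl

    remove-sub : ∀ {u x y} → remove u x y ≡ true → P y ≡ true
    remove-sub {u} {x} {y} eq with P y
    ... | true = refl

    cnt-remove-below : ∀ {u x e} → e ≤ u → cnt (remove u x) e ≡ cnt P e
    cnt-remove-below {e = zero}  _ = refl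
    cnt-remove-below {u} {x} {suc e} e<u =
      cong₂ _+_ (cong bit (remove-below {u} {x} e<u)) (cnt-remove-below (<⇒≤ e<u))

    cnt-remove-above : ∀ {u x e} → u + x ≤ e → (∀ y → u ≤ y → y < u + x → P y ≡ true) →
                       cnt (remove u x) e + x ≡ cnt P e
    cnt-remove-above {u} {x} {e} ux≤e full with m≤n⇒m<n∨m≡n ux≤e
    ... | inj₁ (s≤s {n = e′} ux≤e′) = trans (+-assoc (bit (remove u x e′)) (cnt (remove u x) e′) x)
      (cong₂ _+_ (cong bit (remove-above {u} {x} ux≤e′)) (cnt-remove-above ux≤e′ full))
    ... | inj₂ refl = go x full
      where
      go : ∀ j → (∀ y → u ≤ y → y < u + j → P y ≡ true) → cnt (remove u j) (u + j) + j ≡ cnt P (u + j)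
      go j full = trans (cong (_+ j) (inner j ≤-refl)) (outer j full)
        where
        inner : ∀ i → i ≤ j → cnt (remove u j) (u + i) ≡ cnt P u
        inner zero    _   rewrite +-identityʳ u = cnt-remove-below {u} {j} ≤-refl
        inner (suc i) i<j rewrite +-suc u i =
          cong₂ _+_ (cong bit (remove-inside {u} {j} (m≤m+n u i) (+-monoʳ-< u i<j))) (inner i (<⇒≤ i<j))
        outer : ∀ i → (∀ y → u ≤ y → y < u + i → P y ≡ true) → cnt P u + i ≡ cnt P (u + i)
        outer zero    _ rewrite +-identityʳ u = +-identityʳ _
        outer (suc i) full rewrite +-suc u i | +-suc (cnt P u) i =
          cong₂ _+_ (sym (cong bit (full (u + i) (m≤m+n u i) (≤-reflexive refl))))
            (outer i (λ y a b → full y a (m≤n⇒m≤1+n b)))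

  -- `i` is the room on one side of a block. `A` goes to that side, `K` is the part that fills it up
  -- and may straddle the block, `R` takes what is left. In `straddle` the first case is a `K` no
  -- larger than a part already in `A`; the second arises when `A` is empty, where the choice of the
  -- bag bounds `K`.
  record Sep {V : Set} (_~_ : V → V → Set) (q : ℕ) (C : List V) (i : ℕ) : Set where
    field
      X A K R : List V
      cover   : ∀ {v} → v ∈ C → v ∈ X ⊎ v ∈ A ⊎ v ∈ K ⊎ v ∈ R
      X⊆ : ∀ {v} → v ∈ X → v ∈ C
      A⊆ : ∀ {v} → v ∈ A → v ∈ C
      K⊆ : ∀ {v} → v ∈ K → v ∈ C
      R⊆ : ∀ {v} → v ∈ R → v ∈ C
      uniqueA : Unique A
      uniqueK : Unique K
      uniqueR : Unique R
      sizeX   : length X ≤ q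
      sizes   : length X + length A + length K + length R ≡ length C
      A≁K : ∀ {a b} → a ∈ A → b ∈ K → ¬ (a ~ b)
      A≁R : ∀ {a b} → a ∈ A → b ∈ R → ¬ (a ~ b)
      K≁R : ∀ {a b} → a ∈ K → b ∈ R → ¬ (a ~ b)
      A≤i  : length A ≤ i
      i≤AK : i ≤ length A + length K
      straddle : length K ≤ length A ⊎ length A + length K < i + q

  module Embedding
    {V : Set} (_~_ : V → V → Set) (~-sym : ∀ {a b} → a ~ b → b ~ a)
    (Adj : ℕ → ℕ → Set) (Adj-sym : ∀ {a b} → Adj a b → Adj b a)
    where

    -- `at` is a relation, so that placements of several pieces are united by a sum, without
    -- deciding in which piece a vertex lies. A vertex may have several positions: `edge` holds for
    -- all of them, and a choice by `total` gives a map in the end.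
    record Emb (C : List V) (P : ℕ → Bool) (s e : ℕ) : Set₁ where
      field
        at    : V → ℕ → Set
        total : ∀ {v} → v ∈ C → ∃ (at v)
        sound : ∀ {v a} → at v a → v ∈ C × s ≤ a × a < e × P a ≡ true
        inj   : ∀ {v v′ a} → at v a → at v′ a → v ≡ v′
        edge  : ∀ {v v′ a a′} → at v a → at v′ a′ → v ~ v′ → Adj a a′

    module _ {q C i} (S : Sep _~_ q C i) where
      open Sep S

      -- The bag takes the leading positions of the block, which is joined to the whole interval,
      -- and `S` excludes edges between different pieces. So only edges inside a piece remain, and
      -- these are settled by its own placement.
      combine : ∀ {P s e u a₁ b₁ a₂ b₂ a₃ b₃} →
        s ≤ u → u + q ≤ e → (∀ x → u ≤ x → x < u + length X → P x ≡ true) →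
        (∀ {j a} → j < q → s ≤ a → a < e → Adj (u + j) a) →
        s ≤ a₁ → b₁ ≤ e → s ≤ a₂ → b₂ ≤ e → s ≤ a₃ → b₃ ≤ e →
        (∀ {x} → a₁ ≤ x → x < b₁ → a₂ ≤ x → x < b₂ → ⊥) →
        (∀ {x} → a₁ ≤ x → x < b₁ → a₃ ≤ x → x < b₃ → ⊥) →
        (∀ {x} → a₂ ≤ x → x < b₂ → a₃ ≤ x → x < b₃ → ⊥) →
        Emb A (remove P u (length X)) a₁ b₁ →
        Emb K (remove P u (length X)) a₂ b₂ →
        Emb R (remove P u (length X)) a₃ b₃ →
        Emb C P s e
      combine {P} {s} {e} {u} s≤u uq≤e free adj s₁ e₁ s₂ e₂ s₃ e₃ d₁₂ d₁₃ d₂₃ EA EK ER = record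
        { at = at ; total = total ; sound = λ h → proj₁ (sound h) , proj₁ (proj₂ (sound h)) , proj₁ (proj₂ (proj₂ (sound h))) , proj₂ (proj₂ (proj₂ (sound h)))
        ; inj = inj ; edge = edge }
        where
        module EA = Emb EA
        module EK = Emb EK
        module ER = Emb ER
        P′ = remove P u (length X)
        atX : V → ℕ → Set
        atX v a = Σ[ j ∈ Fin (length X) ] lookup X j ≡ v × u + toℕ j ≡ a
        at : V → ℕ → Set
        at v a = atX v a ⊎ EA.at v a ⊎ EK.at v a ⊎ ER.at v a
        total : ∀ {v} → v ∈ C → ∃ (at v)
        total v∈ with cover v∈
        ... | inj₁ x = _ , inj₁ (index x , sym (lookup-index x) , refl)
        ... | inj₂ (inj₁ a) = let p , h = EA.total a in p , inj₂ (inj₁ h)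
        ... | inj₂ (inj₂ (inj₁ a)) = let p , h = EK.total a in p , inj₂ (inj₂ (inj₁ h))
        ... | inj₂ (inj₂ (inj₂ a)) = let p , h = ER.total a in p , inj₂ (inj₂ (inj₂ h))
        X-range : ∀ (j : Fin (length X)) → toℕ j < q
        X-range j = ≤-trans (Fin.toℕ<n j) sizeX
        sound : ∀ {v a} → at v a → v ∈ C × s ≤ a × a < e × P a ≡ true
        sound (inj₁ (j , refl , refl)) = X⊆ (∈-lookup j) , ≤-trans s≤u (m≤m+n u _) ,
          <-≤-trans (+-monoʳ-< u (X-range j)) uq≤e , free _ (m≤m+n u _) (+-monoʳ-< u (Fin.toℕ<n j))
        sound (inj₂ (inj₁ h)) = let c , a , b , p = EA.sound h in
          A⊆ c , ≤-trans s₁ a , <-≤-trans b e₁ , remove-sub P {u} p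
        sound (inj₂ (inj₂ (inj₁ h))) = let c , a , b , p = EK.sound h in
          K⊆ c , ≤-trans s₂ a , <-≤-trans b e₂ , remove-sub P {u} p
        sound (inj₂ (inj₂ (inj₂ h))) = let c , a , b , p = ER.sound h in
          R⊆ c , ≤-trans s₃ a , <-≤-trans b e₃ , remove-sub P {u} p
        X∩ : ∀ {v a} → atX v a → P′ a ≡ true → ⊥
        X∩ (j , _ , refl) p with () ← trans (sym p) (remove-inside P {u} (m≤m+n u _) (+-monoʳ-< u (Fin.toℕ<n j)))
        A∩K : ∀ {v v′ a} → EA.at v a → EK.at v′ a → ⊥
        A∩K h k = let _ , a , b , _ = EA.sound h ; _ , c , d , _ = EK.sound k in d₁₂ a b c d
        A∩R : ∀ {v v′ a} → EA.at v a → ER.at v′ a → ⊥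
        A∩R h k = let _ , a , b , _ = EA.sound h ; _ , c , d , _ = ER.sound k in d₁₃ a b c d
        K∩R : ∀ {v v′ a} → EK.at v a → ER.at v′ a → ⊥
        K∩R h k = let _ , a , b , _ = EK.sound h ; _ , c , d , _ = ER.sound k in d₂₃ a b c d
        inj : ∀ {v v′ a} → at v a → at v′ a → v ≡ v′
        inj (inj₁ (j , refl , refl)) (inj₁ (j′ , refl , eq)) =
          cong (lookup X) (sym (Fin.toℕ-injective (+-cancelˡ-≡ u _ _ eq)))
        inj (inj₁ x) (inj₂ (inj₁ h)) = ⊥-elim (X∩ x (proj₂ (proj₂ (proj₂ (EA.sound h)))))
        inj (inj₁ x) (inj₂ (inj₂ (inj₁ h))) = ⊥-elim (X∩ x (proj₂ (proj₂ (proj₂ (EK.sound h)))))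
        inj (inj₁ x) (inj₂ (inj₂ (inj₂ h))) = ⊥-elim (X∩ x (proj₂ (proj₂ (proj₂ (ER.sound h)))))
        inj (inj₂ (inj₁ h)) (inj₁ x) = ⊥-elim (X∩ x (proj₂ (proj₂ (proj₂ (EA.sound h)))))
        inj (inj₂ (inj₂ (inj₁ h))) (inj₁ x) = ⊥-elim (X∩ x (proj₂ (proj₂ (proj₂ (EK.sound h)))))
        inj (inj₂ (inj₂ (inj₂ h))) (inj₁ x) = ⊥-elim (X∩ x (proj₂ (proj₂ (proj₂ (ER.sound h)))))
        inj (inj₂ (inj₁ h)) (inj₂ (inj₁ k)) = EA.inj h k
        inj (inj₂ (inj₁ h)) (inj₂ (inj₂ (inj₁ k))) = ⊥-elim (A∩K h k)
        inj (inj₂ (inj₁ h)) (inj₂ (inj₂ (inj₂ k))) = ⊥-elim (A∩R h k)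
        inj (inj₂ (inj₂ (inj₁ h))) (inj₂ (inj₁ k)) = ⊥-elim (A∩K k h)
        inj (inj₂ (inj₂ (inj₁ h))) (inj₂ (inj₂ (inj₁ k))) = EK.inj h k
        inj (inj₂ (inj₂ (inj₁ h))) (inj₂ (inj₂ (inj₂ k))) = ⊥-elim (K∩R h k)
        inj (inj₂ (inj₂ (inj₂ h))) (inj₂ (inj₁ k)) = ⊥-elim (A∩R k h)
        inj (inj₂ (inj₂ (inj₂ h))) (inj₂ (inj₂ (inj₁ k))) = ⊥-elim (K∩R k h)
        inj (inj₂ (inj₂ (inj₂ h))) (inj₂ (inj₂ (inj₂ k))) = ER.inj h k
        Xedge : ∀ {v v′ a a′} → atX v a → at v′ a′ → Adj a a′
        Xedge (j , _ , refl) h = let _ , a , b , _ = sound h in adj (X-range j) a b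
        edge : ∀ {v v′ a a′} → at v a → at v′ a′ → v ~ v′ → Adj a a′
        edge (inj₁ x) h _ = Xedge x h
        edge h@(inj₂ _) (inj₁ x) _ = Adj-sym (Xedge x h)
        edge (inj₂ (inj₁ h)) (inj₂ (inj₁ k)) = EA.edge h k
        edge (inj₂ (inj₁ h)) (inj₂ (inj₂ (inj₁ k))) e = ⊥-elim (A≁K (proj₁ (EA.sound h)) (proj₁ (EK.sound k)) e)
        edge (inj₂ (inj₁ h)) (inj₂ (inj₂ (inj₂ k))) e = ⊥-elim (A≁R (proj₁ (EA.sound h)) (proj₁ (ER.sound k)) e)
        edge (inj₂ (inj₂ (inj₁ h))) (inj₂ (inj₁ k)) e = ⊥-elim (A≁K (proj₁ (EA.sound k)) (proj₁ (EK.sound h)) (~-sym e))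
        edge (inj₂ (inj₂ (inj₁ h))) (inj₂ (inj₂ (inj₁ k))) = EK.edge h k
        edge (inj₂ (inj₂ (inj₁ h))) (inj₂ (inj₂ (inj₂ k))) e = ⊥-elim (K≁R (proj₁ (EK.sound h)) (proj₁ (ER.sound k)) e)
        edge (inj₂ (inj₂ (inj₂ h))) (inj₂ (inj₁ k)) e = ⊥-elim (A≁R (proj₁ (EA.sound k)) (proj₁ (ER.sound h)) (~-sym e))
        edge (inj₂ (inj₂ (inj₂ h))) (inj₂ (inj₂ (inj₁ k))) e = ⊥-elim (K≁R (proj₁ (EK.sound k)) (proj₁ (ER.sound h)) (~-sym e))
        edge (inj₂ (inj₂ (inj₂ h))) (inj₂ (inj₂ (inj₂ k))) = ER.edge h k

-- One bag on one block: splitting an interval into three.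

module Splitting where
  open import Data.Bool using (Bool; true; false)
  open import Data.List using (List; []; _∷_; length)
  open import Data.List.Membership.Propositional using (_∈_)
  open import Data.List.Relation.Unary.Any using (here; there)
  open import Data.List.Relation.Unary.Unique.Propositional using (Unique)
  open import Data.Nat
  open import Data.Nat.Properties
  open LinearArithmetic
  open Placements

  module Steps
    {V : Set} (_~_ : V → V → Set) (~-sym : ∀ {a b} → a ~ b → b ~ a)
    (Adj : ℕ → ℕ → Set) (Adj-sym : ∀ {a b} → Adj a b → Adj b a)
    (q : ℕ) (1≤q : 1 ≤ q) (sep : ∀ C i → Unique C → i + q ≤ length C → Sep _~_ q C i)
    where
    open Embedding _~_ ~-sym Adj Adj-sym

    -- An equality, so that a part uses every free position of its interval and the ends of the
    -- parts can be read off from `cnt`.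
    Fills : List V → (ℕ → Bool) → ℕ → ℕ → Set
    Fills C P s e = length C + cnt P s ≡ cnt P e

    emb-local : ∀ C P s e → s ≤ e → Fills C P s e →
                (∀ {a b} → s ≤ a → a < e → s ≤ b → b < e → Adj a b) → Emb C P s e
    emb-local [] P s e s≤e len adj = record
      { at = λ _ _ → ⊥ ; total = λ () ; sound = λ () ; inj = λ () ; edge = λ () }
    emb-local (v ∷ C) P s e s≤e len adj with m≤n⇒m<n∨m≡n s≤e
    ... | inj₂ refl = ⊥-elim (m≢1+n+m (cnt P s) (sym len))
    ... | inj₁ (s≤s {n = e′} s≤e′) with P e′ in eq
    ...   | false = record { at = E.at ; total = E.total ; sound = λ h → let c , a , b , p = E.sound h in c , a , m≤n⇒m≤1+n b , p
                           ; inj = E.inj ; edge = E.edge }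
            where module E = Emb (emb-local (v ∷ C) P s e′ s≤e′ len (λ a b c d → adj a (m≤n⇒m≤1+n b) c (m≤n⇒m≤1+n d)))
    ...   | true = record { at = at ; total = total ; sound = sound ; inj = inj
                          ; edge = λ h k _ → let _ , a , b , _ = sound h ; _ , c , d , _ = sound k in adj a b c d }
            where
            module E = Emb (emb-local C P s e′ s≤e′ (suc-injective len) (λ a b c d → adj a (m≤n⇒m≤1+n b) c (m≤n⇒m≤1+n d)))
            at : V → ℕ → Set
            at w a = (w ≡ v × a ≡ e′) ⊎ E.at w a
            total : ∀ {w} → w ∈ v ∷ C → ∃ (at w)
            total (here refl) = e′ , inj₁ (refl , refl)
            total (there w∈)  = let a , h = E.total w∈ in a , inj₂ h
            sound : ∀ {w a} → at w a → w ∈ v ∷ C × s ≤ a × a < suc e′ × P a ≡ true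
            sound (inj₁ (refl , refl)) = here refl , s≤e′ , ≤-refl , eq
            sound (inj₂ h) = let c , a , b , p = E.sound h in there c , a , m≤n⇒m≤1+n b , p
            inj : ∀ {w w′ a} → at w a → at w′ a → w ≡ w′
            inj (inj₁ (refl , refl)) (inj₁ (refl , _)) = refl
            inj (inj₁ (refl , refl)) (inj₂ h) = ⊥-elim (<-irrefl refl (proj₁ (proj₂ (proj₂ (E.sound h)))))
            inj (inj₂ h) (inj₁ (refl , refl)) = ⊥-elim (<-irrefl refl (proj₁ (proj₂ (proj₂ (E.sound h)))))
            inj (inj₂ h) (inj₂ k) = E.inj h k

    -- Z y B s e bounds how a part with positions in [s , e) may straddle the
    -- block at y: twice the overhang on one side plus the overhang on the other
    -- side is at most B, up to O(q).
    Z : ℕ → ℕ → ℕ → ℕ → Set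
    Z y B s e = (y + e ≤ 2 * s + B + 18 * q) ⊎ (2 * e ≤ y + s + B + 18 * q)

    -- Positions within 4 q of either end may be occupied: this absorbs a block that
    -- is overrun only slightly.
    Free : (ℕ → Bool) → ℕ → ℕ → (ℕ → Set) → Set
    Free P s e B = ∀ x → s + 4 * q ≤ x → x + 4 * q < e → ¬ B x → P x ≡ true

    Block : ℕ → ℕ → Set
    Block u x = u ≤ x × x < u + q

    None : ℕ → Set
    None _ = ⊥

    -- What a lower level of the hierarchy offers to the next one: `D` describes the intervals it
    -- can deal with, `B` the block inside them that may be occupied.
    Handler : (ℕ → ℕ → Set) → (ℕ → Set) → Set₁
    Handler D B = ∀ C P s e → Unique C → s ≤ e → Fills C P s e → Free P s e B → D s e → Emb C P s e

    -- A bag is placed on the block at u.  The part K straddling u is laid out around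
    -- that block, unless it also overruns the occupied block at y; but then it starts
    -- so close to u that y takes over the role of u.
    module StepLeft
      {T} u y (B : ℕ → Set) (y≡ : y ≡ u + T) (T≥ : 8 * q ≤ T) (B⊆ : ∀ {x} → B x → Block y x)
      C P s e (uC : Unique C) (len : Fills C P s e) (free : Free P s e B)
      (su : s + 4 * q ≤ u) (ue : u + q + 4 * q ≤ e) (uT : u ≤ s + T + 4 * q)
      where
      -- The four handlers serve `A` left of `u`; a `K` that straddles `u` and ends before or near
      -- `y`; a piece that has left `u` behind but starts no later than the end of the block at `y`
      -- (an overrunning `K`, or `R`); and an `R` that starts beyond that block.
      Goal : Set₁
      Goal = (∀ {j a} → j < q → s ≤ a → a < e → Adj (u + j) a) →
        Handler (λ s′ z → s ≤ s′ × z ≤ u) None →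
        Handler (λ z₁ z₂ → s ≤ z₁ × z₂ ≤ e × z₁ ≤ u × u ≤ z₂ × z₂ ≤ y + 4 * q × Z u T z₁ z₂) (Block u) →
        Handler (λ z₁ z₂ → s ≤ z₁ × z₂ ≤ e × u + q ≤ z₁ + 4 * q × (z₂ ≡ e ⊎ y + 4 * q < z₂) × z₁ ≤ y + q) B →
        Handler (λ z e′ → y + q < z × e′ ≡ e) B →
        Emb C P s e

      u≤e : u ≤ e
      u≤e = ((u ≤ e) ∋ lin ue (solve 3 (λ u q e → u :+ e :+ 5 :* q ⊜ e :+ (u :+ q :+ 4 :* q)) refl u q e))
      s≤u : s ≤ u
      s≤u = m+n≤o⇒m≤o s su
      s≤e : s ≤ e
      s≤e = ≤-trans s≤u u≤e
      block-free : ∀ x → u ≤ x → x < u + q → P x ≡ true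
      block-free x ux xu = free x (≤-trans su ux)
        ((x + 4 * q < e) ∋ lin (xu ⊕ ue)
            (solve 4 (λ u q e x → (con 1 :+ (x :+ 4 :* q)) :+ (u :+ q :+ e) :+ con 0 ⊜ e :+ ((con 1 :+ x) :+ (u :+ q :+ 4 :* q))) refl u q e x))
        (λ b → <⇒≱ xu (≤-trans ((u + q ≤ y) ∋ lin (≡⇒≥ y≡ ⊕ T≥)
            (solve 4 (λ u q T y → u :+ q :+ (y :+ T) :+ 7 :* q ⊜ y :+ (u :+ T :+ 8 :* q)) refl u q T y)) (proj₁ (B⊆ b))))
      -- `C` fills both the `i` free positions left of `u` and the `q` free positions of the block.
      i+q≤ : ∀ {i} → i + cnt P s ≡ cnt P u → i + q ≤ length C
      i+q≤ {i} i-eq = let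
                 h = cnt-lower P (m≤m+n u q) block-free
                 m = cnt-mono P {u + q} {e} (m+n≤o⇒m≤o (u + q) ue) in
        ((i + q ≤ length C) ∋ lin (h ⊕ m ⊕ ≡⇒≥ len ⊕ ≡⇒≤ i-eq)
            (solve 8 (λ i q l a b c d u → i :+ q :+ (c :+ u :+ d :+ (l :+ a) :+ b) :+ con 0
              ⊜ l :+ (b :+ (u :+ q) :+ c :+ d :+ (i :+ a))) refl i q (length C) (cnt P s) (cnt P u) (cnt P (u + q)) (cnt P e) u))

      module Parts (i : ℕ) (i-eq : i + cnt P s ≡ cnt P u) (S : Sep _~_ q C i) where
        open Sep S
        x = length X
        P′ = remove P u x
        freeX : ∀ y → u ≤ y → y < u + x → P y ≡ true
        freeX y a b = block-free y a (<-≤-trans b (+-monoʳ-≤ u sizeX))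
        cs : cnt P′ s ≡ cnt P s
        cs = cnt-remove-below P {u} {x} s≤u
        cu : cnt P′ u ≡ cnt P u
        cu = cnt-remove-below P {u} {x} ≤-refl
        ce : cnt P′ e + x ≡ cnt P e
        ce = cnt-remove-above P {u} {x} (≤-trans (+-monoʳ-≤ u sizeX) (m+n≤o⇒m≤o (u + q) ue)) freeX

        module Cuts (z₁ z₂ : ℕ) (s≤z₁ : s ≤ z₁) (z₁≤u : z₁ ≤ u) (u≤z₂ : u ≤ z₂) (z₂≤e : z₂ ≤ e)
          (c₁ : cnt P′ z₁ ≡ length A + cnt P s) (c₂ : cnt P′ z₂ ≡ length A + length K + cnt P s) where
          z₁≤z₂ = ≤-trans z₁≤u u≤z₂
          i≤ : i + s ≤ u
          i≤ = let h = cnt-upper P s≤u in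
            ((i + s ≤ u) ∋ lin (≡⇒≤ i-eq ⊕ h)
                (solve 5 (λ i s u a b → i :+ s :+ (b :+ (a :+ u)) :+ con 0 ⊜ u :+ (i :+ a :+ (b :+ s))) refl i s u (cnt P s) (cnt P u)))
          before : ∀ x → s + 4 * q ≤ x → x < u → P′ x ≡ true
          before x a b = trans (remove-below P {u} {length X} b) (free x a
            ((x + 4 * q < e) ∋ lin (b ⊕ ue)
                (solve 4 (λ x q u e → (con 1 :+ (x :+ 4 :* q)) :+ (u :+ e) :+ q ⊜ e :+ ((con 1 :+ x) :+ (u :+ q :+ 4 :* q))) refl x q u e))
            (λ h → <⇒≱ b (≤-trans ((u ≤ y) ∋ lin (≡⇒≥ y≡) (solve 3 (λ y u T → u :+ y :+ T ⊜ y :+ (u :+ T)) refl y u T)) (proj₁ (B⊆ h)))))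
          after : ∀ x → u + q ≤ x → x + 4 * q < e → ¬ B x → P′ x ≡ true
          after x a b nb = trans (remove-above P {u} {length X} (≤-trans (+-monoʳ-≤ u sizeX) a))
            (free x (≤-trans su (≤-trans (m≤m+n u q) a)) b nb)

          lenK : Fills K P′ z₁ z₂
          lenK = trans (cong (length K +_) c₁) (trans
            (solve 3 (λ k a c → k :+ (a :+ c) ⊜ a :+ k :+ c) refl (length K) (length A) (cnt P s)) (sym c₂))

          -- Except near `s`, all positions left of `u` are free, so `K` overhangs `u` exactly by
          -- the `i - length A` positions that `A` leaves over.
          left-overhang : (z₁ ≤ s + 4 * q) ⊎ (u + length A ≤ i + z₁)
          left-overhang with ≤-total z₁ (s + 4 * q)
          ... | inj₁ h = inj₁ h
          ... | inj₂ h = inj₂ (let g = cnt-lower P′ z₁≤u (λ x a b → before x (≤-trans h a) b) in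
            ((u + length A ≤ i + z₁) ∋ lin (g ⊕ ≡⇒≤ cu ⊕ ≡⇒≥ i-eq ⊕ ≡⇒≥ c₁)
                (solve 8 (λ u a i z s c c′ d → u :+ a :+ (c′ :+ z :+ c :+ (i :+ s) :+ d) :+ con 0
                  ⊜ i :+ z :+ (d :+ u :+ c′ :+ c :+ (a :+ s))) refl u (length A) i z₁ (cnt P s) (cnt P u) (cnt P′ u) (cnt P′ z₁))))

          lenR : Fills R P′ z₂ e
          lenR = ≤-antisym
            ((length R + cnt P′ z₂ ≤ cnt P′ e) ∋ lin (≡⇒≤ sizes ⊕ ≡⇒≤ len ⊕ ≡⇒≥ ce ⊕ ≡⇒≤ c₂)
                (solve 9 (λ X A K R C s e e′ z → R :+ z :+ (C :+ e :+ (e′ :+ X) :+ (A :+ K :+ s)) :+ con 0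
                  ⊜ e′ :+ (X :+ A :+ K :+ R :+ (C :+ s) :+ e :+ z)) refl (length X) (length A) (length K) (length R) (length C) (cnt P s) (cnt P e) (cnt P′ e) (cnt P′ z₂)))
            ((cnt P′ e ≤ length R + cnt P′ z₂) ∋ lin (≡⇒≥ sizes ⊕ ≡⇒≥ len ⊕ ≡⇒≤ ce ⊕ ≡⇒≥ c₂)
                (solve 9 (λ X A K R C s e e′ z → e′ :+ (X :+ A :+ K :+ R :+ (C :+ s) :+ e :+ z) :+ con 0
                  ⊜ R :+ z :+ (C :+ e :+ (e′ :+ X) :+ (A :+ K :+ s))) refl (length X) (length A) (length K) (length R) (length C) (cnt P s) (cnt P e) (cnt P′ e) (cnt P′ z₂)))
          uq≤z₂ : u + q ≤ z₂ + 4 * q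
          uq≤z₂ = ((u + q ≤ z₂ + 4 * q) ∋ lin u≤z₂ (solve 3 (λ u q z → u :+ q :+ z :+ 3 :* q ⊜ z :+ 4 :* q :+ u) refl u q z₂))
          frR : Free P′ z₂ e B
          frR x a b nb = after x (≤-trans uq≤z₂ a) b nb
          module Straddle (z₂≤y : z₂ ≤ y + 4 * q) where
            fr : Free P′ z₁ z₂ (Block u)
            fr x a b nb with x <? u
            ... | yes x<u = before x (≤-trans (+-monoˡ-≤ (4 * q) s≤z₁) a) x<u
            ... | no  x≮u = after x (≮⇒≥ (λ x<uq → nb (≮⇒≥ x≮u , x<uq))) (<-≤-trans b z₂≤e)
              (λ bx → <⇒≱ (<-≤-trans b z₂≤y) (+-monoˡ-≤ (4 * q) (proj₁ (B⊆ bx))))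
            -- `K` has `length A + length K - i` vertices from `u` on. Free positions up to `z₂` can
            -- be missing only on the block and within 4 q of `z₂`, which costs at most 5 q.
            right : z₂ + i ≤ u + length A + length K + 6 * q
            right with ≤-total z₂ (u + q + 4 * q)
            ... | inj₁ h = ((z₂ + i ≤ u + length A + length K + 6 * q) ∋ lin (h ⊕ i≤AK)
                (solve 6 (λ z i u q a k → z :+ i :+ (u :+ q :+ 4 :* q :+ (a :+ k)) :+ q
                  ⊜ u :+ a :+ k :+ 6 :* q :+ (z :+ i)) refl z₂ i u q (length A) (length K)))
            ... | inj₂ h = let w = z₂ ∸ 4 * q
                               w-eq : w + 4 * q ≡ z₂
                               w-eq = m∸n+n≡m (≤-trans (m≤n+m (4 * q) (u + q)) h)
                               uq≤w : u + q ≤ w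
                               uq≤w = ((u + q ≤ w) ∋ lin (≡⇒≥ w-eq ⊕ h)
                                   (solve 4 (λ u q w z → u :+ q :+ (w :+ 4 :* q :+ z) :+ con 0 ⊜ w :+ (z :+ (u :+ q :+ 4 :* q))) refl u q w z₂))
                               g = cnt-lower P′ uq≤w (λ x a b → after x a
                                     (<-≤-trans (+-monoˡ-< (4 * q) b) (≤-trans (≤-reflexive w-eq) z₂≤e))
                                     (λ bx → <⇒≱ b (≤-trans ((w ≤ y) ∋ lin (≡⇒≤ w-eq ⊕ z₂≤y)
                                         (solve 4 (λ w y q z → w :+ (z :+ (y :+ 4 :* q)) :+ con 0 ⊜ y :+ (w :+ 4 :* q :+ z)) refl w y q z₂)) (proj₁ (B⊆ bx)))))
                               m₁ = cnt-mono P′ {u} {u + q} (m≤m+n u q)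
                               m₂ = cnt-mono P′ {w} {z₂} (≤-trans (m≤m+n w _) (≤-reflexive w-eq))
              in ((z₂ + i ≤ u + length A + length K + 6 * q) ∋ lin (≡⇒≥ w-eq ⊕ g ⊕ m₁ ⊕ m₂ ⊕ ≡⇒≥ cu ⊕ ≡⇒≤ i-eq ⊕ ≡⇒≤ c₂)
                  (solve 13 (λ z i u q a k w cu cu′ cuq cw cz cs → z :+ i :+ (w :+ 4 :* q :+ (cw :+ (u :+ q)) :+ cuq :+ cz :+ cu′ :+ cu :+ (a :+ k :+ cs)) :+ q
                    ⊜ u :+ a :+ k :+ 6 :* q :+ (z :+ (cuq :+ w) :+ cu′ :+ cw :+ cu :+ (i :+ cs) :+ cz)) refl z₂ i u q (length A) (length K) w (cnt P u) (cnt P′ u) (cnt P′ (u + q)) (cnt P′ w) (cnt P′ z₂) (cnt P s)))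
            left : u + length A ≤ i + z₁ + 4 * q
            left with left-overhang
            ... | inj₂ h = ≤-trans h (m≤m+n _ _)
            ... | inj₁ h = let g = cnt-lower P′ {s + 4 * q} {u} su before
                               m = cnt-mono P′ {s} {s + 4 * q} (m≤m+n s _)
                               n = cnt-upper P′ s≤z₁
              in ((u + length A ≤ i + z₁ + 4 * q) ∋ lin (g ⊕ m ⊕ n ⊕ ≡⇒≤ cu ⊕ ≡⇒≥ i-eq ⊕ ≡⇒≥ c₁)
                  (solve 12 (λ u a i z q s c c′ d cu cu′ cz → u :+ a :+ (cu′ :+ (s :+ 4 :* q) :+ d :+ (c′ :+ z) :+ cu :+ (i :+ c) :+ cz) :+ con 0
                    ⊜ i :+ z :+ 4 :* q :+ (d :+ u :+ c′ :+ (cz :+ s) :+ cu′ :+ cu :+ (a :+ c))) refl u (length A) i z₁ q s (cnt P s) (cnt P′ s) (cnt P′ (s + 4 * q)) (cnt P u) (cnt P′ u) (cnt P′ z₁)))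
            -- The left overhang is about `i - length A` and the right one
            -- `length A + length K - i`, so twice the left plus the right is
            -- `i + length K - length A`. If `K` is no larger than `A`, this is at most `i`, hence
            -- at most T. In the other case the right overhang is O(q) and the left one at most T,
            -- so the doubled side is exchanged. The 18 q is 6 + 2⋅4 + 4 in the first case and 2⋅6 +
            -- 2 + 4 in the second.
            zz : Z u T z₁ z₂
            zz with straddle
            ... | inj₁ k≤a = inj₁
              ((u + z₂ ≤ 2 * z₁ + T + 18 * q) ∋ lin (right ⊕ 2 ⊗ left ⊕ i≤ ⊕ uT ⊕ k≤a)
                  (solve 9 (λ u z w T q a k i s → u :+ z :+ (u :+ a :+ k :+ 6 :* q :+ 2 :* (i :+ w :+ 4 :* q) :+ u :+ (s :+ T :+ 4 :* q) :+ a) :+ con 0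
                    ⊜ 2 :* w :+ T :+ 18 :* q :+ (z :+ i :+ 2 :* (u :+ a) :+ (i :+ s) :+ u :+ k)) refl u z₂ z₁ T q (length A) (length K) i s))
            ... | inj₂ ak<i = inj₂
              ((2 * z₂ ≤ u + z₁ + T + 18 * q) ∋ lin (2 ⊗ right ⊕ 2 ⊗ ak<i ⊕ uT ⊕ s≤z₁)
                  (solve 9 (λ u z w T q a k i s → 2 :* z :+ (2 :* (u :+ a :+ k :+ 6 :* q) :+ 2 :* (i :+ q) :+ (s :+ T :+ 4 :* q) :+ w) :+ con 2
                    ⊜ u :+ w :+ T :+ 18 :* q :+ (2 :* (z :+ i) :+ 2 :* (con 1 :+ (a :+ k)) :+ u :+ s)) refl u z₂ z₁ T q (length A) (length K) i s))

          module Overshoot (y<z₂ : y + 4 * q < z₂) where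
            uq≤y : u + q ≤ y
            uq≤y = ((u + q ≤ y) ∋ lin (≡⇒≥ y≡ ⊕ T≥) (solve 4 (λ u q T y → u :+ q :+ (y :+ T) :+ 7 :* q ⊜ y :+ (u :+ T :+ 8 :* q)) refl u q T y))
            y≤z₂ : y ≤ z₂
            y≤z₂ = ≤-trans (m≤m+n y _) (<⇒≤ y<z₂)
            m₁ = cnt-mono P′ {u} {u + q} (m≤m+n u q)
            gap = cnt-lower P′ uq≤y (λ x a b → after x a (<-trans (+-monoˡ-< (4 * q) b) (<-≤-trans y<z₂ z₂≤e))
                    (λ bx → <⇒≱ b (proj₁ (B⊆ bx))))
            middle : i + y ≤ length A + length K + u + q
            middle = let m₂ = cnt-mono P′ y≤z₂ in
              ((i + y ≤ length A + length K + u + q) ∋ lin (gap ⊕ m₁ ⊕ m₂ ⊕ ≡⇒≥ cu ⊕ ≡⇒≤ i-eq ⊕ ≡⇒≤ c₂)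
                  (solve 12 (λ i y u q a k cu cu′ cuq cy cz cs → i :+ y :+ (cy :+ (u :+ q) :+ cuq :+ cz :+ cu′ :+ cu :+ (a :+ k :+ cs)) :+ con 0
                    ⊜ a :+ k :+ u :+ q :+ (cuq :+ y :+ cu′ :+ cy :+ cu :+ (i :+ cs) :+ cz)) refl i y u q (length A) (length K) (cnt P u) (cnt P′ u) (cnt P′ (u + q)) (cnt P′ y) (cnt P′ z₂) (cnt P s)))
            right : z₂ + i ≤ u + length A + length K + 6 * q
            right with ≤-total z₂ (y + q + 4 * q)
            ... | inj₁ h = ((z₂ + i ≤ u + length A + length K + 6 * q) ∋ lin (h ⊕ middle)
                (solve 7 (λ z i y u q a k → z :+ i :+ (y :+ q :+ 4 :* q :+ (a :+ k :+ u :+ q)) :+ con 0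
                  ⊜ u :+ a :+ k :+ 6 :* q :+ (z :+ (i :+ y))) refl z₂ i y u q (length A) (length K)))
            ... | inj₂ h = let w = z₂ ∸ 4 * q
                               w-eq : w + 4 * q ≡ z₂
                               w-eq = m∸n+n≡m (≤-trans (m≤n+m (4 * q) (y + q)) h)
                               yq≤w : y + q ≤ w
                               yq≤w = ((y + q ≤ w) ∋ lin (≡⇒≥ w-eq ⊕ h)
                                   (solve 4 (λ u q w z → u :+ q :+ (w :+ 4 :* q :+ z) :+ con 0 ⊜ w :+ (z :+ (u :+ q :+ 4 :* q))) refl y q w z₂))
                               g = cnt-lower P′ yq≤w (λ x a b → after x (≤-trans uq≤y (≤-trans (m≤m+n y q) a))
                                     (<-≤-trans (+-monoˡ-< (4 * q) b) (≤-trans (≤-reflexive w-eq) z₂≤e))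
                                     (λ bx → <⇒≱ (proj₂ (B⊆ bx)) a))
                               m₂ = cnt-mono P′ {w} {z₂} (≤-trans (m≤m+n w _) (≤-reflexive w-eq))
                               m₃ = cnt-mono P′ {y} {y + q} (m≤m+n y q)
              in ((z₂ + i ≤ u + length A + length K + 6 * q) ∋ lin (≡⇒≥ w-eq ⊕ g ⊕ m₁ ⊕ m₂ ⊕ m₃ ⊕ gap ⊕ ≡⇒≥ cu ⊕ ≡⇒≤ i-eq ⊕ ≡⇒≤ c₂)
                  (solve 16 (λ z i u q y a k w cu cu′ cuq cy cyq cw cz cs → z :+ i :+ (w :+ 4 :* q :+ (cw :+ (y :+ q)) :+ cuq :+ cz :+ cyq :+ (cy :+ (u :+ q)) :+ cu′ :+ cu :+ (a :+ k :+ cs)) :+ con 0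
                    ⊜ u :+ a :+ k :+ 6 :* q :+ (z :+ (cyq :+ w) :+ cu′ :+ cw :+ cy :+ (cuq :+ y) :+ cu :+ (i :+ cs) :+ cz)) refl z₂ i u q y (length A) (length K) w (cnt P u) (cnt P′ u) (cnt P′ (u + q)) (cnt P′ y) (cnt P′ (y + q)) (cnt P′ w) (cnt P′ z₂) (cnt P s)))
            -- An overrunning `K` has about T vertices more than fit on the left, which rules out
            -- the second case of `straddle`. In the first case twice the left overhang plus the
            -- right one is T + O(q); since the right overhang alone exceeds T + 4 q, hardly
            -- anything is left of `u`.
            close : u + q ≤ z₁ + 4 * q
            close with left-overhang | straddle
            ... | _ | inj₂ h = ⊥-elim (n≮0
              ((1 ≤ 0) ∋ lin (middle ⊕ h ⊕ T≥ ⊕ ≡⇒≥ y≡)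
                  (solve 7 (λ u T y q a k i → con 1 :+ (a :+ k :+ u :+ q :+ (i :+ q) :+ T :+ y) :+ 6 :* q
                    ⊜ con 0 :+ (i :+ y :+ (con 1 :+ (a :+ k)) :+ 8 :* q :+ (u :+ T))) refl u T y q (length A) (length K) i)))
            -- Here `A` has at most 4 q vertices, so T ≤ `length K` + q ≤ 5 q, against T ≥ 8 q.
            ... | inj₁ h | inj₁ k≤a = let n = cnt-upper P′ s≤z₁ in ⊥-elim (n≮0
              ((1 ≤ 0) ∋ lin (7 ⊗ middle ⊕ 7 ⊗ k≤a ⊕ 7 ⊗ T≥ ⊕ 7 ⊗ ≡⇒≥ y≡ ⊕ 7 ⊗ h ⊕ 7 ⊗ n ⊕ 7 ⊗ ≡⇒≤ cs ⊕ 7 ⊗ ≡⇒≥ c₁ ⊕ 7 ⊗ A≤i ⊕ 21 ⊗ 1≤q)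
                  (solve 12 (λ u T y q a k i s z c c′ d → con 1 :+ (7 :* (a :+ k :+ u :+ q) :+ 7 :* a :+ 7 :* T :+ 7 :* y :+ 7 :* (s :+ 4 :* q) :+ 7 :* (c′ :+ z) :+ 7 :* c :+ 7 :* d :+ 7 :* i :+ 21 :* q) :+ con 20
                    ⊜ con 0 :+ (7 :* (i :+ y) :+ 7 :* k :+ 7 :* (8 :* q) :+ 7 :* (u :+ T) :+ 7 :* z :+ 7 :* (d :+ s) :+ 7 :* c′ :+ 7 :* (a :+ c) :+ 7 :* a :+ (21 :* con 1))) refl u T y q (length A) (length K) i s z₁ (cnt P s) (cnt P′ s) (cnt P′ z₁))))
            ... | inj₂ h | inj₁ k≤a =
              ((u + q ≤ z₁ + 4 * q) ∋ lin* 1 (right ⊕ k≤a ⊕ ≡⇒≥ y≡ ⊕ 2 ⊗ h ⊕ i≤ ⊕ uT ⊕ y<z₂)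
                  (solve 10 (λ u T y q a k i s z w → 2 :* (u :+ q) :+ (u :+ a :+ k :+ 6 :* q :+ a :+ y :+ 2 :* (i :+ z) :+ u :+ (s :+ T :+ 4 :* q) :+ w) :+ con 2
                    ⊜ 2 :* (z :+ 4 :* q) :+ (w :+ i :+ k :+ (u :+ T) :+ 2 :* (u :+ a) :+ (i :+ s) :+ u :+ (con 1 :+ (y :+ 4 :* q))) :+ con 1) refl u T y q (length A) (length K) i s z₁ z₂))
            fr : Free P′ z₁ z₂ B
            fr x a b nb = after x (≤-trans close a) (<-≤-trans b z₂≤e) nb

          run : Goal
          run adj hA hK hH hR =
            combine S s≤u (≤-trans (m≤m+n (u + q) _) ue) freeX adj
              ≤-refl (≤-trans z₁≤u u≤e) s≤z₁ z₂≤e (≤-trans s≤u u≤z₂) ≤-refl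
              (λ _ a b _ → <⇒≱ a b) (λ _ a b _ → <⇒≱ a (≤-trans z₁≤z₂ b)) (λ _ a b _ → <⇒≱ a b)
              EA EK ER
            where
            EA = hA A P′ s z₁ uniqueA s≤z₁ (trans (cong (length A +_) cs) (sym c₁))
              (λ x a b _ → before x a (<-≤-trans (≤-<-trans (m≤m+n x _) b) z₁≤u)) (≤-refl , z₁≤u)
            EK : Emb K P′ z₁ z₂
            EK with ≤-<-connex z₂ (y + 4 * q)
            ... | inj₁ z₂≤y = let open Straddle z₂≤y in hK K P′ z₁ z₂ uniqueK z₁≤z₂ lenK fr
                  (s≤z₁ , z₂≤e , z₁≤u , u≤z₂ , z₂≤y , zz)
            ... | inj₂ y<z₂ = let open Overshoot y<z₂ in hH K P′ z₁ z₂ uniqueK z₁≤z₂ lenK fr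
                  (s≤z₁ , z₂≤e , close , inj₂ y<z₂ , ≤-trans z₁≤u ((u ≤ y + q) ∋ lin (≡⇒≥ y≡)
                      (solve 4 (λ u y q T → u :+ y :+ (q :+ T) ⊜ y :+ q :+ (u :+ T)) refl u y q T)))
            ER : Emb R P′ z₂ e
            ER with ≤-<-connex z₂ (y + q)
            ... | inj₁ z₂≤yq = hH R P′ z₂ e uniqueR z₂≤e lenR frR (≤-trans s≤u u≤z₂ , ≤-refl , uq≤z₂ , inj₁ refl , z₂≤yq)
            ... | inj₂ yq<z₂ = hR R P′ z₂ e uniqueR z₂≤e lenR frR (yq<z₂ , refl)

        run : Goal
        run = let
            z₁ , s≤z₁ , z₁≤u , c₁ = cnt-attains P′ {s} {u} (length A + cnt P s) s≤u (≤-trans (≤-reflexive cs) (m≤n+m _ _))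
              (≤-trans (+-monoˡ-≤ (cnt P s) A≤i) (≤-reflexive (trans i-eq (sym cu))))
            z₂ , u≤z₂ , z₂≤e , c₂ = cnt-attains P′ {u} {e} (length A + length K + cnt P s) u≤e
              (≤-trans (≤-reflexive (trans cu (sym i-eq))) (+-monoˡ-≤ (cnt P s) i≤AK))
              ((length A + length K + cnt P s ≤ cnt P′ e) ∋ lin (≡⇒≤ sizes ⊕ ≡⇒≤ len ⊕ ≡⇒≥ ce)
                  (solve 8 (λ X A K R C s e e′ → A :+ K :+ s :+ (C :+ e :+ (e′ :+ X)) :+ R
                    ⊜ e′ :+ (X :+ A :+ K :+ R :+ (C :+ s) :+ e)) refl (length X) (length A) (length K) (length R) (length C) (cnt P s) (cnt P e) (cnt P′ e)))
          in Cuts.run z₁ z₂ s≤z₁ z₁≤u u≤z₂ z₂≤e c₁ c₂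

      run : Goal
      run = let i-eq = m∸n+n≡m (cnt-mono P s≤u) in Parts.run (cnt P u ∸ cnt P s) i-eq (sep C _ uC (i+q≤ i-eq))

    -- The reflection of `StepLeft`, with `i` the room right of the block. It is not a literal
    -- mirror image: a block extends to the right of its node, and the bag takes the leading
    -- positions of the block, so terms q shift.
    module StepRight
      {T} u y (B : ℕ → Set) (u≡ : u ≡ y + T) (T≥ : 8 * q ≤ T) (B⊆ : ∀ {x} → B x → Block y x)
      C P s e (uC : Unique C) (len : Fills C P s e) (free : Free P s e B)
      (su : s + 4 * q ≤ u) (ue : u + q + 4 * q ≤ e) (eT : e ≤ u + q + T + 4 * q)
      where
      Goal : Set₁
      Goal = (∀ {j a} → j < q → s ≤ a → a < e → Adj (u + j) a) →
        Handler (λ z e′ → e′ ≤ e × u + q ≤ z) None →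
        Handler (λ z₂ z₁ → s ≤ z₂ × z₁ ≤ e × z₂ ≤ u + q × u + q ≤ z₁ × y + q ≤ z₂ + 4 * q × Z u T z₂ z₁) (Block u) →
        Handler (λ z₂ z₁ → s ≤ z₂ × z₁ ≤ e × z₁ ≤ u + 4 * q × (z₂ ≡ s ⊎ z₂ + 4 * q < y + q) × y ≤ z₁) B →
        Handler (λ s′ z → z < y × s′ ≡ s) B →
        Emb C P s e

      uq≤e : u + q ≤ e
      uq≤e = m+n≤o⇒m≤o (u + q) ue
      s≤u : s ≤ u
      s≤u = m+n≤o⇒m≤o s su
      s≤uq : s ≤ u + q
      s≤uq = ≤-trans s≤u (m≤m+n u q)
      yq≤u : y + q ≤ u
      yq≤u = ((y + q ≤ u) ∋ lin (≡⇒≥ u≡ ⊕ T≥) (solve 4 (λ y u q T → y :+ q :+ (u :+ T) :+ 7 :* q ⊜ u :+ (y :+ T :+ 8 :* q)) refl y u q T))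
      block-free : ∀ x → u ≤ x → x < u + q → P x ≡ true
      block-free x ux xu = free x (≤-trans su ux)
        ((x + 4 * q < e) ∋ lin (xu ⊕ ue)
            (solve 4 (λ u q e x → (con 1 :+ (x :+ 4 :* q)) :+ (u :+ q :+ e) :+ con 0 ⊜ e :+ ((con 1 :+ x) :+ (u :+ q :+ 4 :* q))) refl u q e x))
        (λ b → <⇒≱ (proj₂ (B⊆ b)) (≤-trans yq≤u ux))
      i+q≤ : ∀ {i} → i + cnt P (u + q) ≡ cnt P e → i + q ≤ length C
      i+q≤ {i} i-eq = let
                 h = cnt-lower P (m≤m+n u q) block-free
                 m = cnt-mono P {s} {u} s≤u in
        ((i + q ≤ length C) ∋ lin (h ⊕ m ⊕ ≡⇒≥ len ⊕ ≡⇒≤ i-eq)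
            (solve 8 (λ i q l a b c d u → i :+ q :+ (c :+ u :+ b :+ (l :+ a) :+ d) :+ con 0
              ⊜ l :+ (b :+ (u :+ q) :+ a :+ d :+ (i :+ c))) refl i q (length C) (cnt P s) (cnt P u) (cnt P (u + q)) (cnt P e) u))

      module Parts (i : ℕ) (i-eq : i + cnt P (u + q) ≡ cnt P e) (S : Sep _~_ q C i) where
        open Sep S
        x = length X
        P′ = remove P u x
        ux≤uq : u + x ≤ u + q
        ux≤uq = +-monoʳ-≤ u sizeX
        freeX : ∀ y → u ≤ y → y < u + x → P y ≡ true
        freeX y a b = block-free y a (<-≤-trans b ux≤uq)
        cs : cnt P′ s ≡ cnt P s
        cs = cnt-remove-below P {u} {x} s≤u
        cu : cnt P′ u ≡ cnt P u
        cu = cnt-remove-below P {u} {x} ≤-refl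
        cq : cnt P′ (u + q) + x ≡ cnt P (u + q)
        cq = cnt-remove-above P {u} {x} ux≤uq freeX
        ce : cnt P′ e + x ≡ cnt P e
        ce = cnt-remove-above P {u} {x} (≤-trans ux≤uq uq≤e) freeX
        iq : i + cnt P′ (u + q) ≡ cnt P′ e
        iq = +-cancelʳ-≡ x _ _ (trans (+-assoc i _ x) (trans (cong (i +_) cq) (trans i-eq (sym ce))))

        module Cuts (z₁ z₂ : ℕ) (uq≤z₁ : u + q ≤ z₁) (z₁≤e : z₁ ≤ e) (s≤z₂ : s ≤ z₂) (z₂≤uq : z₂ ≤ u + q)
          (c₁ : length A + cnt P′ z₁ ≡ cnt P′ e) (c₂ : length A + length K + cnt P′ z₂ ≡ cnt P′ e) where
          z₂≤z₁ : z₂ ≤ z₁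
          z₂≤z₁ = ≤-trans z₂≤uq uq≤z₁
          i≤ : i + (u + q) ≤ e
          i≤ = let h = cnt-upper P′ uq≤e in
            ((i + (u + q) ≤ e) ∋ lin (≡⇒≤ iq ⊕ h)
                (solve 5 (λ i s u a b → i :+ s :+ (b :+ (a :+ u)) :+ con 0 ⊜ u :+ (i :+ a :+ (b :+ s))) refl i (u + q) e (cnt P′ (u + q)) (cnt P′ e)))
          before : ∀ x → s + 4 * q ≤ x → x < u → ¬ B x → P′ x ≡ true
          before x a b nb = trans (remove-below P {u} {length X} b) (free x a
            ((x + 4 * q < e) ∋ lin (b ⊕ ue)
                (solve 4 (λ x q u e → (con 1 :+ (x :+ 4 :* q)) :+ (u :+ e) :+ q ⊜ e :+ ((con 1 :+ x) :+ (u :+ q :+ 4 :* q))) refl x q u e)) nb)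
          after : ∀ x → u + q ≤ x → x + 4 * q < e → P′ x ≡ true
          after x a b = trans (remove-above P {u} {length X} (≤-trans ux≤uq a))
            (free x (≤-trans su (≤-trans (m≤m+n u q) a)) b
              (λ h → <⇒≱ (proj₂ (B⊆ h)) (≤-trans yq≤u (≤-trans (m≤m+n u q) a))))

          lenK : Fills K P′ z₂ z₁
          lenK = +-cancelˡ-≡ (length A) _ _ (trans (sym (+-assoc (length A) (length K) _)) (trans c₂ (sym c₁)))

          right-overhang : (e ≤ z₁ + 4 * q) ⊎ (z₁ + length A ≤ i + (u + q))
          right-overhang with ≤-total e (z₁ + 4 * q)
          ... | inj₁ h = inj₁ h
          ... | inj₂ h = inj₂ (let g = cnt-lower P′ uq≤z₁ (λ x a b → after x a (<-≤-trans (+-monoˡ-< (4 * q) b) h)) in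
            ((z₁ + length A ≤ i + (u + q)) ∋ lin (g ⊕ ≡⇒≥ iq ⊕ ≡⇒≤ c₁)
                (solve 7 (λ u a i z c d e → z :+ a :+ (d :+ u :+ (i :+ c) :+ e) :+ con 0
                  ⊜ i :+ u :+ (c :+ z :+ e :+ (a :+ d))) refl (u + q) (length A) i z₁ (cnt P′ (u + q)) (cnt P′ z₁) (cnt P′ e))))

          lenR : Fills R P′ s z₂
          lenR = ≤-antisym
            ((length R + cnt P′ s ≤ cnt P′ z₂) ∋ lin (≡⇒≤ sizes ⊕ ≡⇒≤ len ⊕ ≡⇒≥ ce ⊕ ≡⇒≤ cs ⊕ ≡⇒≥ c₂)
                (solve 10 (λ X A K R C s s′ e e′ z → R :+ s′ :+ (C :+ e :+ (e′ :+ X) :+ s :+ (A :+ K :+ z)) :+ con 0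
                  ⊜ z :+ (X :+ A :+ K :+ R :+ (C :+ s) :+ e :+ s′ :+ e′)) refl (length X) (length A) (length K) (length R) (length C) (cnt P s) (cnt P′ s) (cnt P e) (cnt P′ e) (cnt P′ z₂)))
            ((cnt P′ z₂ ≤ length R + cnt P′ s) ∋ lin (≡⇒≥ sizes ⊕ ≡⇒≥ len ⊕ ≡⇒≤ ce ⊕ ≡⇒≥ cs ⊕ ≡⇒≤ c₂)
                (solve 10 (λ X A K R C s s′ e e′ z → z :+ (X :+ A :+ K :+ R :+ (C :+ s) :+ e :+ s′ :+ e′) :+ con 0
                  ⊜ R :+ s′ :+ (C :+ e :+ (e′ :+ X) :+ s :+ (A :+ K :+ z))) refl (length X) (length A) (length K) (length R) (length C) (cnt P s) (cnt P′ s) (cnt P e) (cnt P′ e) (cnt P′ z₂)))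
          z₂≤u4q : z₂ ≤ u + 4 * q
          z₂≤u4q = ((z₂ ≤ u + 4 * q) ∋ lin z₂≤uq (solve 3 (λ u q z → z :+ (u :+ q) :+ 3 :* q ⊜ u :+ 4 :* q :+ z) refl u q z₂))
          frR : Free P′ s z₂ B
          frR x a b nb = before x a (+-cancelʳ-< (4 * q) x u (<-≤-trans b z₂≤u4q)) nb

          module Straddle (y≤z₂ : y + q ≤ z₂ + 4 * q) where
            fr : Free P′ z₂ z₁ (Block u)
            fr x a b nb with x <? u
            ... | yes x<u = before x (≤-trans (+-monoˡ-≤ (4 * q) s≤z₂) a) x<u
              (λ bx → <⇒≱ (proj₂ (B⊆ bx)) (≤-trans y≤z₂ a))
            ... | no  x≮u = after x (≮⇒≥ (λ x<uq → nb (≮⇒≥ x≮u , x<uq))) (<-≤-trans b z₁≤e)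
            left : i + u ≤ z₂ + length A + length K + 4 * q
            left with ≤-total u (z₂ + 4 * q)
            ... | inj₁ h = ((i + u ≤ z₂ + length A + length K + 4 * q) ∋ lin (h ⊕ i≤AK)
                (solve 6 (λ z i u q a k → i :+ u :+ (z :+ 4 :* q :+ (a :+ k)) :+ con 0
                  ⊜ z :+ a :+ k :+ 4 :* q :+ (u :+ i)) refl z₂ i u q (length A) (length K)))
            ... | inj₂ h = let g = cnt-lower P′ h (λ x a b → before x (≤-trans (+-monoˡ-≤ (4 * q) s≤z₂) a) b
                                     (λ bx → <⇒≱ (proj₂ (B⊆ bx)) (≤-trans y≤z₂ a)))
                               m₁ = cnt-mono P′ {u} {u + q} (m≤m+n u q)
                               m₂ = cnt-mono P′ {z₂} {z₂ + 4 * q} (m≤m+n z₂ _)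
              in ((i + u ≤ z₂ + length A + length K + 4 * q) ∋ lin (g ⊕ m₁ ⊕ m₂ ⊕ ≡⇒≤ iq ⊕ ≡⇒≥ c₂)
                  (solve 11 (λ z i u q a k cu cuq cw cz ce → i :+ u :+ (cu :+ (z :+ 4 :* q) :+ cuq :+ cw :+ ce :+ (a :+ k :+ cz)) :+ con 0
                    ⊜ z :+ a :+ k :+ 4 :* q :+ (cw :+ u :+ cu :+ cz :+ (i :+ cuq) :+ ce)) refl z₂ i u q (length A) (length K) (cnt P′ u) (cnt P′ (u + q)) (cnt P′ (z₂ + 4 * q)) (cnt P′ z₂) (cnt P′ e)))
            right : z₁ + length A ≤ i + u + 5 * q
            right with right-overhang
            ... | inj₂ h = ((z₁ + length A ≤ i + u + 5 * q) ∋ lin h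
                (solve 5 (λ z a i u q → z :+ a :+ (i :+ (u :+ q)) :+ 4 :* q ⊜ i :+ u :+ 5 :* q :+ (z :+ a)) refl z₁ (length A) i u q))
            ... | inj₁ h with ≤-total (u + q + 4 * q) z₁
            ...   | inj₁ k = let w = z₁ ∸ 4 * q
                                 w-eq : w + 4 * q ≡ z₁
                                 w-eq = m∸n+n≡m (≤-trans (m≤n+m (4 * q) (u + q)) k)
                                 uq≤w : u + q ≤ w
                                 uq≤w = ((u + q ≤ w) ∋ lin (≡⇒≥ w-eq ⊕ k)
                                     (solve 4 (λ u q w z → u :+ q :+ (w :+ 4 :* q :+ z) :+ con 0 ⊜ w :+ (z :+ (u :+ q :+ 4 :* q))) refl u q w z₁))
                                 g = cnt-lower P′ uq≤w (λ x a b → after x a (<-≤-trans (+-monoˡ-< (4 * q) b) (≤-trans (≤-reflexive w-eq) z₁≤e)))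
                                 m = cnt-mono P′ {w} {z₁} (≤-trans (m≤m+n w _) (≤-reflexive w-eq))
              in ((z₁ + length A ≤ i + u + 5 * q) ∋ lin (≡⇒≥ w-eq ⊕ g ⊕ m ⊕ ≡⇒≥ iq ⊕ ≡⇒≤ c₁)
                  (solve 10 (λ z a i u q w cuq cw cz ce → z :+ a :+ (w :+ 4 :* q :+ (cw :+ (u :+ q)) :+ cz :+ (i :+ cuq) :+ ce) :+ con 0
                    ⊜ i :+ u :+ 5 :* q :+ (z :+ (cuq :+ w) :+ cw :+ ce :+ (a :+ cz))) refl z₁ (length A) i u q w (cnt P′ (u + q)) (cnt P′ w) (cnt P′ z₁) (cnt P′ e)))
            ...   | inj₂ k = ((z₁ + length A ≤ i + u + 5 * q) ∋ lin (k ⊕ A≤i)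
                (solve 5 (λ z a i u q → z :+ a :+ (u :+ q :+ 4 :* q :+ i) :+ con 0 ⊜ i :+ u :+ 5 :* q :+ (z :+ a)) refl z₁ (length A) i u q))
            -- Now the right overhang is the doubled one in the first case. The 18 q is 2⋅5 + 4 + 4
            -- there; the second case has 3 q to spare.
            zz : Z u T z₂ z₁
            zz with straddle
            ... | inj₁ k≤a = inj₂
              ((2 * z₁ ≤ u + z₂ + T + 18 * q) ∋ lin (2 ⊗ right ⊕ left ⊕ i≤ ⊕ eT ⊕ k≤a)
                  (solve 9 (λ u z w T q a k i e → 2 :* w :+ (2 :* (i :+ u :+ 5 :* q) :+ (z :+ a :+ k :+ 4 :* q) :+ e :+ (u :+ q :+ T :+ 4 :* q) :+ a) :+ con 0
                    ⊜ u :+ z :+ T :+ 18 :* q :+ (2 :* (w :+ a) :+ (i :+ u) :+ (i :+ (u :+ q)) :+ e :+ k)) refl u z₂ z₁ T q (length A) (length K) i e))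
            ... | inj₂ ak<i = inj₁
              ((u + z₁ ≤ 2 * z₂ + T + 18 * q) ∋ lin (2 ⊗ left ⊕ 2 ⊗ ak<i ⊕ eT ⊕ z₁≤e)
                  (solve 9 (λ u z w T q a k i e → u :+ w :+ (2 :* (z :+ a :+ k :+ 4 :* q) :+ 2 :* (i :+ q) :+ (u :+ q :+ T :+ 4 :* q) :+ e) :+ (3 :* q :+ con 2)
                    ⊜ 2 :* z :+ T :+ 18 :* q :+ (2 :* (i :+ u) :+ 2 :* (con 1 :+ (a :+ k)) :+ e :+ w)) refl u z₂ z₁ T q (length A) (length K) i e))

          module Overshoot (z₂<y : z₂ + 4 * q < y + q) where
            z₂≤y : z₂ ≤ y
            z₂≤y = ((z₂ ≤ y) ∋ lin z₂<y (solve 3 (λ z q y → z :+ (y :+ q) :+ (3 :* q :+ con 1) ⊜ y :+ (con 1 :+ (z :+ 4 :* q))) refl z₂ q y))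
            gap = cnt-lower P′ yq≤u (λ x a b → before x (≤-trans (+-monoˡ-≤ (4 * q) s≤z₂) (≤-trans (<⇒≤ z₂<y) a)) b
                    (λ bx → <⇒≱ (proj₂ (B⊆ bx)) a))
            m₁ = cnt-mono P′ {u} {u + q} (m≤m+n u q)
            middle : i + u ≤ length A + length K + (y + q)
            middle = let m₂ = cnt-mono P′ {z₂} {y + q} (≤-trans z₂≤y (m≤m+n y q)) in
              ((i + u ≤ length A + length K + (y + q)) ∋ lin (gap ⊕ m₁ ⊕ m₂ ⊕ ≡⇒≤ iq ⊕ ≡⇒≥ c₂)
                  (solve 10 (λ i y u a k cu cuq cy cz ce → i :+ u :+ (cu :+ y :+ cuq :+ cy :+ ce :+ (a :+ k :+ cz)) :+ con 0
                    ⊜ a :+ k :+ y :+ (cy :+ u :+ cu :+ cz :+ (i :+ cuq) :+ ce)) refl i (y + q) u (length A) (length K) (cnt P′ u) (cnt P′ (u + q)) (cnt P′ (y + q)) (cnt P′ z₂) (cnt P′ e)))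
            left : i + u ≤ z₂ + length A + length K + 5 * q
            left with ≤-total y (z₂ + 4 * q)
            ... | inj₁ h = ((i + u ≤ z₂ + length A + length K + 5 * q) ∋ lin (h ⊕ middle)
                (solve 7 (λ z i y u q a k → i :+ u :+ (z :+ 4 :* q :+ (a :+ k :+ (y :+ q))) :+ con 0
                  ⊜ z :+ a :+ k :+ 5 :* q :+ (y :+ (i :+ u))) refl z₂ i y u q (length A) (length K)))
            ... | inj₂ h = let g = cnt-lower P′ h (λ x a b → before x (≤-trans (+-monoˡ-≤ (4 * q) s≤z₂) a) (<-≤-trans b (≤-trans (m≤m+n y q) yq≤u))
                                     (λ bx → <⇒≱ b (proj₁ (B⊆ bx))))
                               m₂ = cnt-mono P′ {z₂} {z₂ + 4 * q} (m≤m+n z₂ _)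
                               m₃ = cnt-mono P′ {y} {y + q} (m≤m+n y q)
              in ((i + u ≤ z₂ + length A + length K + 5 * q) ∋ lin (g ⊕ m₁ ⊕ m₂ ⊕ m₃ ⊕ gap ⊕ ≡⇒≤ iq ⊕ ≡⇒≥ c₂)
                  (solve 14 (λ z i u q y a k cu cuq cy cyq cw cz ce → i :+ u :+ (cy :+ (z :+ 4 :* q) :+ cuq :+ cw :+ cyq :+ (cu :+ (y :+ q)) :+ ce :+ (a :+ k :+ cz)) :+ con 0
                    ⊜ z :+ a :+ k :+ 5 :* q :+ (cw :+ y :+ cu :+ cz :+ cy :+ (cyq :+ u) :+ (i :+ cuq) :+ ce)) refl z₂ i u q y (length A) (length K) (cnt P′ u) (cnt P′ (u + q)) (cnt P′ y) (cnt P′ (y + q)) (cnt P′ (z₂ + 4 * q)) (cnt P′ z₂) (cnt P′ e)))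
            close : z₁ ≤ u + 4 * q
            close with right-overhang | straddle
            ... | _ | inj₂ h = ⊥-elim (n≮0
              ((1 ≤ 0) ∋ lin (middle ⊕ h ⊕ T≥ ⊕ ≡⇒≥ u≡)
                  (solve 7 (λ u T y q a k i → con 1 :+ (a :+ k :+ (y :+ q) :+ (i :+ q) :+ T :+ u) :+ 6 :* q
                    ⊜ con 0 :+ (i :+ u :+ (con 1 :+ (a :+ k)) :+ 8 :* q :+ (y :+ T))) refl u T y q (length A) (length K) i)))
            ... | inj₁ h | inj₁ k≤a = let n = cnt-upper P′ z₁≤e in ⊥-elim (n≮0
              ((1 ≤ 0) ∋ lin (7 ⊗ middle ⊕ 7 ⊗ k≤a ⊕ 7 ⊗ T≥ ⊕ 7 ⊗ ≡⇒≥ u≡ ⊕ 7 ⊗ h ⊕ 7 ⊗ n ⊕ 7 ⊗ ≡⇒≤ c₁ ⊕ 7 ⊗ A≤i ⊕ 21 ⊗ 1≤q)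
                  (solve 11 (λ u T y q a k i e z c d → con 1 :+ (7 :* (a :+ k :+ (y :+ q)) :+ 7 :* a :+ 7 :* T :+ 7 :* u :+ 7 :* (z :+ 4 :* q) :+ 7 :* (c :+ e) :+ 7 :* d :+ 7 :* i :+ 21 :* q) :+ con 20
                    ⊜ con 0 :+ (7 :* (i :+ u) :+ 7 :* k :+ 7 :* (8 :* q) :+ 7 :* (y :+ T) :+ 7 :* e :+ 7 :* (d :+ z) :+ 7 :* (a :+ c) :+ 7 :* a :+ (21 :* con 1))) refl u T y q (length A) (length K) i e z₁ (cnt P′ z₁) (cnt P′ e))))
            ... | inj₂ h | inj₁ k≤a =
              ((z₁ ≤ u + 4 * q) ∋ lin* 1 (left ⊕ k≤a ⊕ ≡⇒≥ u≡ ⊕ 2 ⊗ h ⊕ i≤ ⊕ eT ⊕ z₂<y)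
                  (solve 10 (λ u T y q a k i e z w → 2 :* z :+ (w :+ a :+ k :+ 5 :* q :+ a :+ u :+ 2 :* (i :+ (u :+ q)) :+ e :+ (u :+ q :+ T :+ 4 :* q) :+ (y :+ q)) :+ con 2
                    ⊜ 2 :* (u :+ 4 :* q) :+ (i :+ u :+ k :+ (y :+ T) :+ 2 :* (z :+ a) :+ (i :+ (u :+ q)) :+ e :+ (con 1 :+ (w :+ 4 :* q))) :+ con 1) refl u T y q (length A) (length K) i e z₁ z₂))
            fr : Free P′ z₂ z₁ B
            fr x a b nb = before x (≤-trans (+-monoˡ-≤ (4 * q) s≤z₂) a) (+-cancelʳ-< (4 * q) x u (<-≤-trans b close)) nb

          run : Goal
          run adj hA hK hH hR =
            combine S s≤u uq≤e freeX adj
              (≤-trans s≤uq uq≤z₁) ≤-refl s≤z₂ z₁≤e ≤-refl (≤-trans z₂≤uq uq≤e)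
              (λ a _ _ b → <⇒≱ b a) (λ a _ _ b → <⇒≱ b (≤-trans z₂≤z₁ a)) (λ a _ _ b → <⇒≱ b a)
              EA EK ER
            where
            EA = hA A P′ z₁ e uniqueA z₁≤e c₁
              (λ x a b _ → after x (≤-trans uq≤z₁ (≤-trans (m≤m+n z₁ _) a)) b) (≤-refl , uq≤z₁)
            EK : Emb K P′ z₂ z₁
            EK with ≤-<-connex (y + q) (z₂ + 4 * q)
            ... | inj₁ y≤z₂ = let open Straddle y≤z₂ in hK K P′ z₂ z₁ uniqueK z₂≤z₁ lenK fr
                  (s≤z₂ , z₁≤e , z₂≤uq , uq≤z₁ , y≤z₂ , zz)
            ... | inj₂ z₂<y = let open Overshoot z₂<y in hH K P′ z₂ z₁ uniqueK z₂≤z₁ lenK fr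
                  (s≤z₂ , z₁≤e , close , inj₂ z₂<y , ≤-trans (≤-trans (m≤m+n y q) yq≤u) (≤-trans (m≤m+n u q) uq≤z₁))
            ER : Emb R P′ s z₂
            ER with ≤-<-connex y z₂
            ... | inj₁ y≤z₂ = hH R P′ s z₂ uniqueR s≤z₂ lenR frR (≤-refl , ≤-trans z₂≤uq uq≤e , z₂≤u4q , inj₁ refl , y≤z₂)
            ... | inj₂ z₂<y = hR R P′ s z₂ uniqueR s≤z₂ lenR frR (z₂<y , refl)

        run : Goal
        run = let
            i≤ce : i ≤ cnt P′ e
            i≤ce = ≤-trans (m≤m+n i _) (≤-reflexive iq)
            A≤ce = ≤-trans A≤i i≤ce
            AK≤ce : length A + length K ≤ cnt P′ e
            AK≤ce = ((length A + length K ≤ cnt P′ e) ∋ lin (≡⇒≤ sizes ⊕ ≡⇒≤ len ⊕ ≡⇒≥ ce)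
                (solve 8 (λ X A K R C s e e′ → A :+ K :+ (C :+ e :+ (e′ :+ X)) :+ (R :+ s)
                  ⊜ e′ :+ (X :+ A :+ K :+ R :+ (C :+ s) :+ e)) refl (length X) (length A) (length K) (length R) (length C) (cnt P s) (cnt P e) (cnt P′ e)))
            d₁ = m+[n∸m]≡n A≤ce
            d₂ = m+[n∸m]≡n AK≤ce
            z₁ , uq≤z₁ , z₁≤e , c₁ = cnt-attains P′ {u + q} {e} (cnt P′ e ∸ length A) uq≤e
              (((cnt P′ (u + q)) ≤ (cnt P′ e ∸ length A)) ∋ lin (≡⇒≤ iq ⊕ A≤i ⊕ ≡⇒≥ d₁)
                  (solve 5 (λ i a c e d → c :+ (e :+ i :+ (a :+ d)) :+ con 0
                    ⊜ d :+ (i :+ c :+ a :+ e)) refl i (length A) (cnt P′ (u + q)) (cnt P′ e) (cnt P′ e ∸ length A)))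
              (m∸n≤m _ (length A))
            z₂ , s≤z₂ , z₂≤uq , c₂ = cnt-attains P′ {s} {u + q} (cnt P′ e ∸ (length A + length K)) s≤uq
              ((cnt P′ s ≤ (cnt P′ e ∸ (length A + length K))) ∋ lin (≡⇒≥ d₂ ⊕ ≡⇒≤ sizes ⊕ ≡⇒≤ len ⊕ ≡⇒≥ ce ⊕ ≡⇒≤ cs)
                  (solve 10 (λ X A K R C s s′ e e′ d → s′ :+ (A :+ K :+ d :+ C :+ e :+ (e′ :+ X) :+ s) :+ R
                    ⊜ d :+ (e′ :+ (X :+ A :+ K :+ R) :+ (C :+ s) :+ e :+ s′)) refl (length X) (length A) (length K) (length R) (length C) (cnt P s) (cnt P′ s) (cnt P e) (cnt P′ e) (cnt P′ e ∸ (length A + length K))))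
              (((cnt P′ e ∸ (length A + length K)) ≤ (cnt P′ (u + q))) ∋ lin (≡⇒≤ d₂ ⊕ ≡⇒≥ iq ⊕ i≤AK)
                  (solve 6 (λ A K i c e′ d → d :+ (e′ :+ (i :+ c) :+ (A :+ K)) :+ con 0
                    ⊜ c :+ (A :+ K :+ d :+ e′ :+ i)) refl (length A) (length K) i (cnt P′ (u + q)) (cnt P′ e) (cnt P′ e ∸ (length A + length K))))
          in Cuts.run z₁ z₂ uq≤z₁ z₁≤e s≤z₂ z₂≤uq (trans (cong (length A +_) c₁) d₁) (trans (cong (length A + length K +_) c₂) d₂)

      run : Goal
      run = let i-eq = m∸n+n≡m (cnt-mono P uq≤e) in Parts.run (cnt P e ∸ cnt P (u + q)) i-eq (sep C _ uC (i+q≤ i-eq))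

-- The dyadic hierarchy of blocks and the induction on its levels.

module Hierarchy where
  open import Data.Bool using (true)
  open import Data.List using (length)
  open import Data.List.Relation.Unary.Unique.Propositional using (Unique)
  open import Data.Nat
  open import Data.Nat.Properties
  open import Data.Nat.Tactic.RingSolver using (solve-∀)
  open LinearArithmetic
  open Placements
  open Splitting

  data Octant : Set where
    o₁ o₃ o₅ o₇ : Octant

  num : Octant → ℕ
  num o₁ = 1
  num o₃ = 3
  num o₅ = 5
  num o₇ = 7

  -- How far the node 2ᵏ (8h + num o) is joined to the left and to the right, in
  -- units of a quarter of its spacing 2ᵏ.
  reachˡ reachʳ : Octant → ℕ
  reachˡ o₁ = 8
  reachˡ o₃ = 6
  reachˡ o₅ = 9
  reachˡ o₇ = 6
  reachʳ o₁ = 6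
  reachʳ o₃ = 10
  reachʳ o₅ = 6
  reachʳ o₇ = 12

  spacing : ℕ → ℕ → ℕ
  spacing q zero    = 8 * q
  spacing q (suc k) = 2 * spacing q k

  spacing-≥ : ∀ q k → 8 * q ≤ spacing q k
  spacing-≥ q zero    = ≤-refl
  spacing-≥ q (suc k) = ≤-trans (spacing-≥ q k) (m≤m+n _ _)

  halve : ∀ n → ∃ λ h → n ≡ 2 * h ⊎ n ≡ 2 * h + 1
  halve zero    = 0 , inj₁ refl
  halve (suc n) with halve n
  ... | h , inj₁ refl = h , inj₂ (+-comm 1 (2 * h))
  ... | h , inj₂ refl = suc h , inj₁ (solve 1 (λ h → con 1 :+ (2 :* h :+ con 1) ⊜ 2 :* (con 1 :+ h)) refl h)

  octant₁ : ∀ h → ∃ λ j → 4 * h + 1 ≡ 8 * j + 1 ⊎ 4 * h + 1 ≡ 8 * j + 5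
  octant₁ h with halve h
  ... | j , inj₁ refl = j , inj₁ (solve 1 (λ j → 4 :* (2 :* j) :+ con 1 ⊜ 8 :* j :+ con 1) refl j)
  ... | j , inj₂ refl = j , inj₂ (solve 1 (λ j → 4 :* (2 :* j :+ con 1) :+ con 1 ⊜ 8 :* j :+ con 5) refl j)

  octant₃ : ∀ h → ∃ λ j → 4 * h + 3 ≡ 8 * j + 3 ⊎ 4 * h + 3 ≡ 8 * j + 7
  octant₃ h with halve h
  ... | j , inj₁ refl = j , inj₁ (solve 1 (λ j → 4 :* (2 :* j) :+ con 3 ⊜ 8 :* j :+ con 3) refl j)
  ... | j , inj₂ refl = j , inj₂ (solve 1 (λ j → 4 :* (2 :* j :+ con 1) :+ con 3 ⊜ 8 :* j :+ con 7) refl j)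

  module Universality
    {V : Set} (_~_ : V → V → Set) (~-sym : ∀ {a b} → a ~ b → b ~ a)
    (Adj : ℕ → ℕ → Set) (Adj-sym : ∀ {a b} → Adj a b → Adj b a)
    (q : ℕ) (1≤q : 1 ≤ q) (sep : ∀ C i → Unique C → i + q ≤ length C → Sep _~_ q C i)
    (n δ : ℕ) (δ≥ : 40 * q ≤ δ)
    (near : ∀ {a b} → a ≤ b → b ≤ a + 25 * q → Adj a b)
    (node : ∀ k o h {u j a} → u ≡ (8 * h + num o) * spacing q k → j < q → u + q ≤ n → a < n →
            4 * u ≤ 4 * a + reachˡ o * spacing q k + δ →
            4 * a ≤ 4 * u + reachʳ o * spacing q k + δ → Adj (u + j) a)
    where
    open Embedding _~_ ~-sym Adj Adj-sym
    open Steps _~_ ~-sym Adj Adj-sym q 1≤q sep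

    -- The exponent of 2 in the factor `suc g` of `y`: 0, 1, or at least 2. `Z` is the overhang
    -- bound from the moment when `y` was used, in terms of the spacing of the level of `y` itself.
    data Kind (k g y s e : ℕ) : Set where
      odd  : ∀ h → g ≡ 2 * h → Z y (spacing q k) s e → Kind k g y s e
      two  : ∀ h → g ≡ 4 * h + 1 → Z y (2 * spacing q k) s e → Kind k g y s e
      four : ∀ h → g ≡ 4 * h + 3 → Kind k g y s e

    Z-mono : ∀ {y B s e s′ e′} → s ≤ s′ → e′ ≤ e → Z y B s e → Z y B s′ e′
    Z-mono {y} {B} {s} {e} {s′} {e′} a b (inj₁ z) = inj₁ ((y + e′ ≤ 2 * s′ + B + 18 * q) ∋ lin (2 ⊗ a ⊕ b ⊕ z)
        (solve 7 (λ y B s e s′ e′ q → y :+ e′ :+ (2 :* s′ :+ e :+ (2 :* s :+ B :+ 18 :* q)) :+ con 0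
          ⊜ 2 :* s′ :+ B :+ 18 :* q :+ (2 :* s :+ e′ :+ (y :+ e))) refl y B s e s′ e′ q))
    Z-mono {y} {B} {s} {e} {s′} {e′} a b (inj₂ z) = inj₂ ((2 * e′ ≤ y + s′ + B + 18 * q) ∋ lin (a ⊕ 2 ⊗ b ⊕ z)
        (solve 7 (λ y B s e s′ e′ q → 2 :* e′ :+ (s′ :+ 2 :* e :+ (y :+ s :+ B :+ 18 :* q)) :+ con 0
          ⊜ y :+ s′ :+ B :+ 18 :* q :+ (s :+ 2 :* e′ :+ 2 :* e)) refl y B s e s′ e′ q))

    Kind-mono : ∀ {k g y s e s′ e′} → s ≤ s′ → e′ ≤ e → Kind k g y s e → Kind k g y s′ e′
    Kind-mono a b (odd h p z) = odd h p (Z-mono a b z)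
    Kind-mono a b (two h p z) = two h p (Z-mono a b z)
    Kind-mono a b (four h p)  = four h p

    -- Halving the spacing doubles `suc g`, while the overhang bound remains the same number.
    descend : ∀ {k g y s e} → Kind (suc k) g y s e → Kind k (2 * g + 1) y s e
    descend (odd h refl z)  = two h (solve 1 (λ h → 2 :* (2 :* h) :+ con 1 ⊜ 4 :* h :+ con 1) refl h) z
    descend (two h refl _)  = four (2 * h) (solve 1 (λ h → 2 :* (4 :* h :+ con 1) :+ con 1 ⊜ 4 :* (2 :* h) :+ con 3) refl h)
    descend (four h refl)   = four (2 * h + 1) (solve 1 (λ h → 2 :* (4 :* h :+ con 3) :+ con 1 ⊜ 4 :* (2 :* h :+ con 1) :+ con 3) refl h)

    -- No node of level ≥ k is available in [s , e), except near its ends.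
    NState : ℕ → ℕ → ℕ → ℕ → Set
    NState k c s e = c * spacing q k ≤ s + 4 * q × e ≤ c * spacing q k + spacing q k + q + 4 * q × e ≤ n

    -- The node at y, of level ≥ k, has been used, and no other node of level ≥ k
    -- is available in [s , e), except near its ends.
    HState : ℕ → ℕ → ℕ → ℕ → ℕ → Set
    HState k g y s e = s ≤ y + q × y ≤ e × y ≤ s + spacing q k + 4 * q × e ≤ y + spacing q k + q + 4 * q × e ≤ n ×
                       Kind k g y s e

    record Level (k : ℕ) : Set₁ where
      field
        fresh : ∀ c → Handler (NState k c) None
        holed : ∀ g y → y ≡ suc g * spacing q k → Handler (HState k g y) (Block y)

    -- An interval around a hole extends at most 12 q to the left and 13 q to the right of it; this
    -- is the 25 q of `near`.
    level-zero : Level 0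
    level-zero = record
      { fresh = λ c C P s e uC s≤e len _ (lo , hi , _) → emb-local C P s e s≤e len λ {a} {b} x y z w →
          adj x y z w ((e ≤ s + 25 * q) ∋ lin (lo ⊕ hi)
              (solve 4 (λ s e q c → e :+ (s :+ 4 :* q :+ (c :+ 8 :* q :+ q :+ 4 :* q)) :+ 8 :* q ⊜ s :+ 25 :* q :+ (c :+ e)) refl s e q (c * (8 * q))))
      ; holed = λ g y _ C P s e uC s≤e len _ (_ , _ , lo , hi , _) → emb-local C P s e s≤e len λ {a} {b} x y′ z w →
          adj x y′ z w ((e ≤ s + 25 * q) ∋ lin (lo ⊕ hi)
              (solve 4 (λ s e q y → e :+ (s :+ 8 :* q :+ 4 :* q :+ (y :+ 8 :* q :+ q :+ 4 :* q)) :+ con 0 ⊜ s :+ 25 :* q :+ (y :+ e)) refl s e q y))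
      }
      where
      adj : ∀ {s e a b} → s ≤ a → a < e → s ≤ b → b < e → e ≤ s + 25 * q → Adj a b
      adj {s} {e} {a} {b} sa ae sb be h with ≤-total a b
      ... | inj₁ ab = near ab ((b ≤ a + 25 * q) ∋ lin (sa ⊕ be ⊕ h)
          (solve 5 (λ s e a b q → b :+ (a :+ e :+ (s :+ 25 :* q)) :+ con 1 ⊜ a :+ 25 :* q :+ (s :+ (con 1 :+ b) :+ e)) refl s e a b q))
      ... | inj₂ ba = Adj-sym (near ba ((a ≤ b + 25 * q) ∋ lin (sb ⊕ ae ⊕ h)
          (solve 5 (λ s e a b q → a :+ (b :+ e :+ (s :+ 25 :* q)) :+ con 1 ⊜ b :+ 25 :* q :+ (s :+ (con 1 :+ a) :+ e)) refl s e a b q)))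

    module NextLevel (k : ℕ) (L : Level k) where
      open Level L
      T : ℕ
      T = spacing q k
      T≥ : 8 * q ≤ T
      T≥ = spacing-≥ q k

      hub : ∀ o h {m} u → m ≡ 8 * h + num o → u ≡ m * T → ∀ s e →
            4 * u ≤ 4 * s + reachˡ o * T + δ → 4 * e ≤ 4 * u + reachʳ o * T + δ →
            u + q ≤ e → e ≤ n →
            ∀ {j a} → j < q → s ≤ a → a < e → Adj (u + j) a
      hub o h u refl u≡ s e lo hi ue en {j} {a} jq sa ae = node k o h u≡ jq (≤-trans ue en) (<-≤-trans ae en)
        ((4 * u ≤ 4 * a + (reachˡ o * T) + δ) ∋ lin (lo ⊕ 4 ⊗ sa)
            (solve 6 (λ u s a q r δ → 4 :* u :+ (4 :* s :+ r :+ δ :+ 4 :* a) :+ con 0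
              ⊜ 4 :* a :+ r :+ δ :+ (4 :* u :+ 4 :* s)) refl u s a q (reachˡ o * T) δ))
        ((4 * a ≤ 4 * u + (reachʳ o * T) + δ) ∋ lin (hi ⊕ 4 ⊗ ae)
            (solve 6 (λ u e a q r δ → 4 :* a :+ (4 :* u :+ r :+ δ :+ 4 :* e) :+ con 4
              ⊜ 4 :* u :+ r :+ δ :+ (4 :* e :+ 4 :* (con 1 :+ a))) refl u e a q (reachʳ o * T) δ))

      -- If the middle node `(2 * c + 1) * T` is within O(q) of an end or outside, the interval
      -- already lies between consecutive multiples of T. Otherwise no block has been used yet, and
      -- T on either side is within every reach.
      fresh′ : ∀ c → Handler (NState (suc k) c) None
      fresh′ c C P s e uC s≤e len free (lo , hi , en) with ≤-<-connex (s + 4 * q) u | ≤-<-connex (u + q + 4 * q) e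
        where u = (2 * c + 1) * T
      ... | inj₂ us | _ = fresh (2 * c + 1) C P s e uC s≤e len free (<⇒≤ us , hi′ , en)
        where
        eq = ((∀ c T → (2 * c + 1) * T ≡ c * (2 * T) + T) ∋ solve-∀) c T
        hi′ : e ≤ (2 * c + 1) * T + T + q + 4 * q
        hi′ = ((e ≤ ((2 * c + 1) * T) + T + q + 4 * q) ∋ lin (≡⇒≥ eq ⊕ hi)
            (solve 5 (λ u v T q e → e :+ (u :+ (v :+ 2 :* T :+ q :+ 4 :* q)) :+ con 0
              ⊜ u :+ T :+ q :+ 4 :* q :+ (v :+ T :+ e)) refl ((2 * c + 1) * T) (c * (2 * T)) T q e))
      ... | inj₁ _ | inj₂ eu = fresh (2 * c) C P s e uC s≤e len free
          (≤-trans (≤-reflexive eq) lo , hi′ , en)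
        where
        eq = ((∀ c T → 2 * c * T ≡ c * (2 * T)) ∋ solve-∀) c T
        eq′ = ((∀ c T → (2 * c + 1) * T ≡ 2 * c * T + T) ∋ solve-∀) c T
        hi′ : e ≤ 2 * c * T + T + q + 4 * q
        hi′ = ((e ≤ (2 * c * T) + T + q + 4 * q) ∋ lin (≡⇒≤ eq′ ⊕ eu)
            (solve 5 (λ u v T q e → e :+ (v :+ T :+ (u :+ q :+ 4 :* q)) :+ con 1
              ⊜ v :+ T :+ q :+ 4 :* q :+ (u :+ (con 1 :+ e))) refl ((2 * c + 1) * T) (2 * c * T) T q e))
      -- Nothing is occupied: `u + T` merely bounds the interval on the right, so it carries the
      -- empty predicate `None`.
      ... | inj₁ su | inj₁ ue = StepLeft.run u (u + T) None refl T≥ (λ ()) C P s e uC len free su ue uT adj hA hK hH hR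
        where
        u = (2 * c + 1) * T
        eq : u ≡ c * (2 * T) + T
        eq = ((∀ c T → (2 * c + 1) * T ≡ c * (2 * T) + T) ∋ solve-∀) c T
        eq₂ : 2 * c * T ≡ c * (2 * T)
        eq₂ = ((∀ c T → 2 * c * T ≡ c * (2 * T)) ∋ solve-∀) c T
        uT : u ≤ s + T + 4 * q
        uT = ((u ≤ s + T + 4 * q) ∋ lin (≡⇒≤ eq ⊕ lo)
            (solve 5 (λ u v T q s → u :+ (v :+ T :+ (s :+ 4 :* q)) :+ con 0 ⊜ s :+ T :+ 4 :* q :+ (u :+ v)) refl u (c * (2 * T)) T q s))
        eT : e ≤ u + T + q + 4 * q
        eT = ((e ≤ u + T + q + 4 * q) ∋ lin (≡⇒≥ eq ⊕ hi)
            (solve 5 (λ u v T q e → e :+ (u :+ (v :+ 2 :* T :+ q :+ 4 :* q)) :+ con 0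
              ⊜ u :+ T :+ q :+ 4 :* q :+ (v :+ T :+ e)) refl u (c * (2 * T)) T q e))
        uqe : u + q ≤ e
        uqe = m+n≤o⇒m≤o (u + q) ue
        adj : ∀ {j a} → j < q → s ≤ a → a < e → Adj (u + j) a
        adj with halve c
        ... | d , inj₁ refl with octant₁ d
        ...   | h , inj₁ p = hub o₁ h u (trans (solve 1 (λ d → 2 :* (2 :* d) :+ con 1 ⊜ 4 :* d :+ con 1) refl d) p) refl s e
          ((4 * u ≤ 4 * s + 8 * T + δ) ∋ lin (4 ⊗ uT ⊕ δ≥)
              (solve 5 (λ u T q s δ → 4 :* u :+ (4 :* (s :+ T :+ 4 :* q) :+ δ) :+ (4 :* T :+ 24 :* q)
                ⊜ 4 :* s :+ 8 :* T :+ δ :+ (4 :* u :+ 40 :* q)) refl u T q s δ))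
          ((4 * e ≤ 4 * u + 6 * T + δ) ∋ lin (4 ⊗ eT ⊕ δ≥)
              (solve 5 (λ u T q e δ → 4 :* e :+ (4 :* (u :+ T :+ q :+ 4 :* q) :+ δ) :+ (2 :* T :+ 20 :* q)
                ⊜ 4 :* u :+ 6 :* T :+ δ :+ (4 :* e :+ 40 :* q)) refl u T q e δ)) uqe en
        ...   | h , inj₂ p = hub o₅ h u (trans (solve 1 (λ d → 2 :* (2 :* d) :+ con 1 ⊜ 4 :* d :+ con 1) refl d) p) refl s e
          ((4 * u ≤ 4 * s + 9 * T + δ) ∋ lin (4 ⊗ uT ⊕ δ≥)
              (solve 5 (λ u T q s δ → 4 :* u :+ (4 :* (s :+ T :+ 4 :* q) :+ δ) :+ (5 :* T :+ 24 :* q)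
                ⊜ 4 :* s :+ 9 :* T :+ δ :+ (4 :* u :+ 40 :* q)) refl u T q s δ))
          ((4 * e ≤ 4 * u + 6 * T + δ) ∋ lin (4 ⊗ eT ⊕ δ≥)
              (solve 5 (λ u T q e δ → 4 :* e :+ (4 :* (u :+ T :+ q :+ 4 :* q) :+ δ) :+ (2 :* T :+ 20 :* q)
                ⊜ 4 :* u :+ 6 :* T :+ δ :+ (4 :* e :+ 40 :* q)) refl u T q e δ)) uqe en
        adj | d , inj₂ refl with octant₃ d
        ...   | h , inj₁ p = hub o₃ h u (trans (solve 1 (λ d → 2 :* (2 :* d :+ con 1) :+ con 1 ⊜ 4 :* d :+ con 3) refl d) p) refl s e
          ((4 * u ≤ 4 * s + 6 * T + δ) ∋ lin (4 ⊗ uT ⊕ δ≥)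
              (solve 5 (λ u T q s δ → 4 :* u :+ (4 :* (s :+ T :+ 4 :* q) :+ δ) :+ (2 :* T :+ 24 :* q)
                ⊜ 4 :* s :+ 6 :* T :+ δ :+ (4 :* u :+ 40 :* q)) refl u T q s δ))
          ((4 * e ≤ 4 * u + 10 * T + δ) ∋ lin (4 ⊗ eT ⊕ δ≥)
              (solve 5 (λ u T q e δ → 4 :* e :+ (4 :* (u :+ T :+ q :+ 4 :* q) :+ δ) :+ (6 :* T :+ 20 :* q)
                ⊜ 4 :* u :+ 10 :* T :+ δ :+ (4 :* e :+ 40 :* q)) refl u T q e δ)) uqe en
        ...   | h , inj₂ p = hub o₇ h u (trans (solve 1 (λ d → 2 :* (2 :* d :+ con 1) :+ con 1 ⊜ 4 :* d :+ con 3) refl d) p) refl s e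
          ((4 * u ≤ 4 * s + 6 * T + δ) ∋ lin (4 ⊗ uT ⊕ δ≥)
              (solve 5 (λ u T q s δ → 4 :* u :+ (4 :* (s :+ T :+ 4 :* q) :+ δ) :+ (2 :* T :+ 24 :* q)
                ⊜ 4 :* s :+ 6 :* T :+ δ :+ (4 :* u :+ 40 :* q)) refl u T q s δ))
          ((4 * e ≤ 4 * u + 12 * T + δ) ∋ lin (4 ⊗ eT ⊕ δ≥)
              (solve 5 (λ u T q e δ → 4 :* e :+ (4 :* (u :+ T :+ q :+ 4 :* q) :+ δ) :+ (8 :* T :+ 20 :* q)
                ⊜ 4 :* u :+ 12 :* T :+ δ :+ (4 :* e :+ 40 :* q)) refl u T q e δ)) uqe en
        hA : Handler (λ s′ z → s ≤ s′ × z ≤ u) None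
        hA C P s′ z uC s≤ len free (ss′ , zu) = fresh (2 * c) C P s′ z uC s≤ len free
          ( ≤-trans (≤-reflexive eq₂) (≤-trans lo (+-monoˡ-≤ (4 * q) ss′))
          , ((z ≤ (2 * c * T) + T + q + 4 * q) ∋ lin (≡⇒≤ eq ⊕ ≡⇒≥ eq₂ ⊕ zu)
              (solve 6 (λ u v w T q z → z :+ (v :+ T :+ w :+ u) :+ 5 :* q
                ⊜ w :+ T :+ q :+ 4 :* q :+ (u :+ v :+ z)) refl u (c * (2 * T)) (2 * c * T) T q z))
          , ≤-trans zu (≤-trans (m≤m+n u q) (≤-trans uqe en)))
        hK : Handler (λ z₁ z₂ → s ≤ z₁ × z₂ ≤ e × z₁ ≤ u × u ≤ z₂ × z₂ ≤ (u + T) + 4 * q × Z u T z₁ z₂) (Block u)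
        hK C P z₁ z₂ uC s≤ len free (sz , ze , zu , uz , _ , z) = holed (2 * c) u (cong (_* T) (+-comm (2 * c) 1)) C P z₁ z₂ uC s≤ len free
          ( ≤-trans zu (m≤m+n u q) , uz , ≤-trans uT (+-monoˡ-≤ (4 * q) (+-monoˡ-≤ T sz)) , ≤-trans ze eT , ≤-trans ze en , odd c refl z)
        hH : Handler (λ z₁ z₂ → s ≤ z₁ × z₂ ≤ e × u + q ≤ z₁ + 4 * q × (z₂ ≡ e ⊎ (u + T) + 4 * q < z₂) × z₁ ≤ (u + T) + q) None
        hH C P z₁ z₂ uC s≤ len free (sz , ze , uz , _) = fresh (2 * c + 1) C P z₁ z₂ uC s≤ len free
          (m+n≤o⇒m≤o u uz , ≤-trans ze eT , ≤-trans ze en)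
        hR : Handler (λ z e′ → (u + T) + q < z × e′ ≡ e) None
        hR C P z .e uC s≤ len free (uz , refl) = fresh (2 * c + 1) C P z e uC s≤ len free
          (((u ≤ z + 4 * q) ∋ lin uz
              (solve 4 (λ u T q z → u :+ z :+ (T :+ 5 :* q :+ con 1) ⊜ z :+ 4 :* q :+ (con 1 :+ (u :+ T :+ q))) refl u T q z)) , eT , en)

      module Holed (g y : ℕ) (y≡ : y ≡ suc g * spacing q (suc k)) where
        y≡′ : y ≡ (2 * g + 1) * T + T
        y≡′ = trans y≡ (((∀ g T → suc g * (2 * T) ≡ (2 * g + 1) * T + T) ∋ solve-∀) g T)

        -- States around the hole y in which the node 2ᵏ to the left (right) of y
        -- is not available.
        LState RState : ℕ → ℕ → Set
        LState s e = s ≤ y + q × y ≤ e × y ≤ s + T + 4 * q × e ≤ y + 2 * T + q + 4 * q × e ≤ n × Kind (suc k) g y s e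
        RState s e = s ≤ y + q × y ≤ e × y ≤ s + 2 * T + 4 * q × e ≤ y + T + q + 4 * q × e ≤ n × Kind (suc k) g y s e

        -- Neither y - T nor y + T is available any more, so the lower level takes over with the
        -- same hole.
        lower : Handler (λ s e → s ≤ y + q × y ≤ e × y ≤ s + T + 4 * q × e ≤ y + T + q + 4 * q × e ≤ n × Kind (suc k) g y s e) (Block y)
        lower C P s e uC s≤e len free (a , b , c , d , en , κ) =
          holed (2 * g + 1) y (trans y≡′ (((∀ g T → (2 * g + 1) * T + T ≡ suc (2 * g + 1) * T) ∋ solve-∀) g T))
            C P s e uC s≤e len free (a , b , c , d , en , descend κ)

        -- The bag goes to y - T. The part straddling that node gets it as its hole and ends before
        -- or near `y`; a piece still around `y` keeps `y` as its hole, with nothing available on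
        -- the left; what lies beyond `y` has no hole at all.
        left : ∀ C P s e → Unique C → Fills C P s e → Free P s e (Block y) →
          s + 4 * q + T ≤ y → y ≤ s + 2 * T + 4 * q → y ≤ e → e ≤ n →
          (∀ u → y ≡ u + T → ∀ {j a} → j < q → s ≤ a → a < e → Adj (u + j) a) →
          Handler (λ z₁ z₂ → s ≤ z₁ × z₂ ≤ e × z₁ ≤ y + q × y ≤ z₂ × y ≤ z₁ + T + 4 * q) (Block y) →
          Handler (λ z e′ → y ≤ z × e′ ≡ e) None →
          Emb C P s e
        left C P s e uC len free sy ys ye en adj hH hR =
          StepLeft.run u y (Block y) y≡′ T≥ (λ b → b) C P s e uC len free su ue uT (adj u y≡′) hA hK
            (λ C P z₁ z₂ uC s≤ len free (sz , ze , uz , zz , zy) → hH C P z₁ z₂ uC s≤ len free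
              (sz , ze , zy , y≤z₂ zz , ((y ≤ z₁ + T + 4 * q) ∋ lin (≡⇒≤ y≡′ ⊕ uz)
                  (solve 5 (λ y u T q z → y :+ (u :+ T :+ (z :+ 4 :* q)) :+ q ⊜ z :+ T :+ 4 :* q :+ (y :+ (u :+ q))) refl y u T q z₁))))
            (λ C P z e′ uC s≤ len free (yz , eq) → hR C P z e′ uC s≤ len
              (λ x a b _ → free x a b (λ (_ , xy) → <⇒≱ xy (≤-trans (<⇒≤ yz) (≤-trans (m≤m+n z _) a))))
              (≤-trans (m≤m+n y q) (<⇒≤ yz) , eq))
          where
          u = (2 * g + 1) * T
          su : s + 4 * q ≤ u
          su = ((s + 4 * q ≤ u) ∋ lin (≡⇒≤ y≡′ ⊕ sy)
              (solve 5 (λ y u T q s → s :+ 4 :* q :+ (u :+ T :+ y) :+ con 0 ⊜ u :+ (y :+ (s :+ 4 :* q :+ T))) refl y u T q s))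
          ue : u + q + 4 * q ≤ e
          ue = ((u + q + 4 * q ≤ e) ∋ lin (≡⇒≥ y≡′ ⊕ ye ⊕ T≥)
              (solve 5 (λ y u T q e → u :+ q :+ 4 :* q :+ (y :+ e :+ T) :+ 3 :* q ⊜ e :+ (u :+ T :+ y :+ 8 :* q)) refl y u T q e))
          uT : u ≤ s + T + 4 * q
          uT = ((u ≤ s + T + 4 * q) ∋ lin (≡⇒≥ y≡′ ⊕ ys)
              (solve 5 (λ y u T q s → u :+ (y :+ (s :+ 2 :* T :+ 4 :* q)) :+ con 0 ⊜ s :+ T :+ 4 :* q :+ (u :+ T :+ y)) refl y u T q s))
          y≤z₂ : ∀ {z₂} → z₂ ≡ e ⊎ y + 4 * q < z₂ → y ≤ z₂
          y≤z₂ (inj₁ refl) = ye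
          y≤z₂ (inj₂ h)    = ≤-trans (m≤m+n y _) (<⇒≤ h)
          u≡ : u ≡ 2 * g * T + T
          u≡ = ((∀ g T → (2 * g + 1) * T ≡ 2 * g * T + T) ∋ solve-∀) g T
          hA : Handler (λ s′ z → s ≤ s′ × z ≤ u) None
          hA C P s′ z uC s≤ len free (ss′ , zu) = fresh (2 * g) C P s′ z uC s≤ len free
            ( (((2 * g * T) ≤ s′ + 4 * q) ∋ lin (≡⇒≥ u≡ ⊕ uT ⊕ ss′)
                (solve 6 (λ u v T q s s′ → v :+ (u :+ (s :+ T :+ 4 :* q) :+ s′) :+ con 0
                  ⊜ s′ :+ 4 :* q :+ (v :+ T :+ u :+ s)) refl u (2 * g * T) T q s s′))
            , ((z ≤ (2 * g * T) + T + q + 4 * q) ∋ lin (≡⇒≤ u≡ ⊕ zu)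
                (solve 5 (λ u v T q z → z :+ (v :+ T :+ u) :+ 5 :* q ⊜ v :+ T :+ q :+ 4 :* q :+ (u :+ z)) refl u (2 * g * T) T q z))
            , ≤-trans zu (≤-trans (m+n≤o⇒m≤o u (m+n≤o⇒m≤o (u + q) ue)) en))
          hK : Handler (λ z₁ z₂ → s ≤ z₁ × z₂ ≤ e × z₁ ≤ u × u ≤ z₂ × z₂ ≤ y + 4 * q × Z u T z₁ z₂) (Block u)
          hK C P z₁ z₂ uC s≤ len free (sz , ze , zu , uz , zy , z) =
            holed (2 * g) u (cong (_* T) (+-comm (2 * g) 1)) C P z₁ z₂ uC s≤ len free
            ( ≤-trans zu (m≤m+n u q) , uz , ≤-trans uT (+-monoˡ-≤ (4 * q) (+-monoˡ-≤ T sz))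
            , ((z₂ ≤ u + T + q + 4 * q) ∋ lin (≡⇒≤ y≡′ ⊕ zy)
                (solve 5 (λ y u T q z → z :+ (u :+ T :+ (y :+ 4 :* q)) :+ q ⊜ u :+ T :+ q :+ 4 :* q :+ (y :+ z)) refl y u T q z₂))
            , ≤-trans ze en , odd g refl z)

        right : ∀ C P s e → Unique C → Fills C P s e → Free P s e (Block y) →
          y + T + q + 4 * q ≤ e → e ≤ y + 2 * T + q + 4 * q → s ≤ y + q → e ≤ n →
          (∀ u → u ≡ y + T → ∀ {j a} → j < q → s ≤ a → a < e → Adj (u + j) a) →
          Handler (λ z₁ z₂ → s ≤ z₁ × z₂ ≤ e × z₁ ≤ y + q × y ≤ z₂ × z₂ ≤ y + T + q + 4 * q) (Block y) →
          Handler (λ s′ z → z ≤ y × s′ ≡ s) None →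
          Emb C P s e
        right C P s e uC len free ye ey sy en adj hH hR =
          StepRight.run u y (Block y) u≡ T≥ (λ b → b) C P s e uC len free su ue eT (adj u u≡) hA hK
            (λ C P z₂ z₁ uC s≤ len free (sz , ze , zu , zz , yz) → hH C P z₂ z₁ uC s≤ len free
              (sz , ze , z₂≤y zz , yz , ((z₁ ≤ y + T + q + 4 * q) ∋ lin (≡⇒≤ u≡ ⊕ zu)
                  (solve 5 (λ y u T q z → z :+ (y :+ T :+ (u :+ 4 :* q)) :+ q ⊜ y :+ T :+ q :+ 4 :* q :+ (u :+ z)) refl y u T q z₁))))
            (λ C P s′ z uC s≤ len free (zy , eq) → hR C P s′ z uC s≤ len
              (λ x a b _ → free x a b (λ (yx , _) → <⇒≱ zy (≤-trans yx (≤-trans (m≤m+n x _) (<⇒≤ b)))))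
              (<⇒≤ zy , eq))
          where
          u = (2 * g + 3) * T
          u≡ : u ≡ y + T
          u≡ = trans (((∀ g T → (2 * g + 3) * T ≡ ((2 * g + 1) * T + T) + T) ∋ solve-∀) g T) (cong (_+ T) (sym y≡′))
          su : s + 4 * q ≤ u
          su = ((s + 4 * q ≤ u) ∋ lin (≡⇒≥ u≡ ⊕ sy ⊕ T≥)
              (solve 5 (λ y u T q s → s :+ 4 :* q :+ (u :+ (y :+ q) :+ T) :+ 3 :* q ⊜ u :+ (y :+ T :+ s :+ 8 :* q)) refl y u T q s))
          ue : u + q + 4 * q ≤ e
          ue = ((u + q + 4 * q ≤ e) ∋ lin (≡⇒≤ u≡ ⊕ ye)
              (solve 5 (λ y u T q e → u :+ q :+ 4 :* q :+ (y :+ T :+ e) :+ con 0 ⊜ e :+ (u :+ (y :+ T :+ q :+ 4 :* q))) refl y u T q e))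
          eT : e ≤ u + q + T + 4 * q
          eT = ((e ≤ u + q + T + 4 * q) ∋ lin (≡⇒≥ u≡ ⊕ ey)
              (solve 5 (λ y u T q e → e :+ (u :+ (y :+ 2 :* T :+ q :+ 4 :* q)) :+ con 0 ⊜ u :+ q :+ T :+ 4 :* q :+ (y :+ T :+ e)) refl y u T q e))
          z₂≤y : ∀ {z₂} → z₂ ≡ s ⊎ z₂ + 4 * q < y + q → z₂ ≤ y + q
          z₂≤y (inj₁ refl) = sy
          z₂≤y (inj₂ h)    = m+n≤o⇒m≤o _ (<⇒≤ h)
          hA : Handler (λ z e′ → e′ ≤ e × u + q ≤ z) None
          hA C P z e′ uC s≤ len free (ee′ , uz) = fresh (2 * g + 3) C P z e′ uC s≤ len free
            ( ≤-trans (m+n≤o⇒m≤o u uz) (m≤m+n z _)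
            , ((e′ ≤ u + T + q + 4 * q) ∋ lin (ee′ ⊕ eT)
                (solve 5 (λ u T q e e′ → e′ :+ (e :+ (u :+ q :+ T :+ 4 :* q)) :+ con 0 ⊜ u :+ T :+ q :+ 4 :* q :+ (e′ :+ e)) refl u T q e e′))
            , ≤-trans ee′ en)
          hK : Handler (λ z₂ z₁ → s ≤ z₂ × z₁ ≤ e × z₂ ≤ u + q × u + q ≤ z₁ × y + q ≤ z₂ + 4 * q × Z u T z₂ z₁) (Block u)
          hK C P z₂ z₁ uC s≤ len free (sz , ze , zu , uz , yz , z) =
            holed (2 * g + 2) u (cong (_* T) (+-suc (2 * g) 2)) C P z₂ z₁ uC s≤ len free
            ( zu , m+n≤o⇒m≤o u uz
            , ((u ≤ z₂ + T + 4 * q) ∋ lin (≡⇒≤ u≡ ⊕ yz)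
                (solve 5 (λ y u T q z → u :+ (y :+ T :+ (z :+ 4 :* q)) :+ q ⊜ z :+ T :+ 4 :* q :+ (u :+ (y :+ q))) refl y u T q z₂))
            , ((z₁ ≤ u + T + q + 4 * q) ∋ lin (ze ⊕ eT)
                (solve 5 (λ z u T q e → z :+ (e :+ (u :+ q :+ T :+ 4 :* q)) :+ con 0 ⊜ u :+ T :+ q :+ 4 :* q :+ (z :+ e)) refl z₁ u T q e))
            , ≤-trans ze en , odd (g + 1) (solve 1 (λ g → 2 :* g :+ con 2 ⊜ 2 :* (g :+ con 1)) refl g) z)

        -- y - T has to reach at most T to the left, and T plus the right overhang of `y` to the
        -- right. Only for residue 3 does this require the extra assumption `short`, a right
        -- overhang of at most 3T/2.
        hubˡ : ∀ s e → Kind (suc k) g y s e → s + 4 * q + T ≤ y → y ≤ s + 2 * T + 4 * q → y ≤ e → e ≤ y + 2 * T + q + 4 * q →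
          (∀ h → g ≡ 4 * h + 1 → 4 * e ≤ 4 * y + 6 * T + δ) → e ≤ n →
          ∀ u → y ≡ u + T → ∀ {j a} → j < q → s ≤ a → a < e → Adj (u + j) a
        hubˡ s e κ sy ys ye ey short en u y≡u = go κ
          where
          u≡ : u ≡ (2 * g + 1) * T
          u≡ = +-cancelʳ-≡ T _ _ (trans (sym y≡u) y≡′)
          uq : u + q ≤ e
          uq = ((u + q ≤ e) ∋ lin (≡⇒≥ y≡u ⊕ ye ⊕ T≥)
              (solve 5 (λ y u T q e → u :+ q :+ (y :+ e :+ T) :+ 7 :* q ⊜ e :+ (u :+ T :+ y :+ 8 :* q)) refl y u T q e))
          lo : 4 * u ≤ 4 * s + 4 * T + δ
          lo = ((4 * u ≤ 4 * s + 4 * T + δ) ∋ lin (4 ⊗ ≡⇒≥ y≡u ⊕ 4 ⊗ ys ⊕ δ≥)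
              (solve 6 (λ y u T q s δ → 4 :* u :+ (4 :* y :+ 4 :* (s :+ 2 :* T :+ 4 :* q) :+ δ) :+ 24 :* q
                ⊜ 4 :* s :+ 4 :* T :+ δ :+ (4 :* (u :+ T) :+ 4 :* y :+ 40 :* q)) refl y u T q s δ))
          go : Kind (suc k) g y s e → ∀ {j a} → j < q → s ≤ a → a < e → Adj (u + j) a
          go (odd h g≡ z) = [_,_]′ (λ p → hub o₁ (proj₁ o) u (trans 4h+1 p) u≡ s e ((4 * u ≤ 4 * s + 8 * T + δ) ∋ lin lo
              (solve 4 (λ u s T δ → 4 :* u :+ (4 :* s :+ 4 :* T :+ δ) :+ 4 :* T ⊜ 4 :* s :+ 8 :* T :+ δ :+ 4 :* u) refl u s T δ)) (hi z) uq en)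
                              (λ p → hub o₅ (proj₁ o) u (trans 4h+1 p) u≡ s e ((4 * u ≤ 4 * s + 9 * T + δ) ∋ lin lo
                                  (solve 4 (λ u s T δ → 4 :* u :+ (4 :* s :+ 4 :* T :+ δ) :+ 5 :* T ⊜ 4 :* s :+ 9 :* T :+ δ :+ 4 :* u) refl u s T δ)) (hi z) uq en) (proj₂ o)
            where
            o = octant₁ h
            4h+1 : 2 * g + 1 ≡ 4 * h + 1
            4h+1 = trans (cong (λ g → 2 * g + 1) g≡) (solve 1 (λ h → 2 :* (2 :* h) :+ con 1 ⊜ 4 :* h :+ con 1) refl h)
            -- The left overhang is at least T + 4 q here, so the bound 2T leaves at most T/2 on the
            -- right. The slack 40 q is 4⋅18 q - 8⋅4 q in the first case.
            hi : Z y (2 * T) s e → 4 * e ≤ 4 * u + 6 * T + δ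
            hi (inj₁ z) = ((4 * e ≤ 4 * u + 6 * T + δ) ∋ lin (4 ⊗ ≡⇒≤ y≡u ⊕ 4 ⊗ z ⊕ 8 ⊗ sy ⊕ δ≥)
                (solve 7 (λ y u T q s e δ → 4 :* e :+ (4 :* (u :+ T) :+ 4 :* (2 :* s :+ 2 :* T :+ 18 :* q) :+ 8 :* y :+ δ) :+ 2 :* T
                  ⊜ 4 :* u :+ 6 :* T :+ δ :+ (4 :* y :+ 4 :* (y :+ e) :+ 8 :* (s :+ 4 :* q :+ T) :+ 40 :* q)) refl y u T q s e δ))
            hi (inj₂ z) = ((4 * e ≤ 4 * u + 6 * T + δ) ∋ lin (4 ⊗ ≡⇒≤ y≡u ⊕ 2 ⊗ z ⊕ 2 ⊗ sy ⊕ δ≥)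
                (solve 7 (λ y u T q s e δ → 4 :* e :+ (4 :* (u :+ T) :+ 2 :* (y :+ s :+ 2 :* T :+ 18 :* q) :+ 2 :* y :+ δ) :+ 12 :* q
                  ⊜ 4 :* u :+ 6 :* T :+ δ :+ (4 :* y :+ 2 :* (2 :* e) :+ 2 :* (s :+ 4 :* q :+ T) :+ 40 :* q)) refl y u T q s e δ))
          go (two h g≡ z) = hub o₃ h u (trans (cong (λ g → 2 * g + 1) g≡) (solve 1 (λ h → 2 :* (4 :* h :+ con 1) :+ con 1 ⊜ 8 :* h :+ con 3) refl h)) u≡ s e
            ((4 * u ≤ 4 * s + 6 * T + δ) ∋ lin lo
                (solve 4 (λ u s T δ → 4 :* u :+ (4 :* s :+ 4 :* T :+ δ) :+ 2 :* T ⊜ 4 :* s :+ 6 :* T :+ δ :+ 4 :* u) refl u s T δ))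
            (let m = short h g≡ in ((4 * e ≤ 4 * u + 10 * T + δ) ∋ lin (4 ⊗ ≡⇒≤ y≡u ⊕ m)
                   (solve 5 (λ y u T e δ → 4 :* e :+ (4 :* (u :+ T) :+ (4 :* y :+ 6 :* T :+ δ)) :+ con 0
                     ⊜ 4 :* u :+ 10 :* T :+ δ :+ (4 :* y :+ 4 :* e)) refl y u T e δ))) uq en
          go (four h g≡) = hub o₇ h u (trans (cong (λ g → 2 * g + 1) g≡) (solve 1 (λ h → 2 :* (4 :* h :+ con 3) :+ con 1 ⊜ 8 :* h :+ con 7) refl h)) u≡ s e
            ((4 * u ≤ 4 * s + 6 * T + δ) ∋ lin lo
                (solve 4 (λ u s T δ → 4 :* u :+ (4 :* s :+ 4 :* T :+ δ) :+ 2 :* T ⊜ 4 :* s :+ 6 :* T :+ δ :+ 4 :* u) refl u s T δ))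
            ((4 * e ≤ 4 * u + 12 * T + δ) ∋ lin (4 ⊗ ≡⇒≤ y≡u ⊕ 4 ⊗ ey ⊕ δ≥)
                (solve 6 (λ y u T q e δ → 4 :* e :+ (4 :* (u :+ T) :+ 4 :* (y :+ 2 :* T :+ q :+ 4 :* q) :+ δ) :+ 20 :* q
                  ⊜ 4 :* u :+ 12 :* T :+ δ :+ (4 :* y :+ 4 :* e :+ 40 :* q)) refl y u T q e δ)) uq en

        -- y + T has to reach T plus the left overhang of `y` to the left. `short₂` and `short₄`
        -- bound that overhang by 5T/4 for residue 5, and by T for residue 1, where the left node
        -- has been dealt with already.
        hubʳ : ∀ s e → Kind (suc k) g y s e → y + T + q + 4 * q ≤ e → e ≤ y + 2 * T + q + 4 * q →
          (∀ h → g ≡ 4 * h + 1 → 4 * y ≤ 4 * s + 5 * T + δ) → (∀ h → g ≡ 4 * h + 3 → y ≤ s + T + 4 * q) → e ≤ n →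
          ∀ u → u ≡ y + T → ∀ {j a} → j < q → s ≤ a → a < e → Adj (u + j) a
        hubʳ s e κ ye ey short₂ short₄ en u u≡y = go κ
          where
          u≡ : u ≡ (2 * g + 3) * T
          u≡ = trans u≡y (trans (cong (_+ T) y≡′) (((∀ g T → ((2 * g + 1) * T + T) + T ≡ (2 * g + 3) * T) ∋ solve-∀) g T))
          uq : u + q ≤ e
          uq = ((u + q ≤ e) ∋ lin (≡⇒≤ u≡y ⊕ ye)
              (solve 5 (λ y u T q e → u :+ q :+ (y :+ T :+ e) :+ 4 :* q ⊜ e :+ (u :+ (y :+ T :+ q :+ 4 :* q))) refl y u T q e))
          hi : 4 * e ≤ 4 * u + 4 * T + δ
          hi = ((4 * e ≤ 4 * u + 4 * T + δ) ∋ lin (4 ⊗ ≡⇒≥ u≡y ⊕ 4 ⊗ ey ⊕ δ≥)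
              (solve 6 (λ y u T q e δ → 4 :* e :+ (4 :* u :+ 4 :* (y :+ 2 :* T :+ q :+ 4 :* q) :+ δ) :+ 20 :* q
                ⊜ 4 :* u :+ 4 :* T :+ δ :+ (4 :* (y :+ T) :+ 4 :* e :+ 40 :* q)) refl y u T q e δ))
          go : Kind (suc k) g y s e → ∀ {j a} → j < q → s ≤ a → a < e → Adj (u + j) a
          go (odd h g≡ z) = [_,_]′ (λ p → hub o₃ (proj₁ o) u (trans 4h+3 p) u≡ s e (lo z) ((4 * e ≤ 4 * u + 10 * T + δ) ∋ lin hi
              (solve 4 (λ u e T δ → 4 :* e :+ (4 :* u :+ 4 :* T :+ δ) :+ 6 :* T ⊜ 4 :* u :+ 10 :* T :+ δ :+ 4 :* e) refl u e T δ)) uq en)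
                              (λ p → hub o₇ (proj₁ o) u (trans 4h+3 p) u≡ s e (lo z) ((4 * e ≤ 4 * u + 12 * T + δ) ∋ lin hi
                                  (solve 4 (λ u e T δ → 4 :* e :+ (4 :* u :+ 4 :* T :+ δ) :+ 8 :* T ⊜ 4 :* u :+ 12 :* T :+ δ :+ 4 :* e) refl u e T δ)) uq en) (proj₂ o)
            where
            o = octant₃ h
            4h+3 : 2 * g + 3 ≡ 4 * h + 3
            4h+3 = trans (cong (λ g → 2 * g + 3) g≡) (solve 1 (λ h → 2 :* (2 :* h) :+ con 3 ⊜ 4 :* h :+ con 3) refl h)
            lo : Z y (2 * T) s e → 4 * u ≤ 4 * s + 6 * T + δ
            lo (inj₁ z) = ((4 * u ≤ 4 * s + 6 * T + δ) ∋ lin (4 ⊗ ≡⇒≤ u≡y ⊕ 2 ⊗ z ⊕ 2 ⊗ ye ⊕ δ≥)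
                (solve 7 (λ y u T q s e δ → 4 :* u :+ (4 :* (y :+ T) :+ 2 :* (2 :* s :+ 2 :* T :+ 18 :* q) :+ 2 :* e :+ δ) :+ 14 :* q
                  ⊜ 4 :* s :+ 6 :* T :+ δ :+ (4 :* u :+ 2 :* (y :+ e) :+ 2 :* (y :+ T :+ q :+ 4 :* q) :+ 40 :* q)) refl y u T q s e δ))
            lo (inj₂ z) = ((4 * u ≤ 4 * s + 6 * T + δ) ∋ lin (4 ⊗ ≡⇒≤ u≡y ⊕ 4 ⊗ z ⊕ 8 ⊗ ye ⊕ δ≥)
                (solve 7 (λ y u T q s e δ → 4 :* u :+ (4 :* (y :+ T) :+ 4 :* (y :+ s :+ 2 :* T :+ 18 :* q) :+ 8 :* e :+ δ) :+ (2 :* T :+ 8 :* q)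
                  ⊜ 4 :* s :+ 6 :* T :+ δ :+ (4 :* u :+ 4 :* (2 :* e) :+ 8 :* (y :+ T :+ q :+ 4 :* q) :+ 40 :* q)) refl y u T q s e δ))
          go (two h g≡ z) = hub o₅ h u (trans (cong (λ g → 2 * g + 3) g≡) (solve 1 (λ h → 2 :* (4 :* h :+ con 1) :+ con 3 ⊜ 8 :* h :+ con 5) refl h)) u≡ s e
            (let m = short₂ h g≡ in ((4 * u ≤ 4 * s + 9 * T + δ) ∋ lin (4 ⊗ ≡⇒≤ u≡y ⊕ m)
                   (solve 5 (λ y u T s δ → 4 :* u :+ (4 :* (y :+ T) :+ (4 :* s :+ 5 :* T :+ δ)) :+ con 0
                     ⊜ 4 :* s :+ 9 :* T :+ δ :+ (4 :* u :+ 4 :* y)) refl y u T s δ)))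
            ((4 * e ≤ 4 * u + 6 * T + δ) ∋ lin hi
                (solve 4 (λ u e T δ → 4 :* e :+ (4 :* u :+ 4 :* T :+ δ) :+ 2 :* T ⊜ 4 :* u :+ 6 :* T :+ δ :+ 4 :* e) refl u e T δ)) uq en
          go (four h g≡) = hub o₁ (h + 1) u (trans (cong (λ g → 2 * g + 3) g≡) (solve 1 (λ h → 2 :* (4 :* h :+ con 3) :+ con 3 ⊜ 8 :* (h :+ con 1) :+ con 1) refl h)) u≡ s e
            (let m = short₄ h g≡ in ((4 * u ≤ 4 * s + 8 * T + δ) ∋ lin (4 ⊗ ≡⇒≤ u≡y ⊕ 4 ⊗ m ⊕ δ≥)
                   (solve 6 (λ y u T q s δ → 4 :* u :+ (4 :* (y :+ T) :+ 4 :* (s :+ T :+ 4 :* q) :+ δ) :+ 24 :* q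
                     ⊜ 4 :* s :+ 8 :* T :+ δ :+ (4 :* u :+ 4 :* y :+ 40 :* q)) refl y u T q s δ)))
            ((4 * e ≤ 4 * u + 6 * T + δ) ∋ lin hi
                (solve 4 (λ u e T δ → 4 :* e :+ (4 :* u :+ 4 :* T :+ δ) :+ 2 :* T ⊜ 4 :* u :+ 6 :* T :+ δ :+ 4 :* e) refl u e T δ)) uq en

        freshʳ : ∀ e → e ≤ y + 2 * T + q + 4 * q → e ≤ n → Handler (λ z e′ → y ≤ z × e′ ≡ e) None
        freshʳ e ey en C P z .e uC s≤ len free (yz , refl) = fresh′ (suc g) C P z e uC s≤ len free
          ( ≤-trans (≤-reflexive (sym y≡)) (≤-trans yz (m≤m+n z _))
          , subst (λ y → e ≤ y + 2 * T + q + 4 * q) y≡ ey , en)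

        freshˡ : ∀ s → y ≤ s + 2 * T + 4 * q → y ≤ n → Handler (λ s′ z → z ≤ y × s′ ≡ s) None
        freshˡ s ys yn C P .s z uC s≤ len free (zy , refl) = fresh′ g C P s z uC s≤ len free
          ( (((g * (2 * T)) ≤ s + 4 * q) ∋ lin (≡⇒≥ y≡ ⊕ ys)
              (solve 5 (λ y v T q s → v :+ (y :+ (s :+ 2 :* T :+ 4 :* q)) :+ con 0 ⊜ s :+ 4 :* q :+ (2 :* T :+ v :+ y)) refl y (g * (2 * T)) T q s))
          , ((z ≤ (g * (2 * T)) + 2 * T + q + 4 * q) ∋ lin (≡⇒≤ y≡ ⊕ zy)
              (solve 5 (λ y v T q z → z :+ (2 :* T :+ v :+ y) :+ 5 :* q ⊜ v :+ 2 :* T :+ q :+ 4 :* q :+ (y :+ z)) refl y (g * (2 * T)) T q z))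
          , ≤-trans zy yn)

        onlyRight : Handler LState (Block y)
        onlyRight C P s e uC s≤e len free (sy , ye , ys , ey , en , κ) with ≤-<-connex (y + T + q + 4 * q) e
        ... | inj₂ far = lower C P s e uC s≤e len free (sy , ye , ys , <⇒≤ far , en , κ)
        ... | inj₁ h = right C P s e uC len free h ey sy en
          (hubʳ s e κ h ey (λ _ _ → ((4 * y ≤ 4 * s + 5 * T + δ) ∋ lin (4 ⊗ ys ⊕ δ≥)
              (solve 5 (λ y T q s δ → 4 :* y :+ (4 :* (s :+ T :+ 4 :* q) :+ δ) :+ (T :+ 24 :* q)
                ⊜ 4 :* s :+ 5 :* T :+ δ :+ (4 :* y :+ 40 :* q)) refl y T q s δ))) (λ _ _ → ys) en)
          (λ C P z₁ z₂ uC s≤ len free (sz , ze , zy , yz , zT) → lower C P z₁ z₂ uC s≤ len free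
            (zy , yz , ≤-trans ys (+-monoˡ-≤ (4 * q) (+-monoˡ-≤ T sz)) , zT , ≤-trans ze en , Kind-mono sz ze κ))
          (freshˡ s ((y ≤ s + 2 * T + 4 * q) ∋ lin ys
              (solve 4 (λ y T q s → y :+ (s :+ T :+ 4 :* q) :+ T ⊜ s :+ 2 :* T :+ 4 :* q :+ y) refl y T q s)) (≤-trans ye en))

        onlyLeft : Handler RState (Block y)
        onlyLeft C P s e uC s≤e len free (sy , ye , ys , ey , en , κ) with ≤-<-connex (s + 4 * q + T) y
        ... | inj₂ far = lower C P s e uC s≤e len free (sy , ye , ((y ≤ s + T + 4 * q) ∋ lin far
            (solve 4 (λ y T q s → y :+ (s :+ 4 :* q :+ T) :+ con 1 ⊜ s :+ T :+ 4 :* q :+ (con 1 :+ y)) refl y T q s)) , ey , en , κ)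
        ... | inj₁ h = left C P s e uC len free h ys ye en
          (hubˡ s e κ h ys ye ey′ (λ _ _ → ((4 * e ≤ 4 * y + 6 * T + δ) ∋ lin (4 ⊗ ey ⊕ δ≥)
              (solve 5 (λ y T q e δ → 4 :* e :+ (4 :* (y :+ T :+ q :+ 4 :* q) :+ δ) :+ (2 :* T :+ 20 :* q)
                ⊜ 4 :* y :+ 6 :* T :+ δ :+ (4 :* e :+ 40 :* q)) refl y T q e δ))) en)
          (λ C P z₁ z₂ uC s≤ len free (sz , ze , zy , yz , yT) → lower C P z₁ z₂ uC s≤ len free
            (zy , yz , yT , ≤-trans ze ey , ≤-trans ze en , Kind-mono sz ze κ))
          (freshʳ e ey′ en)
          where
          ey′ : e ≤ y + 2 * T + q + 4 * q
          ey′ = ((e ≤ y + 2 * T + q + 4 * q) ∋ lin ey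
              (solve 4 (λ y T q e → e :+ (y :+ T :+ q :+ 4 :* q) :+ T ⊜ y :+ 2 :* T :+ q :+ 4 :* q :+ e) refl y T q e))

        leftFirst : ∀ C P s e → Unique C → s ≤ e → Fills C P s e → Free P s e (Block y) → HState (suc k) g y s e →
          (∀ h → g ≡ 4 * h + 1 → 4 * e ≤ 4 * y + 6 * T + δ) → Emb C P s e
        leftFirst C P s e uC s≤e len free (sy , ye , ys , ey , en , κ) short with ≤-<-connex (s + 4 * q + T) y
        ... | inj₂ far = onlyRight C P s e uC s≤e len free (sy , ye , ((y ≤ s + T + 4 * q) ∋ lin far
            (solve 4 (λ y T q s → y :+ (s :+ 4 :* q :+ T) :+ con 1 ⊜ s :+ T :+ 4 :* q :+ (con 1 :+ y)) refl y T q s)) , ey , en , κ)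
        ... | inj₁ h = left C P s e uC len free h ys ye en (hubˡ s e κ h ys ye ey short en)
          (λ C P z₁ z₂ uC s≤ len free (sz , ze , zy , yz , yT) → onlyRight C P z₁ z₂ uC s≤ len free
            (zy , yz , yT , ≤-trans ze ey , ≤-trans ze en , Kind-mono sz ze κ))
          (freshʳ e ey en)

        -- The right overhang exceeds 3T/2, so the bound 4T leaves at most 5T/4 on the left, or at
        -- most T in the second case of `Z`. Once y + T is used, the right overhang is down to T,
        -- and y - T reaches that far as well.
        rightFirst : ∀ C P s e → Unique C → s ≤ e → Fills C P s e → Free P s e (Block y) → HState (suc k) g y s e →
          ∀ h → g ≡ 4 * h + 1 → Z y (4 * T) s e → 4 * y + 6 * T + δ < 4 * e → Emb C P s e
        rightFirst C P s e uC s≤e len free (sy , ye , ys , ey , en , κ) h g≡ z far =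
          right C P s e uC len free ye′ ey sy en
          (hubʳ s e κ ye′ ey (λ _ _ → short z) (λ h′ g≡′ → ⊥-elim (1≢3 h h′ (trans (sym g≡) g≡′))) en)
          (λ C P z₁ z₂ uC s≤ len free (sz , ze , zy , yz , zT) → onlyLeft C P z₁ z₂ uC s≤ len free
            (zy , yz , ≤-trans ys (+-monoˡ-≤ (4 * q) (+-monoˡ-≤ (2 * T) sz)) , zT , ≤-trans ze en , Kind-mono sz ze κ))
          (freshˡ s ys (≤-trans ye en))
          where
          ye′ : y + T + q + 4 * q ≤ e
          ye′ = ((y + T + q + 4 * q ≤ e) ∋ lin* 3 (far ⊕ δ≥)
              (solve 5 (λ y T q e δ → 4 :* (y :+ T :+ q :+ 4 :* q) :+ (4 :* e :+ δ) :+ (2 :* T :+ 20 :* q :+ con 4)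
                ⊜ 4 :* e :+ ((con 1 :+ (4 :* y :+ 6 :* T :+ δ)) :+ 40 :* q) :+ con 3) refl y T q e δ))
          short : Z y (4 * T) s e → 4 * y ≤ 4 * s + 5 * T + δ
          short (inj₁ z) = ((4 * y ≤ 4 * s + 5 * T + δ) ∋ lin* 1 (4 ⊗ z ⊕ far ⊕ 2 ⊗ δ≥)
              (solve 6 (λ y T q s e δ → 2 :* (4 :* y) :+ (4 :* (2 :* s :+ 4 :* T :+ 18 :* q) :+ 4 :* e :+ 2 :* δ) :+ (8 :* q :+ δ :+ con 2)
                ⊜ 2 :* (4 :* s :+ 5 :* T :+ δ) :+ (4 :* (y :+ e) :+ (con 1 :+ (4 :* y :+ 6 :* T :+ δ)) :+ 2 :* (40 :* q)) :+ con 1) refl y T q s e δ))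
          short (inj₂ z) = ((4 * y ≤ 4 * s + 5 * T + δ) ∋ lin (4 ⊗ z ⊕ 2 ⊗ far ⊕ 2 ⊗ δ≥)
              (solve 6 (λ y T q s e δ → 4 :* y :+ (4 :* (y :+ s :+ 4 :* T :+ 18 :* q) :+ 2 :* (4 :* e) :+ 2 :* δ) :+ (T :+ 8 :* q :+ δ :+ con 2)
                ⊜ 4 :* s :+ 5 :* T :+ δ :+ (4 :* (2 :* e) :+ 2 :* (con 1 :+ (4 :* y :+ 6 :* T :+ δ)) :+ 2 :* (40 :* q))) refl y T q s e δ))
          1≢3 : ∀ h h′ → 4 * h + 1 ≡ 4 * h′ + 3 → ⊥
          1≢3 h h′ eq with <-cmp h h′
          ... | tri< a _ _ = n≮0 ((1 ≤ 0) ∋ lin (≡⇒≥ eq ⊕ 4 ⊗ a)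
              (solve 2 (λ h h′ → con 1 :+ (4 :* h :+ con 1 :+ 4 :* h′) :+ con 5 ⊜ con 0 :+ (4 :* h′ :+ con 3 :+ 4 :* (con 1 :+ h))) refl h h′))
          ... | tri≈ _ refl _ = n≮0 ((1 ≤ 0) ∋ lin (≡⇒≥ eq)
              (solve 1 (λ h → con 1 :+ (4 :* h :+ con 1) :+ con 1 ⊜ con 0 :+ (4 :* h :+ con 3)) refl h))
          ... | tri> _ _ a = n≮0 ((1 ≤ 0) ∋ lin (≡⇒≤ eq ⊕ 4 ⊗ a)
              (solve 2 (λ h h′ → con 1 :+ (4 :* h′ :+ con 3 :+ 4 :* h) :+ con 1 ⊜ con 0 :+ (4 :* h :+ con 1 :+ 4 :* (con 1 :+ h′))) refl h h′))

        -- y - T is tried before y + T, except for the exponent 1 with a right overhang above 3T/2.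
        holed′ : Handler (HState (suc k) g y) (Block y)
        holed′ C P s e uC s≤e len free st@(sy , ye , ys , ey , en , κ) with ≤-<-connex (4 * e) (4 * y + 6 * T + δ) | κ
        ... | inj₁ h   | _            = leftFirst C P s e uC s≤e len free st (λ _ _ → h)
        ... | inj₂ far | two h g≡ z   = rightFirst C P s e uC s≤e len free st h g≡
          (subst (λ B → Z y B s e) (((∀ T → 2 * (2 * T) ≡ 4 * T) ∋ solve-∀) T) z) far
        ... | inj₂ _   | odd h g≡ _   = leftFirst C P s e uC s≤e len free st (λ h′ g≡′ → ⊥-elim (2h≢4h+1 h h′ (trans (sym g≡) g≡′)))
          where
          2h≢4h+1 : ∀ h h′ → 2 * h ≡ 4 * h′ + 1 → ⊥
          2h≢4h+1 h h′ eq with <-cmp h (2 * h′)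
          ... | tri< a _ _ = n≮0 ((1 ≤ 0) ∋ lin (≡⇒≥ eq ⊕ 2 ⊗ a)
              (solve 2 (λ h h′ → con 1 :+ (2 :* h :+ 2 :* (2 :* h′)) :+ con 2 ⊜ con 0 :+ (4 :* h′ :+ con 1 :+ 2 :* (con 1 :+ h))) refl h h′))
          ... | tri≈ _ refl _ = n≮0 ((1 ≤ 0) ∋ lin (≡⇒≥ eq)
              (solve 1 (λ h′ → con 1 :+ 2 :* (2 :* h′) :+ con 0 ⊜ con 0 :+ (4 :* h′ :+ con 1)) refl h′))
          ... | tri> _ _ a = n≮0 ((1 ≤ 0) ∋ lin (≡⇒≤ eq ⊕ 2 ⊗ a)
              (solve 2 (λ h h′ → con 1 :+ (4 :* h′ :+ con 1 :+ 2 :* h) :+ con 0 ⊜ con 0 :+ (2 :* h :+ 2 :* (con 1 :+ (2 :* h′)))) refl h h′))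
        ... | inj₂ _   | four h g≡    = leftFirst C P s e uC s≤e len free st (λ h′ g≡′ → ⊥-elim (3≢1 h h′ (trans (sym g≡) g≡′)))
          where
          3≢1 : ∀ h h′ → 4 * h + 3 ≡ 4 * h′ + 1 → ⊥
          3≢1 h h′ eq with <-cmp h h′
          ... | tri< a _ _ = n≮0 ((1 ≤ 0) ∋ lin (≡⇒≥ eq ⊕ 4 ⊗ a)
              (solve 2 (λ h h′ → con 1 :+ (4 :* h :+ con 3 :+ 4 :* h′) :+ con 1 ⊜ con 0 :+ (4 :* h′ :+ con 1 :+ 4 :* (con 1 :+ h))) refl h h′))
          ... | tri≈ _ refl _ = n≮0 ((1 ≤ 0) ∋ lin (≡⇒≤ eq)
              (solve 1 (λ h → con 1 :+ (4 :* h :+ con 1) :+ con 1 ⊜ con 0 :+ (4 :* h :+ con 3)) refl h))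
          ... | tri> _ _ a = n≮0 ((1 ≤ 0) ∋ lin (≡⇒≤ eq ⊕ 4 ⊗ a)
              (solve 2 (λ h h′ → con 1 :+ (4 :* h′ :+ con 1 :+ 4 :* h) :+ con 5 ⊜ con 0 :+ (4 :* h :+ con 3 :+ 4 :* (con 1 :+ h′))) refl h h′))

    level : ∀ k → Level k
    level zero    = level-zero
    level (suc k) = record { fresh = NextLevel.fresh′ k (level k) ; holed = NextLevel.Holed.holed′ k (level k) }

    -- The whole line lies between the multiples 0 and 1 of a spacing of at least `n`, so no node of
    -- level k or higher is available in it.
    universal : ∀ k → n ≤ spacing q k → ∀ C → Unique C → length C ≡ n → Emb C (λ _ → true) 0 n
    universal k n≤ C uC len = Level.fresh (level k) 0 C (λ _ → true) 0 n uC z≤n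
      (trans (+-identityʳ _) (trans len (sym (all-true n)))) (λ _ _ _ _ → refl)
      (z≤n , ≤-trans n≤ (≤-trans (m≤m+n _ q) (m≤m+n _ (4 * q))) , ≤-refl)
      where
      all-true : ∀ n → cnt (λ _ → true) n ≡ n
      all-true zero    = refl
      all-true (suc n) = cong suc (all-true n)

-- Rooted trees: depth, parents and ancestors.

module RootedTrees where
  open import Defs
  open import Data.Bool using (false; T)
  open import Data.Fin as Fin using (Fin; zero; suc; inject₁; fromℕ)
  import Data.Fin.Properties as Fin
  open import Data.List using (List; []; _∷_; _++_; length)
  open import Data.List.Membership.Propositional using (_∈_)
  open import Data.List.Membership.Propositional.Properties using (∈-∃++; ∈-++⁺ˡ; ∈-++⁺ʳ; ∈-++⁻)
  open import Data.List.Properties using (length-++)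
  import Data.List.Relation.Unary.All as All
  open import Data.List.Relation.Unary.Any using (here; there)
  open import Data.List.Relation.Unary.AllPairs using ([]; _∷_)
  open import Data.List.Relation.Unary.Unique.Propositional using (Unique)
  open import Data.Nat
  open import Data.Nat.Properties
  open import Relation.Binary.Construct.Closure.ReflexiveTransitive using (Star; ε; _◅_; _◅◅_; reverse)
  open import Relation.Nullary.Decidable using (_×-dec_; _⊎-dec_; isYes)
  open import Data.Bool using (T?)

  open Graph using (_~_)

  ~-sym : ∀ {n} (G : Graph n) {u v} → _~_ G u v → _~_ G v u
  ~-sym G {u} {v} = subst T (Graph.symmetric G u v)

  ~-irrefl : ∀ {n} (G : Graph n) {u} → ¬ _~_ G u u
  ~-irrefl G {u} = subst T (Graph.loopless G u)

  length-⊆ : ∀ {A : Set} (xs ys : List A) → Unique xs → (∀ {x} → x ∈ xs → x ∈ ys) → length xs ≤ length ys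
  length-⊆ []       ys _        _   = z≤n
  length-⊆ (x ∷ xs) ys (x∉ ∷ u) sub with ∈-∃++ (sub (here refl))
  ... | as , bs , refl = ≤-trans (s≤s (length-⊆ xs (as ++ bs) u sub′))
      (≤-reflexive (trans (cong suc (length-++ as)) (trans (sym (+-suc (length as) (length bs))) (sym (length-++ as)))))
    where
    sub′ : ∀ {y} → y ∈ xs → y ∈ as ++ bs
    sub′ y∈ with ∈-++⁻ as (sub (there y∈))
    ... | inj₁ h = ∈-++⁺ˡ h
    ... | inj₂ (here refl) = ⊥-elim (All.lookup x∉ y∈ refl)
    ... | inj₂ (there h)   = ∈-++⁺ʳ as h

  isYes-cong : ∀ {A B : Set} (a? : Dec A) (b? : Dec B) → (A → B) → (B → A) → isYes a? ≡ isYes b?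
  isYes-cong (yes _) (yes _) _ _ = refl
  isYes-cong (no _)  (no _)  _ _ = refl
  isYes-cong (yes a) (no ¬b) f _ = ⊥-elim (¬b (f a))
  isYes-cong (no ¬a) (yes b) _ g = ⊥-elim (¬a (g b))

  isYes-no : ∀ {A : Set} (a? : Dec A) → ¬ A → isYes a? ≡ false
  isYes-no (yes a) ¬a = ⊥-elim (¬a a)
  isYes-no (no _)  _  = refl

  isYes⁺ : ∀ {A : Set} (a? : Dec A) → A → T (isYes a?)
  isYes⁺ (yes _) _ = _
  isYes⁺ (no ¬a) a = ¬a a

  isYes⁻ : ∀ {A : Set} (a? : Dec A) → T (isYes a?) → A
  isYes⁻ (yes a) _ = a

  fromRelation : ∀ {n} {R : Fin n → Fin n → Set} → (∀ u v → Dec (R u v)) → (∀ {u v} → R u v → R v u) → (∀ {u} → ¬ R u u) → Graph n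
  fromRelation R? R-sym R-irrefl = record
    { adj = λ u v → isYes (R? u v) ; symmetric = λ u v → isYes-cong (R? u v) (R? v u) R-sym R-sym
    ; loopless = λ u → isYes-no (R? u u) R-irrefl }

  record SimplePath {t} (R : Fin t → Fin t → Set) (x z : Fin t) : Set where
    field
      {len} : ℕ
      at    : Fin (suc len) → Fin t
      start : at zero ≡ x
      end   : at (fromℕ len) ≡ z
      step  : ∀ i → R (at (inject₁ i)) (at (suc i))
      inj   : Injective _≡_ _≡_ at

  module _ {t} {R : Fin t → Fin t → Set} where

    tail : ∀ {x z} (p : SimplePath R x z) → let open SimplePath p in ∀ (i : Fin (suc len)) → SimplePath R (at i) z
    tail p zero = record { at = at ; start = refl ; end = end ; step = step ; inj = inj }
      where open SimplePath p
    tail record { len = suc l ; at = at ; end = end ; step = step ; inj = inj } (suc i) =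
      tail record { at = at ∘ suc ; start = refl ; end = end ; step = step ∘ suc ; inj = Fin.suc-injective ∘ inj } i

    loop-erase : ∀ {x z} → Star R x z → SimplePath R x z
    loop-erase {x} ε = record { len = 0 ; at = λ _ → x ; start = refl ; end = refl ; step = λ () ; inj = λ { {zero} {zero} _ → refl } }
    loop-erase {x} {z} (r ◅ rs) with loop-erase rs
    ... | p with Fin.any? (λ i → SimplePath.at p i Fin.≟ x)
    ...   | yes (i , eq) = subst (λ x → SimplePath R x z) eq (tail p i)
    ...   | no  x∉ = record { at = at′ ; start = refl ; end = end ; step = step′ ; inj = inj′ }
      where
      open SimplePath p
      at′ : Fin (suc (suc len)) → Fin t
      at′ zero    = x
      at′ (suc i) = at i
      step′ : ∀ i → R (at′ (inject₁ i)) (at′ (suc i))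
      step′ zero    = subst (R x) (sym start) r
      step′ (suc i) = step i
      inj′ : Injective _≡_ _≡_ at′
      inj′ {zero}  {zero}  _  = refl
      inj′ {zero}  {suc j} eq = ⊥-elim (x∉ (j , sym eq))
      inj′ {suc i} {zero}  eq = ⊥-elim (x∉ (i , eq))
      inj′ {suc i} {suc j} eq = cong suc (inj eq)

  module Rooted {t} (G : Graph t) (r : Fin t) (connected : Connected G) (acyclic : ¬ Cycle G) where

    -- Walks of bounded length from the root are decidable by recursion on the bound, so the least
    -- bound, the depth, can be computed.
    Within : ℕ → Fin t → Set
    Within zero    x = x ≡ r
    Within (suc k) x = Within k x ⊎ ∃ λ y → _~_ G y x × Within k y

    within? : ∀ k x → Dec (Within k x)
    within? zero    x = x Fin.≟ r
    within? (suc k) x = within? k x ⊎-dec Fin.any? (λ y → T? (Graph.adj G y x) ×-dec within? k y)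

    within-≤ : ∀ {j k x} → j ≤ k → Within j x → Within k x
    within-≤ {j} {k} j≤k w with m≤n⇒m<n∨m≡n j≤k
    ... | inj₂ refl = w
    ... | inj₁ (s≤s j≤k′) = inj₁ (within-≤ j≤k′ w)

    reachable : ∀ {x y} → Star (_~_ G) x y → ∀ {k} → Within k x → ∃ λ m → Within m y
    reachable ε        w = _ , w
    reachable (e ◅ es) w = reachable es (inj₂ (_ , e , w))

    least : ∀ {x} k → Within k x → ∃ λ m → Within m x × (∀ j → j < m → ¬ Within j x)
    least zero w = 0 , w , λ _ ()
    least {x} (suc k) w with within? k x
    ... | yes w′ = least k w′
    ... | no ¬w′ = suc k , w , λ { j (s≤s j≤k) wj → ¬w′ (within-≤ j≤k wj) }

    abstract
      distance : ∀ x → ∃ λ m → Within m x × (∀ j → j < m → ¬ Within j x)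
      distance x = let m , w = reachable (connected r x) {0} refl in least m w

    depth : Fin t → ℕ
    depth x = proj₁ (distance x)

    depth-≤ : ∀ {m} x → Within m x → depth x ≤ m
    depth-≤ {m} x w = ≮⇒≥ (λ m<d → proj₂ (proj₂ (distance x)) m m<d w)

    abstract
      -- The root is its own parent, which makes `up` and `anc` total. Any other node has a
      -- neighbour one step nearer to the root, by minimality of its depth.
      parent′ : ∀ x → ∃ λ y → depth y ≡ pred (depth x) × (x ≡ r × y ≡ r ⊎ _~_ G y x × depth x ≡ suc (depth y))
      parent′ x with depth x in eq | proj₁ (proj₂ (distance x)) | proj₂ (proj₂ (distance x))
      ... | zero  | x≡r | _ = r , n≤0⇒n≡0 (depth-≤ r refl) , inj₁ (x≡r , refl)
      ... | suc m | inj₁ w | min = ⊥-elim (min m ≤-refl w)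
      ... | suc m | inj₂ (y , y~x , w) | min = y , dy , inj₂ (y~x , cong suc (sym dy))
        where
        dy : depth y ≡ m
        dy = ≤-antisym (depth-≤ y w) (≮⇒≥ λ dy<m → min m ≤-refl
          (within-≤ dy<m (inj₂ (y , y~x , proj₁ (proj₂ (distance y))))))

    parent : Fin t → Fin t
    parent x = proj₁ (parent′ x)

    depth-parent : ∀ x → depth (parent x) ≡ pred (depth x)
    depth-parent x = proj₁ (proj₂ (parent′ x))

    Link : Fin t → Fin t → Set
    Link x y = y ≡ parent x ⊎ x ≡ parent y

    parent-edge : ∀ x → x ≢ r → _~_ G (parent x) x
    parent-edge x x≢r with proj₂ (proj₂ (parent′ x))
    ... | inj₁ (x≡r , _) = ⊥-elim (x≢r x≡r)
    ... | inj₂ (e , _)   = e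

    depth-suc : ∀ x → x ≢ r → depth x ≡ suc (depth (parent x))
    depth-suc x x≢r with proj₂ (proj₂ (parent′ x))
    ... | inj₁ (x≡r , _) = ⊥-elim (x≢r x≡r)
    ... | inj₂ (_ , e)   = e

    parent-root : parent r ≡ r
    parent-root with proj₂ (proj₂ (parent′ r))
    ... | inj₁ (_ , e) = e
    ... | inj₂ (_ , e) = ⊥-elim (0≢1+n (trans (sym (n≤0⇒n≡0 (depth-≤ r refl))) e))

    root-depth : ∀ {x} → depth x ≡ 0 → x ≡ r
    root-depth {x} eq with x Fin.≟ r
    ... | yes x≡r = x≡r
    ... | no  x≢r = ⊥-elim (0≢1+n (trans (sym eq) (depth-suc x x≢r)))

    rise : ∀ m x → depth x ≡ m → Star Link x r
    rise zero    x eq = subst (Star Link x) (root-depth eq) ε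
    rise (suc m) x eq = inj₁ refl ◅ rise m (parent x) (trans (depth-parent x) (cong pred eq))

    Link-sym : ∀ {x y} → Link x y → Link y x
    Link-sym (inj₁ e) = inj₂ e
    Link-sym (inj₂ e) = inj₁ e

    link-edge : ∀ {x y} → x ≢ y → Link x y → _~_ G x y
    link-edge {x} {y} x≢y (inj₁ refl) = ~-sym G (parent-edge x λ { refl → x≢y (sym parent-root) })
    link-edge {x} {y} x≢y (inj₂ refl) = parent-edge y λ { refl → x≢y parent-root }

    -- The edge x ~ y and a simple path from y to x along parent links would form
    -- a cycle, unless that path is a single link.
    edge-link : ∀ {x y} → _~_ G x y → Link x y
    edge-link {x} {y} x~y with loop-erase (rise _ y refl ◅◅ reverse Link-sym (rise _ x refl))
    ... | record { len = 0 ; start = refl ; end = refl } = ⊥-elim (~-irrefl G x~y)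
    ... | record { len = 1 ; start = refl ; end = refl ; step = step } = Link-sym (step zero)
    ... | p@record { len = suc (suc k) } = ⊥-elim (acyclic record
        { vertex = at ; distinct = inj
        ; step = λ i → link-edge (λ eq → <⇒≢ (s≤s (≤-reflexive (Fin.toℕ-inject₁ i))) (cong Fin.toℕ (inj {inject₁ i} {suc i} eq))) (step i)
        ; close = subst₂ (_~_ G) (sym end) (sym start) x~y })
      where open SimplePath p

    up : ℕ → Fin t → Fin t
    up zero    x = x
    up (suc j) x = up j (parent x)

    up-+ : ∀ i j x → up i (up j x) ≡ up (j + i) x
    up-+ i zero    x = refl
    up-+ i (suc j) x = up-+ i j (parent x)

    depth-up : ∀ j x → depth (up j x) ≡ depth x ∸ j
    depth-up zero    x = refl
    depth-up (suc j) x = trans (depth-up j (parent x)) (trans (cong (_∸ j) (depth-parent x)) (lem (depth x)))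
      where
      lem : ∀ d → pred d ∸ j ≡ d ∸ suc j
      lem zero    = 0∸n≡0 j
      lem (suc d) = refl

    anc : ℕ → Fin t → Fin t
    anc δ x = up (depth x ∸ δ) x

    depth-anc : ∀ {δ x} → δ ≤ depth x → depth (anc δ x) ≡ δ
    depth-anc {δ} {x} δ≤ = trans (depth-up (depth x ∸ δ) x) (m∸[m∸n]≡n δ≤)

    anc-anc : ∀ {δ γ x} → δ ≤ γ → γ ≤ depth x → anc δ (anc γ x) ≡ anc δ x
    anc-anc {δ} {γ} {x} δ≤γ γ≤ = trans (up-+ (depth (anc γ x) ∸ δ) (depth x ∸ γ) x)
      (cong (λ j → up j x) (trans (cong (λ g → (depth x ∸ γ) + (g ∸ δ)) (depth-anc γ≤)) (trans (sym (+-∸-assoc (depth x ∸ γ) δ≤γ)) (cong (_∸ δ) (m∸n+n≡m γ≤)))))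

    infix 4 _⊒_
    -- The ancestor order. The only candidate for an ancestor at a given depth is `anc` of that
    -- depth, so the order is an equation and decidable.
    _⊒_ : Fin t → Fin t → Set
    y ⊒ x = depth y ≤ depth x × anc (depth y) x ≡ y

    _⊒?_ : ∀ y x → Dec (y ⊒ x)
    y ⊒? x = (depth y ≤? depth x) ×-dec (anc (depth y) x Fin.≟ y)

    ⊒-refl : ∀ {x} → x ⊒ x
    ⊒-refl {x} = ≤-refl , cong (λ j → up j x) (n∸n≡0 (depth x))

    ⊒-trans : ∀ {x y z} → x ⊒ y → y ⊒ z → x ⊒ z
    ⊒-trans {x} {y} {z} (a , p) (b , q) = ≤-trans a b ,
      trans (sym (anc-anc {depth x} {depth y} {z} a b)) (trans (cong (anc (depth x)) q) p)

    -- Both are values of `anc` at `z`, and `anc` to the smaller depth factors through the larger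
    -- one.
    ⊒-compare : ∀ {x y z} → x ⊒ z → y ⊒ z → depth x ≤ depth y → x ⊒ y
    ⊒-compare {x} {y} {z} (a , p) (b , q) x≤y = x≤y ,
      trans (cong (anc (depth x)) (sym q)) (trans (anc-anc {depth x} {depth y} {z} x≤y b) p)

    ⊒-antisym : ∀ {x y} → x ⊒ y → depth y ≤ depth x → x ≡ y
    ⊒-antisym {x} {y} (a , p) y≤x = trans (sym p)
      (cong (λ j → up j y) (m≤n⇒m∸n≡0 y≤x))

    anc-⊒ : ∀ {δ x} → δ ≤ depth x → anc δ x ⊒ x
    anc-⊒ {δ} {x} δ≤ = subst (_≤ depth x) (sym (depth-anc δ≤)) δ≤ , cong (λ g → anc g x) (depth-anc δ≤)

    root-⊒ : ∀ x → r ⊒ x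
    root-⊒ x = subst (_≤ depth x) (sym d0) z≤n ,
      root-depth (trans (cong (λ g → depth (anc g x)) d0) (depth-anc {0} {x} z≤n))
      where
      d0 : depth r ≡ 0
      d0 = n≤0⇒n≡0 (depth-≤ r refl)

    parent-⊒ : ∀ x → parent x ⊒ x
    parent-⊒ x with x Fin.≟ r
    ... | yes refl = subst (_⊒ r) (sym parent-root) ⊒-refl
    ... | no  x≢r = subst (_≤ depth x) (sym (depth-parent x)) (pred[n]≤n {depth x}) ,
      cong (λ j → up j x) (trans (cong (_∸ depth (parent x)) (depth-suc x x≢r)) (m+n∸n≡m 1 (depth (parent x))))

    ⊒-parent : ∀ {c x} → c ⊒ x → c ≢ x → c ⊒ parent x
    ⊒-parent {c} {x} c⊒x c≢x = ⊒-compare c⊒x (parent-⊒ x)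
      (subst (depth c ≤_) (sym (depth-parent x)) (<⇒≤pred (≰⇒> λ x≤c → c≢x (⊒-antisym c⊒x x≤c))))

-- Separations from a tree decomposition.

module Separation where
  open import Defs
  open import Data.Fin as Fin using (Fin; zero; suc; toℕ)
  import Data.Fin.Properties as Fin
  open import Data.Fin.Subset as Subset using (Subset; ∣_∣) renaming (_∈_ to _∈ˢ_; _∉_ to _∉ˢ_)
  import Data.Fin.Subset.Properties as Subset
  open import Data.List as List using (List; []; _∷_; length; filter; tabulate)
  open import Data.List.Membership.Propositional using (_∈_)
  open import Data.List.Membership.Propositional.Properties using (∈-filter⁺; ∈-filter⁻; ∈-tabulate⁻)
  open import Data.List.Properties using (length-tabulate)
  open import Data.List.Relation.Unary.All as All using (All; []; _∷_)
  open import Data.List.Relation.Unary.Any using (here; there)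
  open import Data.List.Relation.Unary.AllPairs using ([]; _∷_)
  open import Data.List.Relation.Unary.Unique.Propositional using (Unique)
  import Data.List.Relation.Unary.Unique.Propositional.Properties as Unique
  open import Data.Nat
  open import Data.Nat.Properties
  import Data.Vec.Functional as VF
  open import Relation.Binary.Construct.Closure.ReflexiveTransitive using (Star; ε; _◅_)
  open import Relation.Nullary.Decidable using (_×-dec_; ¬?)
  open import Relation.Unary using (Decidable)
  open LinearArithmetic
  open Placements using (Sep)
  open RootedTrees

  open Graph using (_~_)

  module Extremum (_≼_ : ℕ → ℕ → Set) (total : ∀ a b → a ≼ b ⊎ b ≼ a) (trans′ : ∀ {a b c} → a ≼ b → b ≼ c → a ≼ c) where
    extremum : ∀ {m} {P : Fin m → Set} → Decidable P → (f : Fin m → ℕ) → ∃ P → ∃ λ x → P x × ∀ y → P y → f y ≼ f x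
    extremum {suc m} {P} P? f (w , pw) with Fin.any? (P? ∘ suc) | P? zero
    ... | no none | p0? = w , pw , λ y py → subst (λ z → f z ≼ f w) (same w y pw py) (refl′ (f w))
      where
      refl′ : ∀ a → a ≼ a
      refl′ a = Sum.[ (λ x → x) , (λ x → x) ] (total a a)
      same : ∀ x y → P x → P y → x ≡ y
      same zero    zero    _  _  = refl
      same (suc x) _       px _  = ⊥-elim (none (x , px))
      same zero    (suc y) _  py = ⊥-elim (none (y , py))
    ... | yes some | no ¬p0 = let x , px , max = extremum (P? ∘ suc) (f ∘ suc) some in
      suc x , px , λ { zero p0 → ⊥-elim (¬p0 p0) ; (suc y) py → max y py }
    ... | yes some | yes p0 with extremum (P? ∘ suc) (f ∘ suc) some
    ...   | x , px , max with total (f zero) (f (suc x))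
    ...     | inj₁ le = suc x , px , λ { zero _ → le ; (suc y) py → max y py }
    ...     | inj₂ ge = zero , p0 , λ { zero _ → Sum.[ (λ x → x) , (λ x → x) ] (total _ _) ; (suc y) py → trans′ (max y py) ge }

  open Extremum _≤_ ≤-total ≤-trans public using () renaming (extremum to argmax)
  open Extremum _≥_ (flip ≤-total) (flip ≤-trans) using () renaming (extremum to argmin)

  module _ {V : Set} where
    # : {P : V → Set} → Decidable P → List V → ℕ
    # P? xs = length (filter P? xs)

    module _ {P Q : V → Set} (P? : Decidable P) (Q? : Decidable Q) where
      #-mono : ∀ xs → (∀ {v} → v ∈ xs → P v → Q v) → # P? xs ≤ # Q? xs
      #-mono []       _ = z≤n
      #-mono (x ∷ xs) P⊆Q with P? x | Q? x | #-mono xs (P⊆Q ∘ there)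
      ... | yes p | yes q | le = s≤s le
      ... | yes p | no ¬q | le = ⊥-elim (¬q (P⊆Q (here refl) p))
      ... | no ¬p | yes q | le = m≤n⇒m≤1+n le
      ... | no ¬p | no ¬q | le = le

    module _ {P Q R : V → Set} (P? : Decidable P) (Q? : Decidable Q) (R? : Decidable R) where
      #-cover : ∀ xs → (∀ {v} → v ∈ xs → P v → Q v ⊎ R v) → # P? xs ≤ # Q? xs + # R? xs
      #-cover []       _ = z≤n
      #-cover (x ∷ xs) cov with P? x | Q? x | R? x | #-cover xs (cov ∘ there)
      ... | no _  | no _  | no _  | le = le
      ... | no _  | no _  | yes _ | le = ≤-trans le (+-monoʳ-≤ (# Q? xs) (n≤1+n _))
      ... | no _  | yes _ | no _  | le = m≤n⇒m≤1+n le
      ... | no _  | yes _ | yes _ | le = m≤n⇒m≤1+n (≤-trans le (+-monoʳ-≤ (# Q? xs) (n≤1+n _)))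
      ... | yes p | yes _ | no _  | le = s≤s le
      ... | yes p | yes _ | yes _ | le = s≤s (≤-trans le (+-monoʳ-≤ (# Q? xs) (n≤1+n _)))
      ... | yes p | no _  | yes _ | le = ≤-trans (s≤s le) (≤-reflexive (sym (+-suc (# Q? xs) _)))
      ... | yes p | no ¬q | no ¬r | le = ⊥-elim (Sum.[ ¬q , ¬r ] (cov (here refl) p))

      #-add : ∀ xs → (∀ {v} → v ∈ xs → P v → Q v ⊎ R v) → (∀ {v} → Q v → P v) → (∀ {v} → R v → P v) →
              (∀ {v} → Q v → ¬ R v) → # P? xs ≡ # Q? xs + # R? xs
      #-add []       _ _ _ _ = refl
      #-add (x ∷ xs) cov Q⊆P R⊆P dis with P? x | Q? x | R? x | #-add xs (cov ∘ there) Q⊆P R⊆P dis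
      ... | no _  | no _  | no _  | eq = eq
      ... | no ¬p | no _  | yes r | eq = ⊥-elim (¬p (R⊆P r))
      ... | no ¬p | yes q | _     | eq = ⊥-elim (¬p (Q⊆P q))
      ... | yes p | yes q | no _  | eq = cong suc eq
      ... | yes p | yes q | yes r | eq = ⊥-elim (dis q r)
      ... | yes p | no _  | yes _ | eq = trans (cong suc eq) (sym (+-suc (# Q? xs) _))
      ... | yes p | no ¬q | no ¬r | eq = ⊥-elim (Sum.[ ¬q , ¬r ] (cov (here refl) p))

    #-all : {P : V → Set} (P? : Decidable P) → ∀ xs → (∀ {v} → v ∈ xs → P v) → # P? xs ≡ length xs
    #-all P? []       _   = refl
    #-all P? (x ∷ xs) all with P? x
    ... | yes _ = cong suc (#-all P? xs (all ∘ there))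
    ... | no ¬p = ⊥-elim (¬p (all (here refl)))

    #-none : {P : V → Set} (P? : Decidable P) → ∀ xs → (∀ {v} → ¬ P v) → # P? xs ≡ 0
    #-none P? []       _    = refl
    #-none P? (x ∷ xs) none with P? x
    ... | yes p = ⊥-elim (none p)
    ... | no _  = #-none P? xs none

  unique-length : ∀ {n} (p : Subset n) xs → Unique xs → (∀ {v} → v ∈ xs → v ∈ˢ p) → length xs ≤ ∣ p ∣
  unique-length p []       _        _   = z≤n
  unique-length p (x ∷ xs) (x∉ ∷ u) sub = ≤-trans (s≤s (unique-length (p Subset.- x) xs u
    (λ {v} v∈ → Subset.x∈p∧x≢y⇒x∈p-y (sub (there v∈)) (λ { refl → All.lookup x∉ v∈ refl }))))
    (Subset.x∈p⇒∣p-x∣<∣p∣ (sub (here refl)))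

  module Decomposed {n} (H : Graph n) (D : TreeDecomposition H) where
    open TreeDecomposition D
    open IsTree isTree

    r : Fin t
    r = Fin.fromℕ< (>-nonZero⁻¹ t {{nonempty}})

    open Rooted tree r connected acyclic public

    abstract
      top′ : ∀ v → ∃ λ x → v ∈ˢ bag x × ∀ y → v ∈ˢ bag y → depth x ≤ depth y
      top′ v = argmin (λ x → v Subset.∈? bag x) depth (vertices v)

    -- The root of the subtree formed by the nodes whose bags contain `v`.
    top : Fin n → Fin t
    top v = proj₁ (top′ v)

    top-bag : ∀ v → v ∈ˢ bag (top v)
    top-bag v = proj₁ (proj₂ (top′ v))

    -- A walk leaves the subtree below `c` only along the edge from `c` to its parent, and the bags
    -- at both ends of that edge contain `v`.
    exit : ∀ {v z y c} → Star (λ x′ y′ → _~_ tree x′ y′ × v ∈ˢ bag x′ × v ∈ˢ bag y′) z y →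
           c ⊒ z → ¬ c ⊒ y → v ∈ˢ bag c × v ∈ˢ bag (parent c) × c ≢ r
    exit ε c⊒z c⋣y = ⊥-elim (c⋣y c⊒z)
    exit {c = c} (_◅_ {z} {z′} (e , v∈z , v∈z′) rest) c⊒z c⋣y with c ⊒? z′
    ... | yes c⊒z′ = exit rest c⊒z′ c⋣y
    ... | no  c⋣z′ with edge-link e
    ...   | inj₂ refl = ⊥-elim (c⋣z′ (⊒-trans c⊒z (parent-⊒ z′)))
    ...   | inj₁ refl with c Fin.≟ z
    ...     | yes refl = v∈z , v∈z′ , λ { refl → c⋣z′ (root-⊒ _) }
    ...     | no  c≢z  = ⊥-elim (c⋣z′ (⊒-parent c⊒z c≢z))

    top-⊒ : ∀ {v z} → v ∈ˢ bag z → top v ⊒ z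
    top-⊒ {v} {z} v∈z with top v ⊒? z
    ... | yes h = h
    ... | no ¬h = let _ , v∈ , ≢r = exit (coherent v (top v) z (top-bag v) v∈z) ⊒-refl ¬h in
      ⊥-elim (<⇒≱ (≤-reflexive (sym (depth-suc (top v) ≢r))) (proj₂ (proj₂ (top′ v)) _ v∈))

    between : ∀ {v z c} → v ∈ˢ bag z → top v ⊒ c → c ⊒ z → v ∈ˢ bag c
    between {v} {z} {c} v∈z top⊒c c⊒z with c ⊒? top v
    ... | yes c⊒top = subst (λ x → v ∈ˢ bag x) (⊒-antisym top⊒c (proj₁ c⊒top)) (top-bag v)
    ... | no  c⋣top = proj₁ (exit (coherent v z (top v) v∈z (top-bag v)) c⊒z c⋣top)

    -- Both tops are ancestors of a node whose bag contains the edge, hence comparable, and the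
    -- lower top lies on the path along which the other endpoint stays in the bags.
    top-edge : ∀ {u v} → _~_ H u v → (top u ⊒ top v × u ∈ˢ bag (top v)) ⊎ (top v ⊒ top u × v ∈ˢ bag (top u))
    top-edge {u} {v} e with edges u v e
    ... | z , u∈z , v∈z with ≤-total (depth (top u)) (depth (top v))
    ...   | inj₁ le = let h = ⊒-compare (top-⊒ u∈z) (top-⊒ v∈z) le in inj₁ (h , between u∈z h (top-⊒ v∈z))
    ...   | inj₂ ge = let h = ⊒-compare (top-⊒ v∈z) (top-⊒ u∈z) ge in inj₂ (h , between v∈z h (top-⊒ u∈z))

    -- Helly property of subtrees: the bag at the deepest top of a member contains all the others by
    -- `top-edge`.
    clique-in-bag : ∀ {m} (K : Fin (suc m) → Fin n) → (∀ i j → i ≢ j → _~_ H (K i) (K j)) → ∃ λ x → ∀ i → K i ∈ˢ bag x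
    clique-in-bag K adj with argmax {P = λ _ → 0 ≡ 0} (λ _ → yes refl) (depth ∘ top ∘ K) (zero , refl)
    ... | j , _ , max = top (K j) , inside
      where
      inside : ∀ i → K i ∈ˢ bag (top (K j))
      inside i with i Fin.≟ j
      ... | yes refl = top-bag (K i)
      ... | no  i≢j with top-edge (adj i j i≢j)
      ...   | inj₁ (_ , h) = h
      ...   | inj₂ (h , _) = subst (λ x → K i ∈ˢ bag x) (sym (⊒-antisym h (max i refl))) (top-bag (K i))

    bag≤fold : ∀ x → ∣ bag x ∣ ≤ VF.foldr _⊔_ 0 (λ x → ∣ bag x ∣)
    bag≤fold = go (λ x → ∣ bag x ∣)
      where
      go : ∀ {m} (f : Fin m → ℕ) x → f x ≤ VF.foldr _⊔_ 0 f
      go f zero    = m≤m⊔n _ _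
      go f (suc x) = ≤-trans (go (f ∘ suc) x) (m≤n⊔m (f zero) _)

    bag≤1+width : ∀ x → ∣ bag x ∣ ≤ suc width
    bag≤1+width x = ≤-trans (bag≤fold x) (suc-pred-≤ _)
      where
      suc-pred-≤ : ∀ m → m ≤ suc (m ∸ 1)
      suc-pred-≤ zero    = z≤n
      suc-pred-≤ (suc m) = ≤-refl

    clique≤width : ∀ {m} (K : Fin (suc m) → Fin n) → Injective _≡_ _≡_ K → (∀ i j → i ≢ j → _~_ H (K i) (K j)) → m ≤ width
    clique≤width {m} K inj adj with clique-in-bag K adj
    ... | x , K⊆ = s≤s⁻¹ (≤-trans (≤-trans (≤-reflexive (sym (length-tabulate K)))
      (unique-length (bag x) (tabulate K) (Unique.tabulate⁺ inj) (λ v∈ → let i , eq = ∈-tabulate⁻ {f = K} v∈ in subst (_∈ˢ bag x) (sym eq) (K⊆ i))))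
      (bag≤1+width x))

    module Separate (q : ℕ) (1≤q : 1 ≤ q) (bag≤q : ∀ x → ∣ bag x ∣ ≤ q)
      (C : List (Fin n)) (i : ℕ) (uC : Unique C) (i+q≤ : i + q ≤ length C) where

      Under : Fin t → Fin n → Set
      Under y v = y ⊒ top v
      under? : ∀ y → Decidable (Under y)
      under? y v = y ⊒? top v

      abstract
        -- The threshold is `i + q` so that `i` vertices still lie below `x` when its bag is
        -- removed.
        deepest : ∃ λ x → i + q ≤ # (under? x) C × ∀ y → i + q ≤ # (under? y) C → depth y ≤ depth x
        deepest = argmax (λ y → i + q ≤? # (under? y) C) depth
          (r , subst (i + q ≤_) (sym (#-all (under? r) C (λ _ → root-⊒ _))) i+q≤)

      x : Fin t
      x = proj₁ deepest

      Out : Fin n → Set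
      Out v = v ∉ˢ bag x

      out? : Decidable Out
      out? v = ¬? (v Subset.∈? bag x)

      child : Fin n → Fin t
      child v = anc (suc (depth x)) (top v)

      Part : Fin t → Fin n → Set
      Part y v = Out v × x ⊒ top v × child v ≡ y

      part? : ∀ y → Decidable (Part y)
      part? y v = out? v ×-dec ((x ⊒? top v) ×-dec (child v Fin.≟ y))

      deeper : ∀ {v} → Out v → x ⊒ top v → depth x < depth (top v)
      deeper {v} out x⊒ = ≰⇒> λ le → out (subst (λ z → v ∈ˢ bag z) (sym (⊒-antisym x⊒ le)) (top-bag v))

      abstract
        largest : ∃ λ y → 0 ≡ 0 × ∀ z → 0 ≡ 0 → # (part? z) C ≤ # (part? y) C
        largest = argmax {P = λ _ → 0 ≡ 0} (λ _ → yes refl) (λ y → # (part? y) C) (r , refl)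

      y* : Fin t
      y* = proj₁ largest

      order : Fin t → ℕ
      order c with c Fin.≟ y*
      ... | yes _ = 0
      ... | no _  = suc (toℕ c)

      order-zero : ∀ {c} → order c ≡ 0 → c ≡ y*
      order-zero {c} eq with c Fin.≟ y*
      ... | yes h = h

      order-y* : order y* ≡ 0
      order-y* with y* Fin.≟ y*
      ... | yes _ = refl
      ... | no ¬h = ⊥-elim (¬h refl)

      order-suc : ∀ {c j} → order c ≡ suc j → toℕ c ≡ j
      order-suc {c} eq with c Fin.≟ y*
      ... | no _ = suc-injective eq

      order-≤ : ∀ c → order c ≤ t
      order-≤ c with c Fin.≟ y*
      ... | yes _ = z≤n
      ... | no _  = Fin.toℕ<n c

      -- Children of x come in the order given by their index, except that the
      -- largest part comes first; everything not below x comes last.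
      rank : Fin n → ℕ
      rank v with x ⊒? top v
      ... | no _  = suc t
      ... | yes _ = order (child v)

      rank-below : ∀ {v} → x ⊒ top v → rank v ≡ order (child v)
      rank-below {v} h with x ⊒? top v
      ... | yes _ = refl
      ... | no ¬h = ⊥-elim (¬h h)

      rank-other : ∀ {v} → ¬ x ⊒ top v → rank v ≡ suc t
      rank-other {v} h with x ⊒? top v
      ... | yes p = ⊥-elim (h p)
      ... | no _  = refl

      rank-≤⇒below : ∀ {v} → rank v ≤ t → x ⊒ top v
      rank-≤⇒below {v} le with x ⊒? top v
      ... | yes p = p
      ... | no _  = ⊥-elim (<-irrefl refl le)

      rank-child : ∀ {u v} → x ⊒ top u → x ⊒ top v → child u ≡ child v → rank u ≡ rank v
      rank-child hu hv eq = trans (rank-below hu) (trans (cong order eq) (sym (rank-below hv)))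

      rank-zero : ∀ {v} → rank v ≡ 0 → x ⊒ top v × child v ≡ y*
      rank-zero eq = let p = rank-≤⇒below (≤-trans (≤-reflexive eq) z≤n) in p , order-zero (trans (sym (rank-below p)) eq)

      rank-largest : ∀ {v} → x ⊒ top v → child v ≡ y* → rank v ≡ 0
      rank-largest p c = trans (rank-below p) (trans (cong order c) order-y*)

      rank-suc : ∀ {v j} → rank v ≡ suc j → j < t → x ⊒ top v × toℕ (child v) ≡ j
      rank-suc eq j<t = let p = rank-≤⇒below (≤-trans (≤-reflexive eq) j<t) in p , order-suc (trans (sym (rank-below p)) eq)

      rank-≤ : ∀ {v} → x ⊒ top v → rank v ≤ t
      rank-≤ {v} p = ≤-trans (≤-reflexive (rank-below p)) (order-≤ (child v))

      -- An edge outside the bag cannot pass over `x`: if `top u` were at or above `x` and `top v`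
      -- below it, then `u` would lie in the bag of `x`. Otherwise both tops are below the same
      -- child of `x`, or neither is below `x`.
      rank-edge′ : ∀ {u v} → Out u → top u ⊒ top v → u ∈ˢ bag (top v) → rank u ≡ rank v
      rank-edge′ {u} {v} out tu⊒tv u∈ = case x ⊒? top v of λ where
        (no x⋣)  → trans (rank-other {u} (λ p → x⋣ (⊒-trans p tu⊒tv))) (sym (rank-other {v} x⋣))
        (yes x⊒) → case ≤-<-connex (depth (top u)) (depth x) of λ where
          (inj₁ le) → ⊥-elim (out (between u∈ (⊒-compare tu⊒tv x⊒ le) x⊒))
          (inj₂ lt) → rank-child (⊒-compare x⊒ tu⊒tv (<⇒≤ lt)) x⊒
            (trans (cong (anc (suc (depth x))) (sym (proj₂ tu⊒tv))) (anc-anc {suc (depth x)} lt (proj₁ tu⊒tv)))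

      rank-edge : ∀ {u v} → Out u → Out v → _~_ H u v → rank u ≡ rank v
      rank-edge ou ov e with top-edge e
      ... | inj₁ (h , m) = rank-edge′ ou h m
      ... | inj₂ (h , m) = sym (rank-edge′ ov h m)

      Lt At Gt : ℕ → Fin n → Set
      Lt j v = Out v × rank v < j
      At j v = Out v × rank v ≡ j
      Gt j v = Out v × j < rank v
      lt? : ∀ j → Decidable (Lt j)
      lt? j v = out? v ×-dec (rank v <? j)
      at? : ∀ j → Decidable (At j)
      at? j v = out? v ×-dec (rank v ≟ j)
      gt? : ∀ j → Decidable (Gt j)
      gt? j v = out? v ×-dec (j <? rank v)
      in? : Decidable (_∈ˢ bag x)
      in? v = v Subset.∈? bag x

      lt-suc : ∀ j → # (lt? (suc j)) C ≡ # (lt? j) C + # (at? j) C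
      lt-suc j = #-add (lt? (suc j)) (lt? j) (at? j) C
        (λ _ (o , h) → Sum.map (o ,_) (o ,_) (m≤n⇒m<n∨m≡n (s≤s⁻¹ h)))
        (λ (o , h) → o , m≤n⇒m≤1+n h) (λ (o , h) → o , s≤s (≤-reflexive h)) (λ (_ , h) (_ , e) → <-irrefl e h)

      in≤q : # in? C ≤ q
      in≤q = ≤-trans (unique-length (bag x) (filter in? C) (Unique.filter⁺ in? uC) (proj₂ ∘ ∈-filter⁻ in? {xs = C})) (bag≤q x)

      enough : i ≤ # (lt? (suc t)) C
      enough = let h = #-cover (under? x) in? (lt? (suc t)) C cov ; k = proj₁ (proj₂ deepest) ; l = in≤q in
        ((i ≤ # (lt? (suc t)) C) ∋ lin (h ⊕ k ⊕ l)
            (solve 5 (λ i q u a b → i :+ (a :+ b :+ u :+ q) :+ con 0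
              ⊜ b :+ (u :+ (i :+ q) :+ a)) refl i q (# (under? x) C) (# in? C) (# (lt? (suc t)) C)))
        where
        cov : ∀ {v} → v ∈ C → x ⊒ top v → v ∈ˢ bag x ⊎ Lt (suc t) v
        cov {v} _ p with v Subset.∈? bag x
        ... | yes h = inj₁ h
        ... | no ¬h = inj₂ (¬h , s≤s (rank-≤ p))

      -- A nonempty part lies under a child of `x`, and `x` is the deepest node with `i + q`
      -- vertices below it; an empty part is small because q is positive.
      part-small : ∀ y → # (part? y) C < i + q
      -- A trivial search through the indices decides whether the part is empty.
      part-small y with Fin.any? {n = length (filter (part? y) C)} (λ _ → yes refl)
      ... | no none = subst (_< i + q) (sym (empty (filter (part? y) C) none)) (≤-trans 1≤q (m≤n+m q i))
        where
        empty : ∀ (xs : List (Fin n)) → ¬ (∃ λ (_ : Fin (length xs)) → 0 ≡ 0) → length xs ≡ 0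
        empty []       _ = refl
        empty (x ∷ xs) h = ⊥-elim (h (zero , refl))
      ... | yes (j , _) = ≰⇒> λ big → <⇒≱ (≤-reflexive (sym dy)) (proj₂ (proj₂ deepest) y (≤-trans big under))
        where
        v = List.lookup (filter (part? y) C) j
        v∈ : Part y v
        v∈ = proj₂ (∈-filter⁻ (part? y) {xs = C} (∈-lookup j))
          where open import Data.List.Membership.Propositional.Properties using (∈-lookup)
        dy : depth y ≡ suc (depth x)
        dy = subst (λ y → depth y ≡ suc (depth x)) (proj₂ (proj₂ v∈)) (depth-anc (deeper (proj₁ v∈) (proj₁ (proj₂ v∈))))
        under : # (part? y) C ≤ # (under? y) C
        under = #-mono (part? y) (under? y) C λ { _ (o , p , refl) → anc-⊒ (deeper o p) }

      eq-zero : # (at? 0) C ≡ # (part? y*) C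
      eq-zero = ≤-antisym
        (#-mono (at? 0) (part? y*) C λ _ (o , e) → o , rank-zero e)
        (#-mono (part? y*) (at? 0) C λ _ (o , p , c) → o , rank-largest p c)

      eq-suc : ∀ j → j < t → # (at? (suc j)) C ≤ # (at? 0) C
      eq-suc j j<t = subst (# (at? (suc j)) C ≤_) (sym eq-zero)
        (≤-trans (#-mono (at? (suc j)) (part? (Fin.fromℕ< j<t)) C λ _ (o , e) →
          let p , c = rank-suc e j<t in o , p , Fin.toℕ-injective (trans c (sym (Fin.toℕ-fromℕ< j<t))))
          (proj₂ (proj₂ largest) _ refl))

      lt-mono : ∀ {j k} → j ≤ k → # (lt? j) C ≤ # (lt? k) C
      lt-mono {j} {k} le = #-mono (lt? j) (lt? k) C λ _ (o , h) → o , <-≤-trans h le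

      -- The cut is at the rank where the running total passes `i`. At rank 0 nothing precedes, and
      -- `part-small` bounds the part; at any later rank the largest part has already been counted.
      cut : ∀ m → m ≤ t → i ≤ # (lt? (suc m)) C → ∃ λ j → # (lt? j) C ≤ i × i ≤ # (lt? j) C + # (at? j) C ×
        (# (at? j) C ≤ # (lt? j) C ⊎ # (lt? j) C + # (at? j) C < i + q)
      cut zero _ h = 0 , subst (_≤ i) (sym lt0) z≤n , subst (i ≤_) (lt-suc 0) h , inj₂ (subst (_< i + q)
          (sym (trans (cong (_+ # (at? 0) C) lt0) eq-zero)) (part-small y*))
        where
        lt0 : # (lt? 0) C ≡ 0
        lt0 = #-none (lt? 0) C λ { (_ , ()) }
      cut (suc m) m<t h with ≤-<-connex i (# (lt? (suc m)) C)
      ... | inj₁ h′ = cut m (<⇒≤ m<t) h′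
      ... | inj₂ lt = suc m , <⇒≤ lt , subst (i ≤_) (lt-suc (suc m)) h ,
        inj₁ (≤-trans (eq-suc m m<t) (≤-trans (m≤n+m _ _) (≤-trans (≤-reflexive (sym (lt-suc 0))) (lt-mono (s≤s z≤n)))))

      module Members {P : Fin n → Set} (P? : Decidable P) where
        member : ∀ {v} → v ∈ filter P? C → P v
        member v∈ = proj₂ (∈-filter⁻ P? {xs = C} v∈)

        source : ∀ {v} → v ∈ filter P? C → v ∈ C
        source v∈ = proj₁ (∈-filter⁻ P? v∈)

        unique : Unique (filter P? C)
        unique = Unique.filter⁺ P? uC

      module Lt′ (j : ℕ) = Members (lt? j)
      module At′ (j : ℕ) = Members (at? j)
      module Gt′ (j : ℕ) = Members (gt? j)
      module In′ = Members in?

      cover : ∀ j {v} → v ∈ C → v ∈ filter in? C ⊎ v ∈ filter (lt? j) C ⊎ v ∈ filter (at? j) C ⊎ v ∈ filter (gt? j) C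
      cover j {v} v∈ with v Subset.∈? bag x
      ... | yes h = inj₁ (∈-filter⁺ in? v∈ h)
      ... | no o with <-cmp (rank v) j
      ...   | tri< h _ _ = inj₂ (inj₁ (∈-filter⁺ (lt? j) v∈ (o , h)))
      ...   | tri≈ _ h _ = inj₂ (inj₂ (inj₁ (∈-filter⁺ (at? j) v∈ (o , h))))
      ...   | tri> _ _ h = inj₂ (inj₂ (inj₂ (∈-filter⁺ (gt? j) v∈ (o , h))))
      in-out : ∀ v → v ∈ˢ bag x ⊎ Out v
      in-out v with v Subset.∈? bag x
      ... | yes h = inj₁ h
      ... | no ¬h = inj₂ ¬h

      all? : Decidable (λ (_ : Fin n) → 0 ≡ 0)
      all? _ = yes refl

      sizes : ∀ j → # in? C + # (lt? j) C + # (at? j) C + # (gt? j) C ≡ length C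
      sizes j = sym (trans (sym (#-all all? C (λ _ → refl))) (trans
        (#-add all? in? out? C (λ {v} _ _ → in-out v) (λ _ → refl) (λ _ → refl) (λ h o → o h))
        (trans (cong (# in? C +_) (trans
          (#-add out? (lt? (suc j)) (gt? j) C (λ {v} _ o → Sum.map (o ,_) (o ,_) (Sum.map₁ s≤s (≤-<-connex (rank v) j))) proj₁ proj₁
            (λ (_ , h) (_ , h′) → <⇒≱ h′ (s≤s⁻¹ h)))
          (cong (_+ # (gt? j) C) (lt-suc j))))
        (solve 4 (λ a b c d → a :+ (b :+ c :+ d) ⊜ a :+ b :+ c :+ d) refl (# in? C) (# (lt? j) C) (# (at? j) C) (# (gt? j) C)))))

      ranks-apart : ∀ {u v} → Out u → Out v → rank u < rank v → ¬ _~_ H u v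
      ranks-apart ou ov lt e = <-irrefl (rank-edge ou ov e) lt

      lt-at : ∀ j {u v} → Lt j u → At j v → ¬ _~_ H u v
      lt-at j {u} (o , h) (o′ , h′) = ranks-apart o o′ (subst (rank u <_) (sym h′) h)

      lt-gt : ∀ j {u v} → Lt j u → Gt j v → ¬ _~_ H u v
      lt-gt j (o , h) (o′ , h′) = ranks-apart o o′ (<-trans h h′)

      at-gt : ∀ j {u v} → At j u → Gt j v → ¬ _~_ H u v
      at-gt j {_} {v} (o , h) (o′ , h′) = ranks-apart o o′ (subst (_< rank v) (sym h) h′)

      separateAt : ∀ j → # (lt? j) C ≤ i → i ≤ # (lt? j) C + # (at? j) C →
        (# (at? j) C ≤ # (lt? j) C ⊎ # (lt? j) C + # (at? j) C < i + q) → Sep (_~_ H) q C i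
      separateAt j a b c = record
        { X = filter in? C ; A = filter (lt? j) C ; K = filter (at? j) C ; R = filter (gt? j) C
        ; cover = cover j
        ; X⊆ = In′.source ; A⊆ = Lt′.source j ; K⊆ = At′.source j ; R⊆ = Gt′.source j
        ; uniqueA = Lt′.unique j ; uniqueK = At′.unique j ; uniqueR = Gt′.unique j
        ; sizeX = in≤q
        ; sizes = sizes j
        ; A≁K = λ a∈ k∈ → lt-at j (Lt′.member j a∈) (At′.member j k∈)
        ; A≁R = λ a∈ r∈ → lt-gt j (Lt′.member j a∈) (Gt′.member j r∈)
        ; K≁R = λ k∈ r∈ → at-gt j (At′.member j k∈) (Gt′.member j r∈)
        ; A≤i = a ; i≤AK = b ; straddle = c }

      separation : Sep (_~_ H) q C i
      separation = let j , a , b , c = cut t ≤-refl enough in separateAt j a b c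

-- The universal graph and its number of edges.

module UniversalGraphs where
  open import Defs
  open import Data.Bool using (true; T; T?)
  open import Data.Fin as Fin using (Fin; zero; suc; toℕ)
  import Data.Fin.Properties as Fin
  open import Data.Fin.Subset using (∣_∣)
  open import Data.List as List using (List; []; _∷_; length; filter; map; _++_; concatMap; cartesianProduct; allFin; applyUpTo; upTo)
  open import Data.List.Membership.Propositional using (_∈_)
  open import Data.List.Membership.Propositional.Properties using (∈-++⁺ˡ; ∈-++⁺ʳ; ∈-map⁺; ∈-map⁻; ∈-filter⁻; ∈-concatMap⁺; ∈-cartesianProduct⁺; ∈-applyUpTo⁺; ∈-allFin; ∈-upTo⁺)
  open import Data.List.Properties using (length-++; length-map; length-applyUpTo; length-upTo; length-tabulate)
  open import Data.List.Relation.Unary.All using ([]; _∷_)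
  open import Data.List.Relation.Unary.Any as Any using (here; there)
  import Data.List.Relation.Unary.Any.Properties as Any
  open import Data.List.Relation.Unary.AllPairs using ([]; _∷_)
  open import Data.List.Relation.Unary.Unique.Propositional using (Unique)
  import Data.List.Relation.Unary.Unique.Propositional.Properties as Unique
  open import Data.Nat
  open import Data.Nat.DivMod using (m/n*n≤m; /-monoˡ-≤; m*n/n≡m)
  open import Data.Nat.Properties
  open import Data.Nat.Tactic.RingSolver using (solve-∀)
  import Data.Product.Properties as Product
  open import Relation.Nullary.Decidable using (_×-dec_; _⊎-dec_; ¬?)
  open LinearArithmetic
  open Placements using (module Embedding)
  open Hierarchy
  open RootedTrees using (~-sym; ~-irrefl; isYes⁺; isYes⁻; fromRelation; length-⊆)
  open Separation using (module Decomposed)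

  open Graph using (_~_; edgeCount)

  _≟²_ : (p p′ : ℕ × ℕ) → Dec (p ≡ p′)
  _≟²_ = Product.≡-dec _≟_ _≟_

  module FromPairs (n : ℕ) (L : List (ℕ × ℕ)) where
    open import Data.List.Membership.DecPropositional _≟²_ using (_∈?_)

    Joined : ℕ → ℕ → Set
    Joined a b = (a , b) ∈ L ⊎ (b , a) ∈ L

    Adjacent : Fin n → Fin n → Set
    Adjacent u v = u ≢ v × Joined (toℕ u) (toℕ v)

    adjacent? : ∀ u v → Dec (Adjacent u v)
    adjacent? u v = ¬? (u Fin.≟ v) ×-dec (((toℕ u , toℕ v) ∈? L) ⊎-dec ((toℕ v , toℕ u) ∈? L))

    adjacent-sym : ∀ {u v} → Adjacent u v → Adjacent v u
    adjacent-sym (u≢v , j) = u≢v ∘ sym , Sum.swap j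

    graph : Graph n
    graph = fromRelation adjacent? adjacent-sym (λ (u≢u , _) → u≢u refl)

    sorted : ℕ × ℕ → ℕ × ℕ
    sorted (a , b) = a ⊓ b , a ⊔ b

    -- Edges are counted with increasing endpoints, so `sorted` forgets the orientation of the
    -- pairs. Repeated pairs and pairs with entries beyond `n` can only increase the right side.
    edgeCount≤ : edgeCount graph ≤ length L
    edgeCount≤ = subst₂ _≤_ (length-map pair edges) (length-map sorted L)
      (length-⊆ (map pair edges) (map sorted L) (Unique.map⁺ pair-injective unique) included)
      where
      pair : Fin n × Fin n → ℕ × ℕ
      pair (u , v) = toℕ u , toℕ v
      edge? = λ ((u , v) : Fin n × Fin n) → (u Fin.<? v) ×-dec T? (Graph.adj graph u v)
      edges = filter edge? (cartesianProduct (allFin n) (allFin n))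
      pair-injective : ∀ {p p′} → pair p ≡ pair p′ → p ≡ p′
      pair-injective eq = cong₂ _,_ (Fin.toℕ-injective (cong proj₁ eq)) (Fin.toℕ-injective (cong proj₂ eq))
      unique : Unique edges
      unique = Unique.filter⁺ edge? (Unique.cartesianProduct⁺ (Unique.allFin⁺ n) (Unique.allFin⁺ n))
      included : ∀ {p} → p ∈ map pair edges → p ∈ map sorted L
      included p∈ with ∈-map⁻ pair p∈
      ... | (u , v) , e∈ , refl with proj₂ (∈-filter⁻ edge? {xs = cartesianProduct (allFin n) (allFin n)} e∈)
      ...   | u<v , t with proj₂ (isYes⁻ (adjacent? u v) t)
      ...     | inj₁ h = subst (_∈ map sorted L) (cong₂ _,_ (m≤n⇒m⊓n≡m (<⇒≤ u<v)) (m≤n⇒m⊔n≡n (<⇒≤ u<v))) (∈-map⁺ sorted h)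
      ...     | inj₂ h = subst (_∈ map sorted L) (cong₂ _,_ (m≥n⇒m⊓n≡n (<⇒≤ u<v)) (m≥n⇒m⊔n≡m (<⇒≤ u<v))) (∈-map⁺ sorted h)

  length-concatMap : ∀ {A B : Set} (f : A → List B) c xs → (∀ x → length (f x) ≡ c) → length (concatMap f xs) ≡ length xs * c
  length-concatMap f c []       eq = refl
  length-concatMap f c (x ∷ xs) eq = trans (length-++ (f x)) (cong₂ _+_ (eq x) (length-concatMap f c xs eq))

  length-cartesianProduct : ∀ {A B : Set} (xs : List A) (ys : List B) → length (cartesianProduct xs ys) ≡ length xs * length ys
  length-cartesianProduct []       ys = refl
  length-cartesianProduct (x ∷ xs) ys = trans (length-++ (map (x ,_) ys)) (cong₂ _+_ (length-map (x ,_) ys) (length-cartesianProduct xs ys))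

  range : ℕ → ℕ → List ℕ
  range s len = applyUpTo (s +_) len

  ∈-range : ∀ {s len a} → s ≤ a → a < s + len → a ∈ range s len
  ∈-range {s} {len} {a} s≤a a< = subst (_∈ range s len) (m+[n∸m]≡n s≤a)
    (∈-applyUpTo⁺ (s +_) (+-cancelˡ-< s _ _ (subst (_< s + len) (sym (m+[n∸m]≡n s≤a)) a<)))

  quarter : ℕ → ℕ → ℕ
  quarter q zero    = 2 * q
  quarter q (suc k) = 2 * quarter q k

  spacing≡ : ∀ q k → spacing q k ≡ 4 * quarter q k
  spacing≡ q zero    = ((∀ q → 8 * q ≡ 4 * (2 * q)) ∋ solve-∀) q
  spacing≡ q (suc k) = trans (cong (2 *_) (spacing≡ q k)) (((∀ t → 2 * (4 * t) ≡ 4 * (2 * t)) ∋ solve-∀) (quarter q k))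

  quarter-2^ : ∀ q k → quarter q k ≡ 2 ^ k * (2 * q)
  quarter-2^ q zero    = sym (+-identityʳ (2 * q))
  quarter-2^ q (suc k) = trans (cong (2 *_) (quarter-2^ q k)) (sym (*-assoc 2 (2 ^ k) (2 * q)))

  quarter-mono : ∀ q {j k} → j ≤ k → quarter q j ≤ quarter q k
  quarter-mono q {j} {k} j≤k = subst₂ _≤_ (sym (quarter-2^ q j)) (sym (quarter-2^ q k)) (*-monoˡ-≤ (2 * q) (^-monoʳ-≤ 2 j≤k))

  quarter-pos : ∀ {q} → 1 ≤ q → ∀ k → 0 < quarter q k
  quarter-pos 1≤q zero    = ≤-trans 1≤q (m≤m+n _ _)
  quarter-pos 1≤q (suc k) = ≤-trans (quarter-pos 1≤q k) (m≤m+n _ _)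

  module Construction (n q : ℕ) (1≤q : 1 ≤ q) where

    nearPairs : List (ℕ × ℕ)
    nearPairs = concatMap (λ a → map (a ,_) (range a (25 * q + 1))) (upTo n)

    -- `t` is a quarter of the spacing, and `10 * q` on each side is the slack 40 q divided by 4.
    -- Where the subtraction is cut off at 0, the range keeps its length and still covers the reach.
    hubPairs : ℕ → Octant → ℕ → List (ℕ × ℕ)
    hubPairs t o h = cartesianProduct (range u q) (range (u ∸ (reachˡ o * t + 10 * q)) ((reachˡ o + reachʳ o) * t + 20 * q + 1))
      where u = (8 * h + num o) * (4 * t)

    -- Nodes of one residue are 8 spacings apart, which is 32 quarters.
    count : ∀ t → 0 < t → ℕ
    count t 0<t = suc ((n / (32 * t)) {{>-nonZero (≤-trans 0<t (m≤m+n t _))}})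

    octants : List Octant
    octants = o₁ ∷ o₃ ∷ o₅ ∷ o₇ ∷ []

    levelPairs : ℕ → List (ℕ × ℕ)
    levelPairs k = concatMap (λ o → concatMap (hubPairs t o) (upTo (count t (quarter-pos 1≤q k)))) octants
      where t = quarter q k

    allLevels : ℕ → List (ℕ × ℕ)
    allLevels zero    = []
    allLevels (suc K) = levelPairs K ++ allLevels K

    pairs : ℕ → List (ℕ × ℕ)
    pairs K = nearPairs ++ allLevels K

    level-∈ : ∀ {K k p} → k < K → p ∈ levelPairs k → p ∈ allLevels K
    level-∈ {suc K} {k} (s≤s k≤K) p∈ with m≤n⇒m<n∨m≡n k≤K
    ... | inj₁ k<K  = ∈-++⁺ʳ (levelPairs K) (level-∈ k<K p∈)
    ... | inj₂ refl = ∈-++⁺ˡ p∈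

    ∈-concatMap : ∀ {A B : Set} (f : A → List B) {x y xs} → x ∈ xs → y ∈ f x → y ∈ concatMap f xs
    ∈-concatMap f x∈ y∈ = ∈-concatMap⁺ f (Any.map (λ { refl → y∈ }) x∈)

    octant-∈ : ∀ o → o ∈ octants
    octant-∈ o₁ = here refl
    octant-∈ o₃ = there (here refl)
    octant-∈ o₅ = there (there (here refl))
    octant-∈ o₇ = there (there (there (here refl)))

    near-∈ : ∀ {K a b} → a < n → a ≤ b → b ≤ a + 25 * q → (a , b) ∈ pairs K
    near-∈ {K} {a} {b} a<n a≤b b≤ = ∈-++⁺ˡ (∈-concatMap (λ a → map (a ,_) (range a (25 * q + 1))) (∈-upTo⁺ a<n)
      (∈-map⁺ (a ,_) (∈-range a≤b ((b < a + (25 * q + 1)) ∋ lin b≤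
          (solve 3 (λ a b q → (con 1 :+ b) :+ (a :+ 25 :* q) :+ con 0 ⊜ a :+ (25 :* q :+ con 1) :+ b) refl a b q)))))

    node-∈ : ∀ {K} k o h {u j a} → k < K → u ≡ (8 * h + num o) * spacing q k → j < q → u + q ≤ n →
      4 * u ≤ 4 * a + reachˡ o * spacing q k + 40 * q →
      4 * a ≤ 4 * u + reachʳ o * spacing q k + 40 * q → (u + j , a) ∈ pairs K
    node-∈ {K} k o h {u} {j} {a} k<K u≡ j<q uq lo hi = ∈-++⁺ʳ nearPairs (level-∈ k<K
      (∈-concatMap (λ o → concatMap (hubPairs t o) (upTo m)) (octant-∈ o)
        (∈-concatMap (hubPairs t o) (∈-upTo⁺ (s≤s h≤))
          (subst (λ u′ → (u + j , a) ∈ cartesianProduct (range u′ q) (range (u′ ∸ A) len)) u≡′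
            (∈-cartesianProduct⁺ (∈-range (m≤m+n u j) (+-monoʳ-< u j<q)) (∈-range lo′ hi′))))))
      where
      t = quarter q k
      m = count t (quarter-pos 1≤q k)
      A = reachˡ o * t + 10 * q
      len = (reachˡ o + reachʳ o) * t + 20 * q + 1
      u≡′ : u ≡ (8 * h + num o) * (4 * t)
      u≡′ = trans u≡ (cong ((8 * h + num o) *_) (spacing≡ q k))
      nz = >-nonZero (≤-trans (quarter-pos 1≤q k) (m≤m+n t _))
      h≤ : h ≤ (n / (32 * t)) {{nz}}
      h≤ = ≤-trans (≤-reflexive (sym (m*n/n≡m h (32 * t) {{nz}}))) (/-monoˡ-≤ (32 * t) {{nz}} (begin
        h * (32 * t)                ≡⟨ ((∀ h t → h * (32 * t) ≡ 8 * h * (4 * t)) ∋ solve-∀) h t ⟩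
        8 * h * (4 * t)             ≤⟨ *-monoˡ-≤ (4 * t) (m≤m+n (8 * h) (num o)) ⟩
        (8 * h + num o) * (4 * t)   ≡⟨ u≡′ ⟨
        u                           ≤⟨ m+n≤o⇒m≤o u uq ⟩
        n                           ∎))
        where open ≤-Reasoning
      eqˡ : reachˡ o * spacing q k ≡ 4 * (reachˡ o * t)
      eqˡ = trans (cong (reachˡ o *_) (spacing≡ q k)) (((∀ r t → r * (4 * t) ≡ 4 * (r * t)) ∋ solve-∀) (reachˡ o) t)
      eqʳ : reachʳ o * spacing q k ≡ 4 * (reachʳ o * t)
      eqʳ = trans (cong (reachʳ o *_) (spacing≡ q k)) (((∀ r t → r * (4 * t) ≡ 4 * (r * t)) ∋ solve-∀) (reachʳ o) t)
      lo′ : u ∸ A ≤ a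
      lo′ = m≤n+o⇒m∸n≤o u A ((u ≤ (reachˡ o * t) + 10 * q + a) ∋ lin* 3 (lo ⊕ ≡⇒≤ eqˡ)
          (solve 5 (λ u a q r R → 4 :* u :+ (4 :* a :+ R :+ 40 :* q :+ 4 :* r) :+ con 3
            ⊜ 4 :* (r :+ 10 :* q :+ a) :+ (4 :* u :+ R) :+ con 3) refl u a q (reachˡ o * t) (reachˡ o * spacing q k)))
      hi′ : a < (u ∸ A) + len
      hi′ = let d = m≤n+m∸n u A ; e = *-distribʳ-+ t (reachˡ o) (reachʳ o) in
        ((a < (u ∸ A) + (((reachˡ o + reachʳ o) * t) + 20 * q + 1)) ∋ lin* 3 (hi ⊕ ≡⇒≤ eqʳ ⊕ 4 ⊗ d ⊕ 4 ⊗ ≡⇒≥ e)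
            (solve 8 (λ u a q l r R v s → 4 :* (con 1 :+ a) :+ (4 :* u :+ R :+ 40 :* q :+ 4 :* r :+ 4 :* (l :+ 10 :* q :+ v) :+ 4 :* s) :+ con 3
              ⊜ 4 :* (v :+ (s :+ 20 :* q :+ con 1)) :+ (4 :* a :+ R :+ 4 :* u :+ 4 :* (l :+ r)) :+ con 3) refl u a q (reachˡ o * t) (reachʳ o * t) (reachʳ o * spacing q k) (u ∸ A) ((reachˡ o + reachʳ o) * t)))

    length-near : length nearPairs ≡ n * (25 * q + 1)
    length-near = trans (length-concatMap (λ a → map (a ,_) (range a (25 * q + 1))) (25 * q + 1) (upTo n) (λ a → trans (length-map (a ,_) (range a (25 * q + 1))) (length-applyUpTo (a +_) (25 * q + 1))))
      (cong (_* (25 * q + 1)) (length-upTo n))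

    length-hub : ∀ t o h → length (hubPairs t o h) ≡ q * ((reachˡ o + reachʳ o) * t + 20 * q + 1)
    length-hub t o h = trans (length-cartesianProduct (range u q) _) (cong₂ _*_ (length-applyUpTo (u +_) q) (length-applyUpTo _ _))
      where u = (8 * h + num o) * (4 * t)

    length-level : ∀ k → length (levelPairs k) ≡ count (quarter q k) (quarter-pos 1≤q k) * (q * (63 * quarter q k + 80 * q + 4))
    length-level k = trans (length-++ (hubs o₁)) (trans (cong₂ _+_ (one o₁) (trans (length-++ (hubs o₃)) (cong₂ _+_ (one o₃)
        (trans (length-++ (hubs o₅)) (cong₂ _+_ (one o₅) (trans (length-++ (hubs o₇)) (cong₂ _+_ (one o₇) refl)))))))
        (((∀ m q t → m * (q * (14 * t + 20 * q + 1)) + (m * (q * (16 * t + 20 * q + 1)) + (m * (q * (15 * t + 20 * q + 1)) + (m * (q * (18 * t + 20 * q + 1)) + 0)))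
           ≡ m * (q * (63 * t + 80 * q + 4))) ∋ solve-∀) m q t))
      where
      t = quarter q k
      m = count t (quarter-pos 1≤q k)
      hubs : Octant → List (ℕ × ℕ)
      hubs o = concatMap (hubPairs t o) (upTo m)
      one : ∀ o → length (hubs o) ≡ m * (q * ((reachˡ o + reachʳ o) * t + 20 * q + 1))
      one o = trans (length-concatMap (hubPairs t o) _ (upTo m) (length-hub t o)) (cong (_* (q * ((reachˡ o + reachʳ o) * t + 20 * q + 1))) (length-upTo m))

    count≤ : ∀ k → 32 * quarter q k * count (quarter q k) (quarter-pos 1≤q k) ≤ n + 32 * quarter q k
    count≤ k = begin
      32 * t * suc d          ≡⟨ ((∀ t d → 32 * t * (1 + d) ≡ d * (32 * t) + 32 * t) ∋ solve-∀) t d ⟩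
      d * (32 * t) + 32 * t   ≤⟨ +-monoˡ-≤ (32 * t) (m/n*n≤m n (32 * t) {{nz}}) ⟩
      n + 32 * t              ∎
      where
      open ≤-Reasoning
      t = quarter q k
      nz = >-nonZero (≤-trans (quarter-pos 1≤q k) (m≤m+n t _))
      d = (n / (32 * t)) {{nz}}

    hubCount : ℕ → ℕ
    hubCount zero    = 0
    hubCount (suc K) = count (quarter q K) (quarter-pos 1≤q K) + hubCount K

    spread : ℕ → ℕ
    spread zero    = 0
    spread (suc K) = quarter q K + spread K

    spread≤ : ∀ K → spread K + 2 * q ≡ quarter q K
    spread≤ zero    = refl
    spread≤ (suc K) = trans (+-assoc (quarter q K) (spread K) (2 * q)) (trans (cong (quarter q K +_) (spread≤ K)) (cong (quarter q K +_) (sym (+-identityʳ _))))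

    -- 63 is the sum of the eight reaches, 2016 = 32⋅63 accounts for rounding up the number of nodes
    -- of each residue, and 2688 = 32⋅80 + 32⋅4 for the slack.
    length-levels : ∀ K → 32 * length (allLevels K) ≤ 63 * (q * (n * K)) + 2016 * (q * spread K) + 2688 * (q * (q * hubCount K))
    length-levels zero    = z≤n
    length-levels (suc K) = begin
      32 * length (levelPairs K ++ allLevels K)
        ≡⟨ cong (32 *_) (trans (length-++ (levelPairs K)) (cong (_+ length (allLevels K)) (length-level K))) ⟩
      32 * (m * (q * (63 * t + 80 * q + 4)) + length (allLevels K))
        ≡⟨ ((∀ m q t l → 32 * (m * (q * (63 * t + 80 * q + 4)) + l) ≡ 63 * (q * (32 * t * m)) + 2560 * (q * (q * m)) + 128 * (q * m) + 32 * l) ∋ solve-∀) m q t (length (allLevels K)) ⟩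
      63 * (q * (32 * t * m)) + 2560 * (q * (q * m)) + 128 * (q * m) + 32 * length (allLevels K)
        ≤⟨ +-mono-≤ (+-mono-≤ (+-monoˡ-≤ _ (*-monoʳ-≤ 63 (*-monoʳ-≤ q (count≤ K))))
             (*-monoʳ-≤ 128 (*-monoʳ-≤ q (≤-trans (≤-reflexive (sym (+-identityʳ m))) (*-monoˡ-≤ m 1≤q))))) (length-levels K) ⟩
      63 * (q * (n + 32 * t)) + 2560 * (q * (q * m)) + 128 * (q * (q * m)) + (63 * (q * (n * K)) + 2016 * (q * spread K) + 2688 * (q * (q * hubCount K)))
        ≡⟨ ((∀ m q t n K s c → 63 * (q * (n + 32 * t)) + 2560 * (q * (q * m)) + 128 * (q * (q * m)) + (63 * (q * (n * K)) + 2016 * (q * s) + 2688 * (q * (q * c)))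
              ≡ 63 * (q * (n * (1 + K))) + 2016 * (q * (t + s)) + 2688 * (q * (q * (m + c)))) ∋ solve-∀) m q t n K (spread K) (hubCount K) ⟩
      63 * (q * (n * suc K)) + 2016 * (q * spread (suc K)) + 2688 * (q * (q * hubCount (suc K))) ∎
      where
      open ≤-Reasoning
      t = quarter q K
      m = count t (quarter-pos 1≤q K)

    module _ {K} (below : ∀ k → k < K → spacing q k < n) where

      spread≤n : spread K ≤ n
      spread≤n = go K below
        where
        go : ∀ K → (∀ k → k < K → spacing q k < n) → spread K ≤ n
        go zero    _     = z≤n
        go (suc K) below = let h = below K ≤-refl ; e = spacing≡ q K ; s = spread≤ K in
          ((quarter q K + spread K ≤ n) ∋ lin (h ⊕ ≡⇒≥ e ⊕ ≡⇒≤ s)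
              (solve 5 (λ t s q n T → t :+ s :+ (n :+ T :+ t) :+ (2 :* t :+ 2 :* q :+ con 1)
                ⊜ n :+ ((con 1 :+ T) :+ 4 :* t :+ (s :+ 2 :* q))) refl (quarter q K) (spread K) q n (spacing q K)))

      -- The number of nodes on level k is O(n / (q 2ᵏ)), as the spacing is below `n`; 64 q times it
      -- is at most 9n / 2ᵏ, and the geometric series sums to at most 18 n.
      hubCount≤ : 64 * q * hubCount K ≤ 18 * n
      hubCount≤ = *-cancelˡ-≤ (2 ^ K) {{>-nonZero (m^n>0 2 K)}} (m+n≤o⇒m≤o _ (≤-trans (go K below) (≤-reflexive (*-comm (18 * n) (2 ^ K)))))
        where
        open ≤-Reasoning
        -- The partial sums are bounded by 18 n (1 - 2⁻ᴷ), multiplied out so as to stay in the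
        -- natural numbers.
        go : ∀ K → (∀ k → k < K → spacing q k < n) → 2 ^ K * (64 * q * hubCount K) + 18 * n ≤ 18 * n * 2 ^ K
        go zero    _     = ≤-reflexive (((∀ q n → 1 * (64 * q * 0) + 18 * n ≡ 18 * n * 1) ∋ solve-∀) q n)
        go (suc K) below = begin
          2 * 2 ^ K * (64 * q * (m + hubCount K)) + 18 * n
            ≡⟨ ((∀ p q m c n → 2 * p * (64 * q * (m + c)) + 18 * n ≡ 2 * (p * (64 * q * c)) + 2 * (32 * (p * (2 * q)) * m) + 18 * n) ∋ solve-∀) (2 ^ K) q m (hubCount K) n ⟩
          2 * (2 ^ K * (64 * q * hubCount K)) + 2 * (32 * (2 ^ K * (2 * q)) * m) + 18 * n
            ≤⟨ +-monoˡ-≤ (18 * n) (+-monoʳ-≤ (2 * (2 ^ K * (64 * q * hubCount K))) (*-monoʳ-≤ 2 9n)) ⟩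
          2 * (2 ^ K * (64 * q * hubCount K)) + 2 * (9 * n) + 18 * n
            ≡⟨ ((∀ x n → 2 * x + 2 * (9 * n) + 18 * n ≡ 2 * (x + 18 * n)) ∋ solve-∀) (2 ^ K * (64 * q * hubCount K)) n ⟩
          2 * (2 ^ K * (64 * q * hubCount K) + 18 * n)
            ≤⟨ *-monoʳ-≤ 2 (go K (λ k k<K → below k (m≤n⇒m≤1+n k<K))) ⟩
          2 * (18 * n * 2 ^ K)
            ≡⟨ ((∀ n p → 2 * (18 * n * p) ≡ 18 * n * (2 * p)) ∋ solve-∀) n (2 ^ K) ⟩
          18 * n * (2 * 2 ^ K) ∎
          where
          t = quarter q K
          m = count t (quarter-pos 1≤q K)
          9n : 32 * (2 ^ K * (2 * q)) * m ≤ 9 * n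
          9n = subst (λ t → 32 * t * m ≤ 9 * n) (quarter-2^ q K) (≤-trans (count≤ K)
            (let h = below K ≤-refl ; e = spacing≡ q K in
              ((n + 32 * t ≤ 9 * n) ∋ lin (8 ⊗ h ⊕ 8 ⊗ ≡⇒≥ e)
                  (solve 3 (λ t n T → n :+ 32 :* t :+ (8 :* n :+ 8 :* T) :+ con 8
                    ⊜ 9 :* n :+ (8 :* (con 1 :+ T) :+ 8 :* (4 :* t))) refl t n (spacing q K)))))

      length-pairs : 32 * length (pairs K) ≤ 63 * (q * n * K) + 4000 * (q * n)
      length-pairs = begin
        32 * length (pairs K)
          ≡⟨ cong (32 *_) (trans (length-++ nearPairs) (cong (_+ length (allLevels K)) length-near)) ⟩
        32 * (n * (25 * q + 1) + length (allLevels K))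
          ≡⟨ ((∀ n q l → 32 * (n * (25 * q + 1) + l) ≡ 800 * (q * n) + 32 * (1 * n) + 32 * l) ∋ solve-∀) n q (length (allLevels K)) ⟩
        800 * (q * n) + 32 * (1 * n) + 32 * length (allLevels K)
          ≤⟨ +-mono-≤ (+-monoʳ-≤ (800 * (q * n)) (*-monoʳ-≤ 32 (*-monoˡ-≤ n 1≤q))) (length-levels K) ⟩
        800 * (q * n) + 32 * (q * n) + (63 * (q * (n * K)) + 2016 * (q * spread K) + 2688 * (q * (q * hubCount K)))
          ≡⟨ ((∀ q n K s c → 800 * (q * n) + 32 * (q * n) + (63 * (q * (n * K)) + 2016 * (q * s) + 2688 * (q * (q * c)))
                ≡ 832 * (q * n) + 63 * (q * n * K) + 2016 * (q * s) + 42 * (q * (64 * q * c))) ∋ solve-∀) q n K (spread K) (hubCount K) ⟩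
        832 * (q * n) + 63 * (q * n * K) + 2016 * (q * spread K) + 42 * (q * (64 * q * hubCount K))
          ≤⟨ +-mono-≤ (+-monoʳ-≤ (832 * (q * n) + 63 * (q * n * K)) (*-monoʳ-≤ 2016 (*-monoʳ-≤ q spread≤n))) (*-monoʳ-≤ 42 (*-monoʳ-≤ q hubCount≤)) ⟩
        832 * (q * n) + 63 * (q * n * K) + 2016 * (q * n) + 42 * (q * (18 * n))
          ≤⟨ ≤-trans (m≤m+n _ (396 * (q * n))) (≤-reflexive (((∀ q n K → 832 * (q * n) + 63 * (q * n * K) + 2016 * (q * n) + 42 * (q * (18 * n)) + 396 * (q * n) ≡ 63 * (q * n * K) + 4000 * (q * n)) ∋ solve-∀) q n K)) ⟩
        63 * (q * n * K) + 4000 * (q * n) ∎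
        where open ≤-Reasoning

    levels : ∃ λ K → n ≤ spacing q K × (∀ k → k < K → spacing q k < n)
    levels = go n (≤-trans (n≤2^n n) (subst (2 ^ n ≤_) (sym (trans (spacing≡ q n) (cong (4 *_) (quarter-2^ q n))))
      (≤-trans (m≤m*n (2 ^ n) (2 * q) {{>-nonZero (≤-trans 1≤q (m≤m+n _ _))}}) (m≤m+n _ _))))
      where
      n≤2^n : ∀ n → n ≤ 2 ^ n
      n≤2^n zero    = z≤n
      n≤2^n (suc n) = ≤-trans (+-mono-≤ (m^n>0 2 n) (n≤2^n n)) (≤-reflexive (cong (2 ^ n +_) (sym (+-identityʳ _))))
      go : ∀ K → n ≤ spacing q K → ∃ λ K → n ≤ spacing q K × (∀ k → k < K → spacing q k < n)
      go zero h = 0 , h , λ _ ()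
      go (suc K) h with ≤-<-connex n (spacing q K)
      ... | inj₁ h′ = go K h′
      ... | inj₂ lt = suc K , h , λ k k<K → ≤-<-trans (spacing-mono (s≤s⁻¹ k<K)) lt
        where
        spacing-mono : ∀ {j k} → j ≤ k → spacing q j ≤ spacing q k
        spacing-mono {j} {k} le = subst₂ _≤_ (sym (spacing≡ q j)) (sym (spacing≡ q k)) (*-monoʳ-≤ 4 (quarter-mono q le))

  module Placed (n : ℕ) (L : List (ℕ × ℕ)) where
    open FromPairs n L

    -- A hub is required to be adjacent to every position of the interval, including its own, while
    -- the graph has no loops; hence the case of equality.
    Near : ℕ → ℕ → Set
    Near a b = a < n → b < n → a ≡ b ⊎ Joined a b
    Near-sym : ∀ {a b} → Near a b → Near b a
    Near-sym h b< a< = Sum.map sym Sum.swap (h a< b<)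

    module _ (H : Graph n) where
      open Embedding (_~_ H) (~-sym H) Near (λ {a} {b} → Near-sym {a} {b})

      emb-⊑ : Emb (allFin n) (λ _ → true) 0 n → H ⊑ graph
      emb-⊑ E = f , f-inj , f-edge
        where
        open Emb E
        at-f : ∀ v → ∃ (at v)
        at-f v = total (∈-allFin v)
        bound : ∀ v → proj₁ (at-f v) < n
        bound v = proj₁ (proj₂ (proj₂ (sound (proj₂ (at-f v)))))
        f : Fin n → Fin n
        f v = Fin.fromℕ< (bound v)
        toℕ-f : ∀ v → toℕ (f v) ≡ proj₁ (at-f v)
        toℕ-f v = Fin.toℕ-fromℕ< (bound v)
        f-inj : ∀ {u v} → f u ≡ f v → u ≡ v
        f-inj {u} {v} eq = inj (proj₂ (at-f u))
          (subst (at v) (trans (sym (toℕ-f v)) (trans (cong toℕ (sym eq)) (toℕ-f u))) (proj₂ (at-f v)))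
        f-edge : ∀ u v → _~_ H u v → _~_ graph (f u) (f v)
        f-edge u v u~v = isYes⁺ (adjacent? (f u) (f v)) (u≢v , joined)
          where
          u≢v : f u ≢ f v
          u≢v eq = ~-irrefl H (subst (_~_ H u) (sym (f-inj eq)) u~v)
          joined : Joined (toℕ (f u)) (toℕ (f v))
          joined with edge (proj₂ (at-f u)) (proj₂ (at-f v)) u~v (bound u) (bound v)
          ... | inj₁ eq = ⊥-elim (u≢v (Fin.toℕ-injective (trans (toℕ-f u) (trans eq (sym (toℕ-f v))))))
          ... | inj₂ j  = subst₂ Joined (sym (toℕ-f u)) (sym (toℕ-f v)) j

  module FromHubs (n w : ℕ) (L : List (ℕ × ℕ)) (K : ℕ) (n≤ : n ≤ spacing (suc w) K)
    (near-∈ : ∀ {a b} → a < n → a ≤ b → b ≤ a + 25 * suc w → (a , b) ∈ L)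
    (node-∈ : ∀ k o h {u j a} → k < K → u ≡ (8 * h + num o) * spacing (suc w) k → j < suc w → u + suc w ≤ n →
      4 * u ≤ 4 * a + reachˡ o * spacing (suc w) k + 40 * suc w →
      4 * a ≤ 4 * u + reachʳ o * spacing (suc w) k + 40 * suc w → (u + j , a) ∈ L)
    where
    open FromPairs n L
    open Placed n L

    universal-graph : Universal (HasTreewidth w) graph
    universal-graph H ((D , width≡) , _) =
      emb-⊑ H (U.universal K n≤ (allFin n) (Unique.allFin⁺ n) (length-tabulate (λ (i : Fin n) → i)))
      where
      q = suc w
      module D = Decomposed H D
      -- A block that fits has its node at least one spacing from 0 and below `n`, so its level is
      -- among those constructed.
      below : ∀ {k m u} → u ≡ m * spacing q k → 1 ≤ m → u + q ≤ n → k < K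
      below {k} {m} {u} u≡ 1≤m uq = ≰⇒> λ K≤k → <⇒≱ (≤-trans (≤-trans (s≤s (≤-trans (≤-reflexive (sym (+-identityʳ (spacing q k)))) (*-monoˡ-≤ (spacing q k) 1≤m))) (≤-reflexive (cong suc (sym u≡))))
          (≤-trans (≤-trans (≤-reflexive (+-comm 1 u)) (+-monoʳ-≤ u (s≤s z≤n))) uq))
        (≤-trans n≤ (subst₂ _≤_ (sym (spacing≡ q K)) (sym (spacing≡ q k)) (*-monoʳ-≤ 4 (quarter-mono q K≤k))))
      bag≤q : ∀ x → ∣ TreeDecomposition.bag D x ∣ ≤ q
      bag≤q x = subst (λ m → ∣ TreeDecomposition.bag D x ∣ ≤ suc m) width≡ (D.bag≤1+width x)
      pos : ∀ h o → 1 ≤ 8 * h + num o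
      pos h o = ≤-trans (num-pos o) (m≤n+m (num o) (8 * h))
        where
        num-pos : ∀ o → 1 ≤ num o
        num-pos o₁ = s≤s z≤n
        num-pos o₃ = s≤s z≤n
        num-pos o₅ = s≤s z≤n
        num-pos o₇ = s≤s z≤n
      module U = Universality (_~_ H) (~-sym H) Near Near-sym q (s≤s z≤n)
        (λ C i → D.Separate.separation q (s≤s z≤n) bag≤q C i)
        n (40 * q) ≤-refl
        (λ a≤b b≤ a< _ → inj₂ (inj₁ (near-∈ a< a≤b b≤)))
        (λ k o h u≡ j<q uq _ lo hi _ _ → inj₂ (inj₁ (node-∈ k o h (below u≡ (pos h o) uq) u≡ j<q uq lo hi)))

  module UniversalGraph (n w : ℕ) where
    open Construction n (suc w) (s≤s z≤n)

    result : ∃ λ K → (∀ k → k < K → spacing (suc w) k < n) × Σ[ G ∈ Graph n ]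
      Universal {n} (HasTreewidth w) G × 32 * edgeCount G ≤ 63 * (suc w * n * K) + 4000 * (suc w * n)
    result = let K , n≤ , below = levels in
      K , below , FromPairs.graph n (pairs K)
      , FromHubs.universal-graph n w (pairs K) K n≤ (near-∈ {K}) node-∈
      , ≤-trans (*-monoʳ-≤ 32 (FromPairs.edgeCount≤ n (pairs K))) (length-pairs {K} below)

-- Comparison of logarithms by lower and upper sums of 1/t.

module Logarithms where
  open import Defs
  open import Data.Integer using (+_)
  open import Data.Nat as ℕ using (ℕ; zero; suc)
  import Data.Nat.Properties as ℕ
  open import Data.Rational as ℚ using (ℚ; 0ℚ; 1ℚ; ½; _+_; _*_; _-_; -_; _≤_; _<_)
  import Data.Rational.Properties as ℚ
  open import Data.Rational.Solver using (module +-*-Solver)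

  open RationalLemmas
  open LogarithmCauchy
  open LogarithmBound
  open ℚ.≤-Reasoning
  open +-*-Solver using (solve; _:=_; _:+_; _:*_; _:-_; :-_; con)

  ≤⇒0≤- : ∀ {a b} → a ≤ b → 0ℚ ≤ b - a
  ≤⇒0≤- {a} {b} a≤b = subst (_≤ b - a) (ℚ.+-inverseʳ a) (ℚ.+-monoˡ-≤ (- a) a≤b)

  recip-antimono : ∀ {a b} → 0ℚ < a → a ≤ b → recip b ≤ recip a
  recip-antimono {a} {b} 0<a a≤b = subst₂ _≤_
    (ℚ.0≤p⇒∣p∣≡p (ℚ.<⇒≤ (recip-pos (ℚ.<-≤-trans 0<a a≤b)))) refl
    (abs-recip a b 0<a (ℚ.≤-trans a≤b (≤abs b)))

  recip-* : ∀ {a b} → 0ℚ < a → 0ℚ < b → recip (a * b) ≡ recip a * recip b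
  recip-* {a} {b} 0<a 0<b = begin-equality
    recip (a * b)
      ≡⟨ solve 1 (λ r → r := (con 1ℚ :* con 1ℚ) :* r) refl (recip (a * b)) ⟩
    (1ℚ * 1ℚ) * recip (a * b)
      ≡⟨ cong₂ (λ s t → (s * t) * recip (a * b)) (sym (recip-inverseʳ (>⇒≢ 0<a))) (sym (recip-inverseʳ (>⇒≢ 0<b))) ⟩
    ((a * recip a) * (b * recip b)) * recip (a * b)
      ≡⟨ solve 5 (λ a b x y r → ((a :* x) :* (b :* y)) :* r := ((a :* b) :* r) :* (x :* y)) refl a b (recip a) (recip b) (recip (a * b)) ⟩
    ((a * b) * recip (a * b)) * (recip a * recip b)
      ≡⟨ cong (_* (recip a * recip b)) (recip-inverseʳ (>⇒≢ (*-pos 0<a 0<b))) ⟩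
    1ℚ * (recip a * recip b)
      ≡⟨ ℚ.*-identityˡ _ ⟩
    recip a * recip b ∎

  -- Partitions as binary trees. `riemann` is the lower sum of the tree that bisects evenly, so it
  -- can be compared with upper sums over any other partition of the same interval.
  data Partition : ℚ → ℚ → Set where
    cell  : ∀ {a b} → a ≤ b → Partition a b
    split : ∀ {a b c} → Partition a b → Partition b c → Partition a c

  ends : ∀ {a b} → Partition a b → a ≤ b
  ends (cell a≤b)  = a≤b
  ends (split P Q) = ℚ.≤-trans (ends P) (ends Q)

  lower upper : ∀ {a b} → Partition a b → ℚ
  lower (cell {a} {b} _) = (b - a) * recip b
  lower (split P Q)      = lower P + lower Q
  upper (cell {a} {b} _) = (b - a) * recip a
  upper (split P Q)      = upper P + upper Q

  -- Cutting at `b` is a refinement, and 1/t decreases, so the upper sum does not grow.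
  restrict : ∀ {a b c} → 0ℚ < a → a ≤ b → b ≤ c → (Q : Partition a c) →
             Σ[ Q₁ ∈ Partition a b ] Σ[ Q₂ ∈ Partition b c ] upper Q₁ + upper Q₂ ≤ upper Q
  restrict {a} {b} {c} 0<a a≤b b≤c (cell a≤c) = cell a≤b , cell b≤c , (begin
    (b - a) * recip a + (c - b) * recip b
      ≤⟨ ℚ.+-monoʳ-≤ ((b - a) * recip a) (*-mono (c - b) (c - b) (recip b) (recip a)
           (≤⇒0≤- b≤c) (ℚ.<⇒≤ (recip-pos (ℚ.<-≤-trans 0<a a≤b))) ℚ.≤-refl (recip-antimono 0<a a≤b)) ⟩
    (b - a) * recip a + (c - b) * recip a
      ≡⟨ solve 4 (λ a b c r → (b :- a) :* r :+ (c :- b) :* r := (c :- a) :* r) refl a b c (recip a) ⟩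
    (c - a) * recip a ∎)
  restrict {a} {b} {c} 0<a a≤b b≤c (split {b = m} P Q) with ℚ.≤-total b m
  ... | inj₁ b≤m with restrict 0<a a≤b b≤m P
  ...   | P₁ , P₂ , h = P₁ , split P₂ Q , (begin
    upper P₁ + (upper P₂ + upper Q)  ≡⟨ ℚ.+-assoc (upper P₁) (upper P₂) (upper Q) ⟨
    (upper P₁ + upper P₂) + upper Q  ≤⟨ ℚ.+-monoˡ-≤ (upper Q) h ⟩
    upper P + upper Q                ∎)
  restrict {a} {b} {c} 0<a a≤b b≤c (split {b = m} P Q) | inj₂ m≤b with restrict (ℚ.<-≤-trans 0<a (ends P)) m≤b b≤c Q
  ...   | Q₁ , Q₂ , h = split P Q₁ , Q₂ , (begin
    (upper P + upper Q₁) + upper Q₂  ≡⟨ ℚ.+-assoc (upper P) (upper Q₁) (upper Q₂) ⟩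
    upper P + (upper Q₁ + upper Q₂)  ≤⟨ ℚ.+-monoʳ-≤ (upper P) h ⟩
    upper P + upper Q                ∎)

  cell≤upper : ∀ {a b} → 0ℚ < a → (Q : Partition a b) → (b - a) * recip b ≤ upper Q
  cell≤upper {a} {b} 0<a (cell a≤b) = *-mono (b - a) (b - a) (recip b) (recip a)
    (≤⇒0≤- a≤b) (ℚ.<⇒≤ (recip-pos (ℚ.<-≤-trans 0<a a≤b))) ℚ.≤-refl (recip-antimono 0<a a≤b)
  cell≤upper {a} {c} 0<a (split {b = b} P Q) = begin
    (c - a) * recip c
      ≡⟨ solve 4 (λ a b c r → (c :- a) :* r := (b :- a) :* r :+ (c :- b) :* r) refl a b c (recip c) ⟩
    (b - a) * recip c + (c - b) * recip c
      ≤⟨ ℚ.+-monoˡ-≤ ((c - b) * recip c) (*-mono (b - a) (b - a) (recip c) (recip b)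
           (≤⇒0≤- (ends P)) (ℚ.<⇒≤ (recip-pos (ℚ.<-≤-trans 0<b (ends Q)))) ℚ.≤-refl (recip-antimono 0<b (ends Q))) ⟩
    (b - a) * recip b + (c - b) * recip c
      ≤⟨ ℚ.+-mono-≤ (cell≤upper 0<a P) (cell≤upper 0<b Q) ⟩
    upper P + upper Q ∎
    where
    0<b : 0ℚ < b
    0<b = ℚ.<-≤-trans 0<a (ends P)

  -- By recursion on `P`, cutting `Q` at the division points of `P`.
  lower≤upper : ∀ {a b} → 0ℚ < a → (P Q : Partition a b) → lower P ≤ upper Q
  lower≤upper 0<a (cell _) Q = cell≤upper 0<a Q
  lower≤upper 0<a (split P₁ P₂) Q with restrict 0<a (ends P₁) (ends P₂) Q
  ... | Q₁ , Q₂ , h = ℚ.≤-trans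
    (ℚ.+-mono-≤ (lower≤upper 0<a P₁ Q₁) (lower≤upper (ℚ.<-≤-trans 0<a (ends P₁)) P₂ Q₂)) h

  lower-nonneg : ∀ {a b} → 0ℚ < a → (P : Partition a b) → 0ℚ ≤ lower P
  lower-nonneg {a} {b} 0<a (cell a≤b) = *-nonneg (b - a) (recip b) (≤⇒0≤- a≤b) (ℚ.<⇒≤ (recip-pos (ℚ.<-≤-trans 0<a a≤b)))
  lower-nonneg 0<a (split P Q) = ℚ.+-mono-≤ (lower-nonneg 0<a P) (lower-nonneg (ℚ.<-≤-trans 0<a (ends P)) Q)

  dyadic : ∀ {a b} → a ≤ b → ℕ → Partition a b
  dyadic a≤b zero    = cell a≤b
  dyadic a≤b (suc k) = split (dyadic (mid-≥ ℚ.≤-refl a≤b) k) (dyadic (mid-≤ a≤b ℚ.≤-refl) k)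

  lower-dyadic : ∀ {a b} (a≤b : a ≤ b) k → lower (dyadic a≤b k) ≡ riemann a b k
  lower-dyadic a≤b zero    = refl
  lower-dyadic a≤b (suc k) = cong₂ _+_ (lower-dyadic _ k) (lower-dyadic _ k)

  -- On cells of equal length, the difference of upper and lower sum telescopes to the cell length
  -- times 1/a - 1/b.
  upper-dyadic : ∀ {a b} (a≤b : a ≤ b) k →
    upper (dyadic a≤b k) ≡ riemann a b k + ((b - a) * (recip a - recip b)) * pow½ k
  upper-dyadic {a} {b} a≤b zero = solve 4 (λ a b x y → (b :- a) :* x := (b :- a) :* y :+ ((b :- a) :* (x :- y)) :* con 1ℚ) refl a b (recip a) (recip b)
  upper-dyadic {a} {b} a≤b (suc k) = trans (cong₂ _+_ (upper-dyadic (mid-≥ ℚ.≤-refl a≤b) k) (upper-dyadic (mid-≤ a≤b ℚ.≤-refl) k))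
    (solve 8 (λ a b x y z p r s → (r :+ ((con ½ :* (a :+ b) :- a) :* (x :- z)) :* p) :+ (s :+ ((b :- con ½ :* (a :+ b)) :* (z :- y)) :* p)
        := (r :+ s) :+ ((b :- a) :* (x :- y)) :* (con ½ :* p))
      refl a b (recip a) (recip b) (recip (mid a b)) (pow½ k) (riemann a (mid a b) k) (riemann (mid a b) b k))

  scale-cell : ∀ c {a b d} → 0ℚ < c → 0ℚ < d → (c * b - c * a) * recip (c * d) ≡ (b - a) * recip d
  scale-cell c {a} {b} {d} 0<c 0<d = begin-equality
    (c * b - c * a) * recip (c * d)             ≡⟨ cong ((c * b - c * a) *_) (recip-* 0<c 0<d) ⟩
    (c * b - c * a) * (recip c * recip d)       ≡⟨ solve 5 (λ a b c x y → (c :* b :- c :* a) :* (x :* y) := (c :* x) :* ((b :- a) :* y)) refl a b c (recip c) (recip d) ⟩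
    (c * recip c) * ((b - a) * recip d)         ≡⟨ cong (_* ((b - a) * recip d)) (recip-inverseʳ (>⇒≢ 0<c)) ⟩
    1ℚ * ((b - a) * recip d)                    ≡⟨ ℚ.*-identityˡ _ ⟩
    (b - a) * recip d                           ∎

  -- The form dt/t is invariant under scaling, cell by cell; this replaces the functional equation
  -- of the logarithm.
  dilate : ∀ c → 0ℚ < c → ∀ {a b} → 0ℚ < a → (P : Partition a b) →
           Σ[ Q ∈ Partition (c * a) (c * b) ] lower Q ≡ lower P × upper Q ≡ upper P
  dilate c 0<c 0<a (cell a≤b) = cell (ℚ.*-monoˡ-≤-nonNeg c {{ℚ.nonNegative (ℚ.<⇒≤ 0<c)}} a≤b)
    , scale-cell c 0<c (ℚ.<-≤-trans 0<a a≤b) , scale-cell c 0<c 0<a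
  dilate c 0<c 0<a (split P₁ P₂) with dilate c 0<c 0<a P₁ | dilate c 0<c (ℚ.<-≤-trans 0<a (ends P₁)) P₂
  ... | Q₁ , l₁ , u₁ | Q₂ , l₂ , u₂ = split Q₁ Q₂ , cong₂ _+_ l₁ l₂ , cong₂ _+_ u₁ u₂

  power : ℚ → ℕ → ℚ
  power y zero    = 1ℚ
  power y (suc p) = power y p * y

  power-pos : ∀ {y} p → 0ℚ < y → 0ℚ < power y p
  power-pos zero    _   = ℚ.positive⁻¹ 1ℚ
  power-pos (suc p) 0<y = *-pos (power-pos p 0<y) 0<y

  power-mono : ∀ {y z} p → 0ℚ < y → y ≤ z → power y p ≤ power z p
  power-mono zero    _   _   = ℚ.≤-refl
  power-mono {y} {z} (suc p) 0<y y≤z = *-mono (power y p) (power z p) y z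
    (ℚ.<⇒≤ (power-pos p (ℚ.<-≤-trans 0<y y≤z))) (ℚ.<⇒≤ 0<y) (power-mono p 0<y y≤z) y≤z

  relabel : ∀ {a a′ b} → a ≡ a′ → (P : Partition a b) → Σ[ Q ∈ Partition a′ b ] lower Q ≡ lower P × upper Q ≡ upper P
  relabel refl P = P , refl , refl

  -- The p translates of P under multiplication by y partition [1 , yᵖ].
  powers : ∀ {y} → 0ℚ < y → (P : Partition 1ℚ y) → ∀ p →
    Σ[ Q ∈ Partition 1ℚ (power y p) ] lower Q ≡ nat p * lower P × upper Q ≡ nat p * upper P
  powers 0<y P zero = cell ℚ.≤-refl , sym (ℚ.*-zeroˡ (lower P)) , sym (ℚ.*-zeroˡ (upper P))
  powers {y} 0<y P (suc p) with powers 0<y P p | dilate (power y p) (power-pos p 0<y) (ℚ.positive⁻¹ 1ℚ) P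
  ... | Q , l , u | R , l′ , u′ with relabel (ℚ.*-identityʳ (power y p)) R
  ...   | R′ , l″ , u″ = split Q R′ , add l (trans l″ l′) , add u (trans u″ u′)
    where
    add : ∀ {x z t} → x ≡ nat p * t → z ≡ t → x + z ≡ nat (suc p) * t
    add {t = t} refl refl = solve 2 (λ n t → n :* t :+ t := (con 1ℚ :+ n) :* t) refl (nat p) t

  -- The `m` dilated copies of a partition of [1 , x] end at xᵐ, and one more cell leads on to yᵖ,
  -- where a lower sum meets an upper sum. The error term comes from `upper-dyadic` and vanishes as
  -- `k` grows.
  log-power≤ : ∀ {x y} → 1ℚ ≤ x → 1ℚ ≤ y → ∀ m p k → power x m ≤ power y p →
    nat m * riemann 1ℚ x k ≤ nat p * (riemann 1ℚ y k + ((y - 1ℚ) * (recip 1ℚ - recip y)) * pow½ k)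
  log-power≤ {x} {y} 1≤x 1≤y m p k le with powers (ℚ.<-≤-trans (ℚ.positive⁻¹ 1ℚ) 1≤x) (dyadic 1≤x k) m
                                        | powers (ℚ.<-≤-trans (ℚ.positive⁻¹ 1ℚ) 1≤y) (dyadic 1≤y k) p
  ... | P , l , _ | Q , _ , u = begin
    nat m * riemann 1ℚ x k                ≡⟨ cong (nat m *_) (lower-dyadic 1≤x k) ⟨
    nat m * lower (dyadic 1≤x k)          ≡⟨ l ⟨
    lower P                               ≡⟨ ℚ.+-identityʳ (lower P) ⟨
    lower P + 0ℚ                          ≤⟨ ℚ.+-monoʳ-≤ (lower P) (lower-nonneg (power-pos m (ℚ.<-≤-trans (ℚ.positive⁻¹ 1ℚ) 1≤x)) (cell le)) ⟩
    lower (split P (cell le))             ≤⟨ lower≤upper (ℚ.positive⁻¹ 1ℚ) (split P (cell le)) Q ⟩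
    upper Q                               ≡⟨ u ⟩
    nat p * upper (dyadic 1≤y k)          ≡⟨ cong (nat p *_) (upper-dyadic 1≤y k) ⟩
    nat p * (riemann 1ℚ y k + ((y - 1ℚ) * (recip 1ℚ - recip y)) * pow½ k) ∎

  pow½-antimono : ∀ {j k} → j ℕ.≤ k → pow½ k ≤ pow½ j
  pow½-antimono {j} {k} j≤k with ℕ.m≤n⇒m<n∨m≡n j≤k
  ... | inj₂ refl = ℚ.≤-refl
  ... | inj₁ (ℕ.s≤s {n = k′} j≤k′) = ℚ.≤-trans
    (subst (½ * pow½ k′ ≤_) (ℚ.*-identityˡ (pow½ k′)) (*-monoʳ {½} {1ℚ} (pow½ k′) (ℚ.<⇒≤ (pow½-pos k′)) (ℚ.≤ᵇ⇒≤ _)))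
    (pow½-antimono j≤k′)

  3^5j≤ : ∀ j → power (nat 3) (5 ℕ.* j) ≤ power (power (nat 2) j) 8
  3^5j≤ zero    = ℚ.≤ᵇ⇒≤ _
  3^5j≤ (suc j) = subst (λ m → power (nat 3) m ≤ power (power (nat 2) (suc j)) 8) (sym (ℕ.*-suc 5 j)) (begin
    power (nat 3) (5 ℕ.+ 5 ℕ.* j)
      ≡⟨ solve 2 (λ a t → a :* t :* t :* t :* t :* t := a :* (t :* t :* t :* t :* t)) refl (power (nat 3) (5 ℕ.* j)) (nat 3) ⟩
    power (nat 3) (5 ℕ.* j) * (nat 3 * nat 3 * nat 3 * nat 3 * nat 3)
      ≤⟨ *-mono (power (nat 3) (5 ℕ.* j)) (power b 8) (nat 3 * nat 3 * nat 3 * nat 3 * nat 3) (power (nat 2) 8)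
           (ℚ.<⇒≤ (power-pos 8 (power-pos j (ℚ.positive⁻¹ (nat 2))))) (ℚ.≤ᵇ⇒≤ _) (3^5j≤ j) (ℚ.≤ᵇ⇒≤ _) ⟩
    power b 8 * power (nat 2) 8
      ≡⟨ solve 2 (λ b t → let p8 = λ x → con 1ℚ :* x :* x :* x :* x :* x :* x :* x :* x in p8 b :* p8 t := p8 (b :* t)) refl b (nat 2) ⟩
    power (b * nat 2) 8 ∎)
    where b = power (nat 2) j

  -- The index `N` depends on `x`, because the error does; an error of 1 is harmless, as it ends up
  -- in the term O(nw).
  5ln3≤8ln : ∀ {x} → 1ℚ ≤ x → ∀ j → power (nat 2) j ≤ x →
    ∃ λ N → ∀ k → N ℕ.≤ k → nat (5 ℕ.* j) * riemann 1ℚ (nat 3) k ≤ nat 8 * riemann 1ℚ x k + 1ℚ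
  5ln3≤8ln {x} 1≤x j 2^j≤x = N , λ k N≤k → begin
    nat (5 ℕ.* j) * riemann 1ℚ (nat 3) k
      ≤⟨ log-power≤ (ℚ.≤ᵇ⇒≤ _) 1≤x (5 ℕ.* j) 8 k (ℚ.≤-trans (3^5j≤ j) (power-mono 8 (power-pos j (ℚ.positive⁻¹ (nat 2))) 2^j≤x)) ⟩
    nat 8 * (riemann 1ℚ x k + e * pow½ k)
      ≡⟨ solve 3 (λ r e p → con (nat 8) :* (r :+ e :* p) := con (nat 8) :* r :+ (con (nat 8) :* e) :* p) refl (riemann 1ℚ x k) e (pow½ k) ⟩
    nat 8 * riemann 1ℚ x k + (nat 8 * e) * pow½ k
      ≤⟨ ℚ.+-monoʳ-≤ (nat 8 * riemann 1ℚ x k) (ℚ.≤-trans (ℚ.*-monoˡ-≤-nonNeg (nat 8 * e) {{ℚ.nonNegative 0≤8e}} (pow½-antimono N≤k)) small) ⟩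
    nat 8 * riemann 1ℚ x k + 1ℚ ∎
    where
    e = (x - 1ℚ) * (recip 1ℚ - recip x)
    0≤8e : 0ℚ ≤ nat 8 * e
    0≤8e = *-nonneg (nat 8) e (ℚ.≤ᵇ⇒≤ _) (*-nonneg (x - 1ℚ) (recip 1ℚ - recip x) (≤⇒0≤- 1≤x) (≤⇒0≤- (recip-antimono (ℚ.positive⁻¹ 1ℚ) 1≤x)))
    bound = pow½-small (nat 8 * e) 1ℚ 0≤8e (ℚ.positive⁻¹ 1ℚ)
    N = proj₁ bound
    small = proj₂ bound

  harmonic : ℕ → ℚ
  harmonic zero    = 0ℚ
  harmonic (suc m) = harmonic m + recip (nat (suc m))

  nat-pos : ∀ m → 0ℚ < nat (suc m)
  nat-pos m = ℚ.<-≤-trans (ℚ.positive⁻¹ 1ℚ) (subst (_≤ nat (suc m)) (ℚ.+-identityʳ 1ℚ) (ℚ.+-monoʳ-≤ 1ℚ (nat-nonneg m)))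

  nat-step : ∀ m → nat m ≤ nat (suc m)
  nat-step m = subst (_≤ nat (suc m)) (ℚ.+-identityˡ (nat m)) (ℚ.+-monoˡ-≤ (nat m) (ℚ.<⇒≤ (ℚ.positive⁻¹ 1ℚ)))

  unitCells : ∀ m → Σ[ Q ∈ Partition 1ℚ (nat (suc m)) ] upper Q ≡ harmonic m
  unitCells zero    = cell ℚ.≤-refl , refl
  unitCells (suc m) = let Q , u = unitCells m in split Q (cell (nat-step (suc m)))
    , cong₂ _+_ u (solve 2 (λ a r → (con 1ℚ :+ a :- a) :* r := r) refl (nat (suc m)) (recip (nat (suc m))))

  -- Unit cells up to M = m + 1 have upper sum `harmonic m`, and the single cell [M , 2M] has upper
  -- sum 1.
  ln≤harmonic : ∀ {x} m → 1ℚ ≤ x → x ≤ nat (suc m) + nat (suc m) → ∀ k → riemann 1ℚ x k ≤ harmonic m + 1ℚ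
  ln≤harmonic {x} m 1≤x x≤ k with unitCells m
  ... | Q , u = begin
    riemann 1ℚ x k                                   ≡⟨ lower-dyadic 1≤x k ⟨
    lower (dyadic 1≤x k)                             ≡⟨ ℚ.+-identityʳ _ ⟨
    lower (dyadic 1≤x k) + 0ℚ                        ≤⟨ ℚ.+-monoʳ-≤ (lower (dyadic 1≤x k)) (lower-nonneg (ℚ.<-≤-trans (ℚ.positive⁻¹ 1ℚ) 1≤x) (cell x≤)) ⟩
    lower (split (dyadic 1≤x k) (cell x≤))           ≤⟨ lower≤upper (ℚ.positive⁻¹ 1ℚ) (split (dyadic 1≤x k) (cell x≤)) (split Q (cell M≤2M)) ⟩
    upper Q + ((M + M) - M) * recip M                ≡⟨ cong₂ _+_ u (trans (solve 2 (λ m r → (m :+ m :- m) :* r := m :* r) refl M (recip M)) (recip-inverseʳ (>⇒≢ (nat-pos m)))) ⟩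
    harmonic m + 1ℚ                                  ∎
    where
    M = nat (suc m)
    M≤2M : M ≤ M + M
    M≤2M = subst (_≤ M + M) (ℚ.+-identityʳ M) (ℚ.+-monoʳ-≤ M (nat-nonneg (suc m)))

-- Graphs of treewidth w made of groups with w hubs each.

module GroupGraphs where
  open import Defs
  open import Data.Bool using (true; false; T)
  open import Data.Fin as Fin using (Fin; zero; suc; toℕ; inject₁; fromℕ)
  import Data.Fin.Properties as Fin
  open import Data.Fin.Subset using (Subset; ∣_∣) renaming (_∈_ to _∈ˢ_)
  open import Data.List using (List; []; _∷_; length; map; upTo; tabulate)
  open import Data.List.Membership.Propositional using (_∈_)
  open import Data.List.Membership.Propositional.Properties using (∈-map⁺; ∈-map⁻; ∈-upTo⁺)
  open import Data.List.Properties using (length-map; length-upTo)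
  open import Data.List.Relation.Unary.All as All using (All; []; _∷_)
  import Data.List.Relation.Unary.All.Properties as All
  open import Data.List.Relation.Unary.Any using (here; there)
  open import Data.List.Relation.Unary.AllPairs using ([]; _∷_)
  open import Data.List.Relation.Unary.Unique.Propositional using (Unique)
  import Data.List.Relation.Unary.Unique.Propositional.Properties as Unique
  open import Data.Nat
  open import Data.Nat.Divisibility using (n∣m*n)
  open import Data.Nat.DivMod using (m≡m%n+[m/n]*n; m<n⇒m/n≡0; m<n⇒m%n≡m; m*n/n≡m; +-distrib-/-∣ʳ; [m+kn]%n≡m%n; /-monoˡ-≤)
  open import Data.Nat.Properties
  open import Data.Vec as Vec using (Vec; []; _∷_)
  import Data.Vec.Properties as Vec
  import Data.Vec.Functional as VF
  open import Relation.Binary.Construct.Closure.ReflexiveTransitive using (Star; ε; _◅_; reverse; gmap)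
  open import Relation.Nullary.Decidable using (_×-dec_; _⊎-dec_; ¬?; isYes)
  open LinearArithmetic
  open RootedTrees using (~-sym; isYes⁺; isYes⁻; fromRelation; length-⊆)
  open Separation

  open Graph using (_~_; edgeCount)

  module Path (n : ℕ) where

    Next : Fin n → Fin n → Set
    Next a b = toℕ b ≡ suc (toℕ a) ⊎ toℕ a ≡ suc (toℕ b)

    next? : ∀ a b → Dec (Next a b)
    next? a b = (toℕ b ≟ suc (toℕ a)) ⊎-dec (toℕ a ≟ suc (toℕ b))

    path : Graph n
    path = fromRelation next? Sum.swap λ { (inj₁ e) → 1+n≢n (sym e) ; (inj₂ e) → 1+n≢n (sym e) }

    -- The largest vertex of a cycle would have two neighbours below it.
    below : ∀ {a b} → _~_ path a b → toℕ b ≤ toℕ a → toℕ a ≡ suc (toℕ b)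
    below {a} {b} e le with isYes⁻ (next? a b) e
    ... | inj₁ eq = ⊥-elim (<⇒≱ (≤-reflexive (sym eq)) le)
    ... | inj₂ eq = eq

    acyclic : ¬ Cycle path
    acyclic C with argmax {P = λ _ → 0 ≡ 0} (λ _ → yes refl) (toℕ ∘ Cycle.vertex C) (zero , refl)
    ... | j , _ , max = peak j max
      where
      open Cycle C
      two-below : ∀ {j a b} → (∀ i → 0 ≡ 0 → toℕ (vertex i) ≤ toℕ (vertex j)) → a ≢ b →
        _~_ path (vertex j) (vertex a) → _~_ path (vertex j) (vertex b) → ⊥
      two-below {j} {a} {b} max a≢b ja jb = a≢b (distinct (Fin.toℕ-injective (suc-injective
        (trans (sym (below ja (max a refl))) (below jb (max b refl))))))
      peak : ∀ j → (∀ i → 0 ≡ 0 → toℕ (vertex i) ≤ toℕ (vertex j)) → ⊥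
      peak zero max = two-below {zero} {suc zero} {fromℕ (2 + k)} max (λ ()) (step zero) (~-sym path close)
      peak (suc j) max with suc j Fin.≟ fromℕ (2 + k)
      ... | yes eq = two-below {suc j} {inject₁ j} {zero} max (λ e → 1≢0 (subst (λ z → toℕ z ≡ 0) (Fin.suc-injective eq) (trans (sym (Fin.toℕ-inject₁ j)) (cong toℕ e))))
        (~-sym path (step j)) (subst (λ z → _~_ path (vertex z) (vertex zero)) (sym eq) close)
        where
        1≢0 : toℕ (fromℕ (1 + k)) ≢ 0
        1≢0 ()
      ... | no  ne = two-below {suc j} {inject₁ j} {suc j′} max
        (λ e → m≢1+m+n (toℕ j) (trans (trans (sym (Fin.toℕ-inject₁ j)) (cong toℕ e)) (trans (cong suc toℕ-j′) (cong suc (sym (+-comm (toℕ j) 1))) )))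
        (~-sym path (step j)) (subst (λ z → _~_ path (vertex z) (vertex (suc j′))) inject-j′ (step j′))
        where
        j<  : suc (toℕ j) < 2 + k
        j< = ≤∧≢⇒< (Fin.toℕ≤pred[n] (suc j)) (λ e → ne (Fin.toℕ-injective (trans e (sym (Fin.toℕ-fromℕ (2 + k))))))
        j′ : Fin (2 + k)
        j′ = Fin.fromℕ< j<
        toℕ-j′ : toℕ j′ ≡ suc (toℕ j)
        toℕ-j′ = Fin.toℕ-fromℕ< j<
        inject-j′ : inject₁ j′ ≡ suc j
        inject-j′ = Fin.toℕ-injective (trans (Fin.toℕ-inject₁ j′) toℕ-j′)

    walk-up : ∀ {Q : Fin n → Set} m x y → toℕ y ≡ m + toℕ x → (∀ z → toℕ x ≤ toℕ z → toℕ z ≤ toℕ y → Q z) →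
              Star (λ a b → _~_ path a b × Q a × Q b) x y
    walk-up {Q} zero    x y eq _ = subst (Star _ x) (Fin.toℕ-injective (sym eq)) ε
    walk-up {Q} (suc m) x y eq q = (isYes⁺ (next? x x′) (inj₁ x′≡) , q x ≤-refl (≤-trans (n≤1+n _) x′≤y) , q x′ (≤-trans (n≤1+n _) (≤-reflexive (sym x′≡))) (subst (_≤ toℕ y) (sym x′≡) x′≤y))
        ◅ walk-up m x′ y (trans eq (trans (sym (+-suc m (toℕ x))) (cong (m +_) (sym x′≡)))) (λ z a b → q z (≤-trans (n≤1+n _) (≤-trans (≤-reflexive (sym x′≡)) a)) b)
      where
      x′≤y : suc (toℕ x) ≤ toℕ y
      x′≤y = subst (suc (toℕ x) ≤_) (sym eq) (s≤s (m≤n+m (toℕ x) m))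
      x′< : suc (toℕ x) < n
      x′< = ≤-<-trans x′≤y (Fin.toℕ<n y)
      x′ : Fin n
      x′ = Fin.fromℕ< x′<
      x′≡ : toℕ x′ ≡ suc (toℕ x)
      x′≡ = Fin.toℕ-fromℕ< x′<

    walk : ∀ {Q : Fin n → Set} x y → (∀ z → toℕ x ⊓ toℕ y ≤ toℕ z → toℕ z ≤ toℕ x ⊔ toℕ y → Q z) →
           Star (λ a b → _~_ path a b × Q a × Q b) x y
    walk {Q} x y q with ≤-total (toℕ x) (toℕ y)
    ... | inj₁ le = walk-up (toℕ y ∸ toℕ x) x y (sym (m∸n+n≡m le))
      (λ z a b → q z (≤-trans (m⊓n≤m _ _) a) (≤-trans b (m≤n⊔m _ _)))
    ... | inj₂ ge = reverse (λ (e , a , b) → ~-sym path e , b , a) (walk-up (toℕ x ∸ toℕ y) y x (sym (m∸n+n≡m ge))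
      (λ z a b → q z (≤-trans (m⊓n≤n _ _) a) (≤-trans b (m≤m⊔n _ _))))

    isTree : .{{NonZero n}} → IsTree path
    isTree {{nz}} = record
      { nonempty = recompute-nonzero ; connected = λ x y → gmap (λ z → z) proj₁ (walk {λ _ → 0 ≡ 0} x y (λ _ _ _ → refl)) ; acyclic = acyclic }
      where
      recompute-nonzero : NonZero n
      recompute-nonzero = ≢-nonZero (λ n≡0 → ≢-nonZero⁻¹ n n≡0)

  elements : ∀ {n} → Subset n → List (Fin n)
  elements []          = []
  elements (true ∷ p)  = zero ∷ map suc (elements p)
  elements (false ∷ p) = map suc (elements p)

  length-elements : ∀ {n} (p : Subset n) → length (elements p) ≡ ∣ p ∣
  length-elements []          = refl
  length-elements (true ∷ p)  = cong suc (trans (length-map suc (elements p)) (length-elements p))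
  length-elements (false ∷ p) = trans (length-map suc (elements p)) (length-elements p)

  elements-∈ : ∀ {n} (p : Subset n) {v} → v ∈ elements p → v ∈ˢ p
  elements-∈ (true ∷ p)  (here refl) = Vec.here
  elements-∈ (true ∷ p)  (there v∈) with ∈-map⁻ suc v∈
  ... | _ , u∈ , refl = Vec.there (elements-∈ p u∈)
  elements-∈ (false ∷ p) v∈ with ∈-map⁻ suc v∈
  ... | _ , u∈ , refl = Vec.there (elements-∈ p u∈)

  elements-unique : ∀ {n} (p : Subset n) → Unique (elements p)
  elements-unique []          = []
  elements-unique (true ∷ p)  = All.map⁺ (All.tabulate (λ _ ())) ∷ Unique.map⁺ Fin.suc-injective (elements-unique p)
  elements-unique (false ∷ p) = Unique.map⁺ Fin.suc-injective (elements-unique p)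

  ∣∣≤length : ∀ {n} (p : Subset n) (ys : List ℕ) → (∀ {v} → v ∈ˢ p → toℕ v ∈ ys) → ∣ p ∣ ≤ length ys
  ∣∣≤length p ys sub = subst (_≤ length ys) (trans (length-map toℕ (elements p)) (length-elements p))
    (length-⊆ (map toℕ (elements p)) ys (Unique.map⁺ Fin.toℕ-injective (elements-unique p))
      λ x∈ → case ∈-map⁻ toℕ x∈ of λ { (_ , v∈ , refl) → sub (elements-∈ p v∈) })

  -- Consecutive groups of c vertices; the first w vertices of each group are
  -- joined to the whole group.
  module Groups (n c w : ℕ) (1≤w : 1 ≤ w) (w<c : w < c) (c≤n : c ≤ n) where
    instance
      c≢0 : NonZero c
      c≢0 = >-nonZero (≤-trans (s≤s z≤n) w<c)
      n≢0 : NonZero n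
      n≢0 = >-nonZero (≤-trans (≤-trans (s≤s z≤n) w<c) c≤n)

    Hub : Fin n → Set
    Hub v = toℕ v % c < w

    group : Fin n → ℕ
    group v = toℕ v / c

    Same : Fin n → Fin n → Set
    Same u v = u ≢ v × group u ≡ group v × (Hub u ⊎ Hub v)

    same? : ∀ u v → Dec (Same u v)
    same? u v = ¬? (u Fin.≟ v) ×-dec ((group u ≟ group v) ×-dec ((toℕ u % c <? w) ⊎-dec (toℕ v % c <? w)))

    groups : Graph n
    groups = fromRelation same? (λ (a , b , c) → a ∘ sym , sym b , Sum.swap c) (λ (a , _) → a refl)

    open Path n

    -- The tree is the path on the vertices themselves: along a group the hubs stay in the bag while
    -- the other vertices pass through it one at a time.
    Bag : Fin n → Fin n → Set
    Bag x v = group v ≡ group x × (Hub v ⊎ v ≡ x)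

    bag? : ∀ x v → Dec (Bag x v)
    bag? x v = (group v ≟ group x) ×-dec ((toℕ v % c <? w) ⊎-dec (v Fin.≟ x))

    bag : Fin n → Subset n
    bag x = Vec.tabulate (λ v → isYes (bag? x v))

    bag⁺ : ∀ {x v} → Bag x v → v ∈ˢ bag x
    bag⁺ {x} {v} b = Vec.lookup⇒[]= v (bag x) (trans (Vec.lookup∘tabulate _ v) (isYes-true (bag? x v) b))
      where
      isYes-true : ∀ {A : Set} (a? : Dec A) → A → isYes a? ≡ true
      isYes-true (yes _) _ = refl
      isYes-true (no ¬a) a = ⊥-elim (¬a a)

    bag⁻ : ∀ {x v} → v ∈ˢ bag x → Bag x v
    bag⁻ {x} {v} v∈ = isYes⁻ (bag? x v) (subst T (sym (trans (sym (Vec.lookup∘tabulate _ v)) (Vec.[]=⇒lookup v∈))) _)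

    decomposition : TreeDecomposition groups
    decomposition = record
      { tree = path ; isTree = isTree ; bag = bag
      ; vertices = λ v → v , bag⁺ (refl , inj₂ refl)
      ; edges = edges
      ; coherent = coherent }
      where
      edges : ∀ u v → _~_ groups u v → ∃ λ x → u ∈ˢ bag x × v ∈ˢ bag x
      edges u v e with isYes⁻ (same? u v) e
      ... | _ , eq , inj₁ hub = v , bag⁺ (eq , inj₁ hub) , bag⁺ (refl , inj₂ refl)
      ... | _ , eq , inj₂ hub = u , bag⁺ (refl , inj₂ refl) , bag⁺ (sym eq , inj₁ hub)
      between : ∀ v x y z → toℕ x ⊓ toℕ y ≤ toℕ z → toℕ z ≤ toℕ x ⊔ toℕ y → group v ≡ group x → group v ≡ group y → group v ≡ group z
      between v x y z lo hi gx gy with ≤-total (toℕ x) (toℕ y)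
      ... | inj₁ le = ≤-antisym (subst (_≤ group z) (sym gx) (/-monoˡ-≤ c (subst (_≤ toℕ z) (m≤n⇒m⊓n≡m le) lo)))
                                (subst (group z ≤_) (sym gy) (/-monoˡ-≤ c (subst (toℕ z ≤_) (m≤n⇒m⊔n≡n le) hi)))
      ... | inj₂ ge = ≤-antisym (subst (_≤ group z) (sym gy) (/-monoˡ-≤ c (subst (_≤ toℕ z) (m≥n⇒m⊓n≡n ge) lo)))
                                (subst (group z ≤_) (sym gx) (/-monoˡ-≤ c (subst (toℕ z ≤_) (m≥n⇒m⊔n≡m ge) hi)))
      -- A vertex that is not a hub lies in its own bag only; a hub lies in the bags of its group,
      -- which are consecutive on the path.
      coherent : ∀ v x y → v ∈ˢ bag x → v ∈ˢ bag y → Star (λ x′ y′ → _~_ path x′ y′ × v ∈ˢ bag x′ × v ∈ˢ bag y′) x y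
      coherent v x y v∈x v∈y with bag⁻ v∈x | bag⁻ v∈y
      ... | _ , inj₂ refl | _ , inj₂ refl = ε
      ... | gx , inj₁ hub  | gy , _        = walk x y λ z lo hi → bag⁺ (between v x y z lo hi gx gy , inj₁ hub)
      ... | gx , inj₂ refl | gy , inj₁ hub = walk x y λ z lo hi → bag⁺ (between v x y z lo hi gx gy , inj₁ hub)

    bag-size : ∀ x → ∣ bag x ∣ ≤ suc w
    bag-size x = subst (∣ bag x ∣ ≤_) (cong suc (trans (length-map _ (upTo w)) (length-upTo w)))
      (∣∣≤length (bag x) (toℕ x ∷ map (λ j → j + group x * c) (upTo w)) inside)
      where
      inside : ∀ {v} → v ∈ˢ bag x → toℕ v ∈ toℕ x ∷ map (λ j → j + group x * c) (upTo w)
      inside {v} v∈ with bag⁻ v∈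
      ... | _ , inj₂ refl = here refl
      ... | g , inj₁ hub  = there (subst (_∈ map (λ j → j + group x * c) (upTo w))
        (trans (cong (λ g → toℕ v % c + g * c) (sym g)) (sym (m≡m%n+[m/n]*n (toℕ v) c))) (∈-map⁺ (λ j → j + group x * c) (∈-upTo⁺ hub)))

    vertex : ∀ g (j : Fin c) → toℕ j + g * c < n → Fin n
    vertex g j lt = Fin.fromℕ< lt

    toℕ-vertex : ∀ g j lt → toℕ (vertex g j lt) ≡ toℕ j + g * c
    toℕ-vertex g j lt = Fin.toℕ-fromℕ< lt

    group-vertex : ∀ g j lt → group (vertex g j lt) ≡ g
    group-vertex g j lt = trans (cong (_/ c) (toℕ-vertex g j lt))
      (trans (+-distrib-/-∣ʳ (toℕ j) (n∣m*n g)) (cong₂ _+_ (m<n⇒m/n≡0 (Fin.toℕ<n j)) (m*n/n≡m g c)))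

    index-vertex : ∀ g j lt → toℕ (vertex g j lt) % c ≡ toℕ j
    index-vertex g j lt = trans (cong (_% c) (toℕ-vertex g j lt)) (trans ([m+kn]%n≡m%n (toℕ j) g c) (m<n⇒m%n≡m (Fin.toℕ<n j)))

    -- Universality speaks of treewidth exactly `w`, so a lower bound is needed as well: the `w`
    -- hubs of the group 0 and one more vertex of it form a clique.
    treewidth : HasTreewidth w groups
    treewidth = (decomposition , ≤-antisym width≤ (at-least decomposition)) , λ k (D , eq) → subst (w ≤_) eq (at-least D)
      where
      width≤ : TreeDecomposition.width decomposition ≤ w
      width≤ = ∸-monoˡ-≤ 1 (fold≤ (λ x → ∣ bag x ∣) bag-size)
        where
        fold≤ : ∀ {m} (f : Fin m → ℕ) → (∀ x → f x ≤ suc w) → VF.foldr _⊔_ 0 f ≤ suc w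
        fold≤ {zero}  f h = z≤n
        fold≤ {suc m} f h = ⊔-lub (h zero) (fold≤ (f ∘ suc) (h ∘ suc))
      small : ∀ (j : Fin (suc w)) → toℕ j < n
      small j = <-≤-trans (≤-trans (Fin.toℕ<n j) w<c) c≤n
      K : Fin (suc w) → Fin n
      K j = Fin.fromℕ< (small j)
      toℕ-K : ∀ j → toℕ (K j) ≡ toℕ j
      toℕ-K j = Fin.toℕ-fromℕ< (small j)
      K-inj : ∀ {i j} → K i ≡ K j → i ≡ j
      K-inj {i} {j} eq = Fin.toℕ-injective (trans (sym (toℕ-K i)) (trans (cong toℕ eq) (toℕ-K j)))
      K-group : ∀ j → group (K j) ≡ 0
      K-group j = trans (cong (_/ c) (toℕ-K j)) (m<n⇒m/n≡0 (≤-trans (Fin.toℕ<n j) w<c))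
      K-index : ∀ j → toℕ (K j) % c ≡ toℕ j
      K-index j = trans (cong (_% c) (toℕ-K j)) (m<n⇒m%n≡m (≤-trans (Fin.toℕ<n j) w<c))
      K-hub : ∀ i j → i ≢ j → Hub (K i) ⊎ Hub (K j)
      K-hub i j i≢j with toℕ i <? w | toℕ j <? w
      ... | yes h | _ = inj₁ (subst (_< w) (sym (K-index i)) h)
      ... | no _ | yes h = inj₂ (subst (_< w) (sym (K-index j)) h)
      ... | no p | no r = ⊥-elim (i≢j (Fin.toℕ-injective (trans (≤-antisym (Fin.toℕ≤pred[n] i) (≮⇒≥ p)) (sym (≤-antisym (Fin.toℕ≤pred[n] j) (≮⇒≥ r))))))
      at-least : (D : TreeDecomposition groups) → w ≤ TreeDecomposition.width D
      at-least D = Decomposed.clique≤width groups D K K-inj λ i j i≢j → isYes⁺ (same? (K i) (K j))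
        ((λ eq → i≢j (K-inj eq)) , trans (K-group i) (sym (K-group j)) , K-hub i j i≢j)

-- Deleting hubs from a universal graph.

module Peeling where
  open import Defs
  open import Data.Bool using (T?)
  open import Data.Fin as Fin using (Fin; zero; suc; toℕ)
  import Data.Fin.Properties as Fin
  open import Data.List as List using (List; []; _∷_; length; filter; map; tabulate)
  open import Data.List.Membership.Propositional using (_∈_; _∉_)
  open import Data.List.Membership.Propositional.Properties using (∈-map⁻; ∈-filter⁺; ∈-filter⁻; ∈-tabulate⁻; ∈-cartesianProduct⁺; ∈-allFin)
  open import Data.List.Properties using (length-map; length-tabulate)
  open import Data.List.Relation.Unary.Any using (here; there)
  open import Data.List.Relation.Unary.Unique.Propositional using (Unique)
  import Data.List.Relation.Unary.Unique.Propositional.Properties as Unique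
  open import Data.Nat
  open import Data.Nat.DivMod using (m/n*n≤m; /-monoˡ-≤; m*n/n≡m)
  open import Data.Nat.Properties
  open import Relation.Nullary.Decidable using (_×-dec_; _⊎-dec_; ¬?; decidable-stable)
  open import Relation.Unary using (Decidable)
  open LinearArithmetic
  open RootedTrees using (~-sym; ~-irrefl; isYes⁺; length-⊆)
  open Separation
  open GroupGraphs

  open Graph using (_~_; edgeCount)

  #-filter : ∀ {A : Set} {P R : A → Set} (P? : Decidable P) (R? : Decidable R) xs →
             (∀ {x} → P x → R x) → # P? xs ≤ # P? (filter R? xs)
  #-filter P? R? []       _   = z≤n
  #-filter P? R? (x ∷ xs) P⊆R with R? x
  ... | yes r with P? x
  ...   | yes _ = s≤s (#-filter P? R? xs P⊆R)
  ...   | no _  = #-filter P? R? xs P⊆R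
  #-filter P? R? (x ∷ xs) P⊆R | no ¬r with P? x
  ...   | yes p = ⊥-elim (¬r (P⊆R p))
  ...   | no _  = #-filter P? R? xs P⊆R

  -- If the last class has `w` members or more, dropping it from the list leaves fewer than `i * w`
  -- elements for the remaining `i` classes.
  pigeonhole : ∀ {A : Set} (class : A → ℕ) i w xs → length xs < i * w → ∃ λ g → g < i × # (λ x → class x ≟ g) xs < w
  pigeonhole class (suc i) w xs len with ≤-<-connex w (# (λ x → class x ≟ i) xs)
  ... | inj₂ few = i , ≤-refl , few
  ... | inj₁ many with pigeonhole class i w rest len′
    where
    other? = λ x → ¬? (class x ≟ i)
    all? : Decidable (λ _ → 0 ≡ 0)
    all? _ = yes refl
    rest = filter other? xs
    total : length xs ≡ # (λ x → class x ≟ i) xs + length rest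
    total = trans (sym (#-all all? xs (λ _ → refl))) (#-add all? (λ x → class x ≟ i) other? xs
      (λ {x} _ _ → case class x ≟ i of λ { (yes h) → inj₁ h ; (no h) → inj₂ h }) (λ _ → refl) (λ _ → refl) (λ h k → k h))
    len′ : length rest < i * w
    len′ = ((length rest < (i * w)) ∋ lin (≡⇒≥ total ⊕ many ⊕ len)
        (solve 5 (λ r x m w p → (con 1 :+ r) :+ (x :+ m :+ (w :+ p)) :+ con 0
          ⊜ p :+ (m :+ r :+ w :+ (con 1 :+ x))) refl (length rest) (length xs) (# (λ x → class x ≟ i) xs) w (i * w)))
  ... | g , g<i , few = g , m≤n⇒m≤1+n g<i ,
    ≤-<-trans (#-filter (λ x → class x ≟ g) (λ x → ¬? (class x ≟ i)) xs (λ p r → <-irrefl (trans (sym p) r) g<i)) few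

  module Peel {n} (G : Graph n) where
    open import Data.List.Membership.DecPropositional (Fin._≟_ {n}) using (_∈?_)

    Avoids : List (Fin n) → Fin n × Fin n → Set
    Avoids S (u , v) = u ∉ S × v ∉ S

    avoids? : ∀ S → Decidable (Avoids S)
    avoids? S (u , v) = ¬? (u ∈? S) ×-dec ¬? (v ∈? S)

    edges : List (Fin n × Fin n)
    edges = Graph.edges G

    remaining : List (Fin n) → ℕ
    remaining S = # (avoids? S) edges

    edge-∈ : ∀ {u v} → toℕ u < toℕ v → _~_ G u v → (u , v) ∈ edges
    edge-∈ {u} {v} u<v e = ∈-filter⁺ (λ (u , v) → (u Fin.<? v) ×-dec T? (Graph.adj G u v))
      (∈-cartesianProduct⁺ (∈-allFin u) (∈-allFin v)) (u<v , e)

    oriented : Fin n → Fin n → Fin n × Fin n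
    oriented h x with toℕ h <? toℕ x
    ... | yes _ = h , x
    ... | no _  = x , h

    -- The edges that avoid `S` either avoid `h` too or meet it, and the edges from `h` to `N` are
    -- distinct ones of the latter kind.
    peel : ∀ h S (N : List (Fin n)) → h ∉ S → Unique N → (∀ {x} → x ∈ N → _~_ G h x × x ∉ S) →
           remaining (h ∷ S) + length N ≤ remaining S
    peel h S N h∉S uN nbr = begin
      remaining (h ∷ S) + length N                ≤⟨ +-monoʳ-≤ (remaining (h ∷ S)) incident ⟩
      remaining (h ∷ S) + # at? edges             ≡⟨ #-add (avoids? S) (avoids? (h ∷ S)) at? edges cover
                                                       (λ (a , b) → a ∘ there , b ∘ there) proj₁
                                                       (λ { (a , b) (_ , inj₁ refl) → a (here refl) ; (a , b) (_ , inj₂ refl) → b (here refl) }) ⟨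
      remaining S                                 ∎
      where
      open ≤-Reasoning
      At : Fin n × Fin n → Set
      At (u , v) = Avoids S (u , v) × (u ≡ h ⊎ v ≡ h)
      at? : Decidable At
      at? (u , v) = avoids? S (u , v) ×-dec ((u Fin.≟ h) ⊎-dec (v Fin.≟ h))
      cover : ∀ {e} → e ∈ edges → Avoids S e → Avoids (h ∷ S) e ⊎ At e
      cover {u , v} _ av@(a , b) with u Fin.≟ h | v Fin.≟ h
      ... | yes p | _     = inj₂ (av , inj₁ p)
      ... | no _  | yes p = inj₂ (av , inj₂ p)
      ... | no p  | no r  = inj₁ ((λ { (here e) → p e ; (there i) → a i }) , λ { (here e) → r e ; (there i) → b i })
      oriented-inj : ∀ {x y} → oriented h x ≡ oriented h y → x ≡ y
      oriented-inj {x} {y} eq with toℕ h <? toℕ x | toℕ h <? toℕ y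
      ... | yes _ | yes _ = cong proj₂ eq
      ... | no _  | no _  = cong proj₁ eq
      ... | yes p | no _  = trans (cong proj₂ eq) (cong proj₁ eq)
      ... | no _  | yes _ = trans (cong proj₁ eq) (cong proj₂ eq)
      oriented-∈ : ∀ {x} → x ∈ N → oriented h x ∈ filter at? edges
      oriented-∈ {x} x∈ with toℕ h <? toℕ x | nbr x∈
      ... | yes lt | e , x∉ = ∈-filter⁺ at? (edge-∈ lt e) ((h∉S , x∉) , inj₁ refl)
      ... | no ge  | e , x∉ = ∈-filter⁺ at? (edge-∈ (≤∧≢⇒< (≮⇒≥ ge) λ eq → ~-irrefl G (subst (λ z → _~_ G h z) (Fin.toℕ-injective eq) e)) (~-sym G e))
        ((x∉ , h∉S) , inj₂ refl)
      incident : length N ≤ # at? edges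
      incident = subst (_≤ # at? edges) (length-map (oriented h) N)
        (length-⊆ (map (oriented h) N) (filter at? edges) (Unique.map⁺ oriented-inj uN)
          λ p∈ → case ∈-map⁻ (oriented h) p∈ of λ { (_ , x∈ , refl) → oriented-∈ x∈ })

    module Step (i c w : ℕ) (1≤w : 1 ≤ w) (w<c : w < c) (ic≤n : suc i * c ≤ n)
      (copy : Groups.groups n c w 1≤w w<c (m+n≤o⇒m≤o c ic≤n) ⊑ G) (S : List (Fin n)) (S< : length S < suc i * w) where
      open Groups n c w 1≤w w<c (m+n≤o⇒m≤o c ic≤n)

      f : Fin n → Fin n
      f = proj₁ copy

      f-inj : ∀ {u v} → f u ≡ f v → u ≡ v
      f-inj = proj₁ (proj₂ copy)

      -- A vertex outside the image of the copy is put into class 0. This can only enlarge a class,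
      -- so a class with few deleted vertices still belongs to a group with few of them.
      class : Fin n → ℕ
      class x with Fin.any? (λ v → f v Fin.≟ x)
      ... | yes (v , _) = group v
      ... | no _        = 0

      class-f : ∀ v → class (f v) ≡ group v
      class-f v with Fin.any? (λ u → f u Fin.≟ f v)
      ... | yes (u , eq) = cong group (f-inj eq)
      ... | no none      = ⊥-elim (none (v , refl))

      next : ∃ λ h → h ∉ S × remaining (h ∷ S) + (c ∸ w) ≤ remaining S
      next with pigeonhole class (suc i) w S S<
      ... | g , g< , few = case Fin.any? (λ (j : Fin c) → (toℕ j <? w) ×-dec ¬? (place j ∈? S)) of λ where
          (no none)          → ⊥-elim (all-hubs none)
          (yes (j , jw , h∉S)) → place j , h∉S , ≤-trans (+-monoʳ-≤ (remaining (place j ∷ S)) (enough j))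
            (peel (place j) S (others j) h∉S (uniqueOthers j) (λ x∈ → neighbour j jw x∈))
        where
        room : ∀ (j : Fin c) → toℕ j + g * c < n
        room j = <-≤-trans (+-monoˡ-< (g * c) (Fin.toℕ<n j)) (≤-trans (*-monoˡ-≤ c g<) ic≤n)
        vert : Fin c → Fin n
        vert j = vertex g j (room j)
        place : Fin c → Fin n
        place j = f (vert j)
        vert-inj : ∀ {j k} → vert j ≡ vert k → j ≡ k
        vert-inj {j} {k} eq = Fin.toℕ-injective (trans (sym (index-vertex g j (room j))) (trans (cong (λ v → toℕ v % c) eq) (index-vertex g k (room k))))
        place-inj : ∀ {j k} → place j ≡ place k → j ≡ k
        place-inj = vert-inj ∘ f-inj
        place-class : ∀ j → class (place j) ≡ g
        place-class j = trans (class-f (vert j)) (group-vertex g j (room j))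
        all-hubs : ¬ (∃ λ j → toℕ j < w × place j ∉ S) → ⊥
        all-hubs none = <⇒≱ few (subst (_≤ # (λ x → class x ≟ g) S) (length-tabulate hub)
          (length-⊆ (tabulate hub) (filter (λ x → class x ≟ g) S)
            (Unique.tabulate⁺ (λ {a} {b} eq → Fin.inject≤-injective (<⇒≤ w<c) (<⇒≤ w<c) a b (place-inj eq)))
            λ x∈ → case ∈-tabulate⁻ {f = hub} x∈ of λ { (j , refl) → ∈-filter⁺ (λ x → class x ≟ g)
              (decidable-stable (hub j ∈? S) λ h∉ → none (Fin.inject≤ j (<⇒≤ w<c) , subst (_< w) (sym (Fin.toℕ-inject≤ j (<⇒≤ w<c))) (Fin.toℕ<n j) , h∉))
              (place-class (Fin.inject≤ j (<⇒≤ w<c))) }))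
          where
          hub : Fin w → Fin n
          hub j = place (Fin.inject≤ j (<⇒≤ w<c))
        Other : Fin c → Fin n → Set
        Other j x = x ∉ S × x ≢ place j
        other? : ∀ j → Decidable (Other j)
        other? j x = ¬? (x ∈? S) ×-dec ¬? (x Fin.≟ place j)
        places : List (Fin n)
        places = tabulate place
        uniquePlaces : Unique places
        uniquePlaces = Unique.tabulate⁺ place-inj
        others : Fin c → List (Fin n)
        others j = filter (other? j) places
        uniqueOthers : ∀ j → Unique (others j)
        uniqueOthers j = Unique.filter⁺ (other? j) uniquePlaces
        neighbour : ∀ j → toℕ j < w → ∀ {x} → x ∈ others j → _~_ G (place j) x × x ∉ S
        neighbour j jw x∈ with ∈-filter⁻ (other? j) {xs = places} x∈
        ... | p∈ , x∉S , x≢ with ∈-tabulate⁻ {f = place} p∈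
        ...   | k , refl = proj₂ (proj₂ copy) (vert j) (vert k) (isYes⁺ (same? (vert j) (vert k))
          ( (λ eq → x≢ (cong f (sym eq))) , trans (group-vertex g j (room j)) (sym (group-vertex g k (room k)))
          , inj₁ (subst (_< w) (sym (index-vertex g j (room j))) jw))) , x∉S
        enough : ∀ j → c ∸ w ≤ length (others j)
        enough j = m≤n+o⇒m∸n≤o c w (begin
          c                                                    ≡⟨ length-tabulate place ⟨
          length places                                        ≡⟨ #-all (λ _ → yes refl) places (λ _ → refl {x = 0}) ⟨
          # (λ _ → yes refl) places                            ≤⟨ #-cover {P = λ _ → 0 ≡ 0} (λ _ → yes refl) bad? (other? j) places cover ⟩
          # bad? places + length (others j)                    ≤⟨ +-monoˡ-≤ (length (others j)) bad≤w ⟩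
          w + length (others j)                                ∎)
          where
          open ≤-Reasoning
          bad? : Decidable (λ x → x ∈ S ⊎ x ≡ place j)
          bad? x = (x ∈? S) ⊎-dec (x Fin.≟ place j)
          cover : ∀ {x} → x ∈ places → 0 ≡ 0 → (x ∈ S ⊎ x ≡ place j) ⊎ Other j x
          cover {x} _ _ with x ∈? S | x Fin.≟ place j
          ... | yes p | _     = inj₁ (inj₁ p)
          ... | no _  | yes p = inj₁ (inj₂ p)
          ... | no p  | no r  = inj₂ (p , r)
          bad≤w : # bad? places ≤ w
          -- The inequality `few` is strict, which pays for the hub itself.
          bad≤w = ≤-trans (length-⊆ (filter bad? places) (place j ∷ filter (λ x → class x ≟ g) S) (Unique.filter⁺ bad? uniquePlaces) sub) few
            where
            sub : ∀ {x} → x ∈ filter bad? places → x ∈ place j ∷ filter (λ x → class x ≟ g) S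
            sub x∈ with ∈-filter⁻ bad? {xs = places} x∈
            ... | _  , inj₂ eq = here eq
            ... | p∈ , inj₁ x∈S with ∈-tabulate⁻ {f = place} p∈
            ...   | k , refl = there (∈-filter⁺ (λ x → class x ≟ g) x∈S (place-class k))

  divisors : ℕ → ℕ → ℕ → ℕ
  divisors n w zero    = 0
  divisors n w (suc m) = divisors n w m + (n / suc m ∸ w)

  module _ {n w} (1≤w : 1 ≤ w) (G : Graph n) (universal : Universal {n} (HasTreewidth w) G) where
    open Peel G

    module _ (i c : ℕ) (w<c : w < c) (ic≤n : suc i * c ≤ n) where
      peel-hub : ∀ S → length S < suc i * w → ∃ λ h → remaining (h ∷ S) + (c ∸ w) ≤ remaining S
      peel-hub S S< = let h , _ , step = Step.next i c w 1≤w w<c ic≤n (universal groups treewidth) S S< in h , step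
        where open Groups n c w 1≤w w<c (m+n≤o⇒m≤o c ic≤n)

      -- Groups of one size serve for `w` deletions: before each of them the number of deleted
      -- vertices is still below `suc i * w`.
      peel-group : ∀ j → j ≤ w → ∀ S → length S ≡ i * w →
        ∃ λ S′ → length S′ ≡ i * w + j × remaining S′ + j * (c ∸ w) ≤ remaining S
      peel-group zero    _   S len = S , trans len (sym (+-identityʳ _)) , ≤-reflexive (+-identityʳ _)
      peel-group (suc j) j<w S len = let
          S′ , len′ , ih = peel-group j (<⇒≤ j<w) S len
          h , step = peel-hub S′ ((length S′ < w + (i * w)) ∋ lin (≡⇒≤ len′ ⊕ j<w)
              (solve 4 (λ l p j w → (con 1 :+ l) :+ (p :+ j :+ w) :+ con 0 ⊜ w :+ p :+ (l :+ (con 1 :+ j))) refl (length S′) (i * w) j w))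
        in h ∷ S′ , trans (cong suc len′) (sym (+-suc (i * w) j)) ,
          (((remaining (h ∷ S′)) + ((c ∸ w) + (j * (c ∸ w))) ≤ remaining S) ∋ lin (step ⊕ ih)
              (solve 5 (λ a b c d e → a :+ (d :+ e) :+ (b :+ c) :+ con 0
                ⊜ c :+ (a :+ d :+ (b :+ e))) refl (remaining (h ∷ S′)) (remaining S′) (remaining S) (c ∸ w) (j * (c ∸ w))))

    peel-groups : ∀ m → m * suc w ≤ n → ∃ λ S → length S ≡ m * w × remaining S + w * divisors n w m ≤ edgeCount G
    peel-groups zero    _  = [] , refl , ≤-trans (≤-reflexive (trans (cong (remaining [] +_) (*-zeroʳ w)) (+-identityʳ _))) remaining≤
      where
      open import Data.List.Properties using (length-filter)
      remaining≤ : remaining [] ≤ edgeCount G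
      remaining≤ = length-filter (avoids? []) edges
    peel-groups (suc m) le = let
        S , len , ih = peel-groups m (≤-trans (m≤n+m _ (suc w)) le)
        w<c : w < n / suc m
        w<c = subst (_≤ n / suc m) (m*n/n≡m (suc w) (suc m)) (/-monoˡ-≤ (suc m) (subst (_≤ n) (*-comm (suc m) (suc w)) le))
        mc≤n : suc m * (n / suc m) ≤ n
        mc≤n = subst (_≤ n) (*-comm (n / suc m) (suc m)) (m/n*n≤m n (suc m))
        S′ , len′ , step = peel-group m (n / suc m) w<c mc≤n w ≤-refl S len
        dist = *-distribˡ-+ w (divisors n w m) (n / suc m ∸ w)
      in S′ , trans len′ (+-comm (m * w) w) ,
        ((remaining S′ + (w * (divisors n w m + (n / suc m ∸ w))) ≤ edgeCount G) ∋ lin (step ⊕ ih ⊕ ≡⇒≤ dist)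
            (solve 6 (λ r r′ a b c e → r′ :+ c :+ (r :+ e :+ (a :+ b)) :+ con 0
              ⊜ e :+ (r′ :+ b :+ (r :+ a) :+ c)) refl (remaining S) (remaining S′) (w * divisors n w m) (w * (n / suc m ∸ w)) (w * (divisors n w m + (n / suc m ∸ w))) (edgeCount G)))

    edges≥ : ∀ m → m * suc w ≤ n → w * divisors n w m ≤ edgeCount G
    edges≥ m le = let S , _ , h = peel-groups m le in ≤-trans (m≤n+m _ (remaining S)) h

-- From edge counts to the two logarithmic bounds.

module Estimates where
  open import Defs
  open import Data.Integer as ℤ using (+_)
  import Data.Integer.Properties as ℤ
  open import Data.Nat as ℕ using (ℕ; zero; suc; NonZero; _+_; _*_; _<_; s≤s)
  import Data.Nat.Properties as ℕ
  import Data.Nat.DivMod as ℕ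
  open import Data.Rational as ℚ using (ℚ; 0ℚ; 1ℚ; _/_)
  import Data.Rational.Properties as ℚ
  open import Data.Rational.Solver using (module +-*-Solver)
  open import Data.Rational.Unnormalised as ℚᵘ using (mkℚᵘ; *≡*)
  import Data.Rational.Unnormalised.Properties as ℚᵘ
  open import Data.Nat.Tactic.RingSolver using (solve-∀)
  open UniversalGraphs using (module UniversalGraph; quarter; quarter-2^; spacing≡)
  open Hierarchy using (spacing)
  open Logarithms
  open Peeling using (divisors; edges≥)

  open RationalLemmas
  open LogarithmCauchy
  open LogarithmBound
  open ℝ using (seq)
  open ℚ.≤-Reasoning
  open +-*-Solver using (solve; _:=_; _:+_; _:*_; _:-_; :-_; con)

  nat-+ : ∀ a b → nat (a + b) ≡ nat a ℚ.+ nat b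
  nat-+ zero    b = sym (ℚ.+-identityˡ (nat b))
  nat-+ (suc a) b = trans (cong (1ℚ ℚ.+_) (nat-+ a b)) (sym (ℚ.+-assoc 1ℚ (nat a) (nat b)))

  nat-* : ∀ a b → nat (a * b) ≡ nat a ℚ.* nat b
  nat-* zero    b = sym (ℚ.*-zeroˡ (nat b))
  nat-* (suc a) b = trans (nat-+ b (a * b)) (trans (cong (nat b ℚ.+_) (nat-* a b))
    (solve 2 (λ a b → b :+ a :* b := (con 1ℚ :+ a) :* b) refl (nat a) (nat b)))

  nat-mono : ∀ {a b} → a ℕ.≤ b → nat a ℚ.≤ nat b
  nat-mono {a} {b} a≤b = subst₂ ℚ._≤_ (ℚ.+-identityʳ (nat a))
    (trans (sym (nat-+ a (b ℕ.∸ a))) (cong nat (ℕ.m+[n∸m]≡n a≤b)))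
    (ℚ.+-monoʳ-≤ (nat a) (nat-nonneg (b ℕ.∸ a)))

  nat-power : ∀ a p → nat (a ℕ.^ p) ≡ power (nat a) p
  nat-power a zero    = ℚ.+-identityʳ 1ℚ
  nat-power a (suc p) = trans (nat-* a (a ℕ.^ p)) (trans (cong (nat a ℚ.*_) (nat-power a p)) (ℚ.*-comm (nat a) (power (nat a) p)))

  quotient-* : ∀ n w .{{_ : NonZero w}} → (+ n / w) ℚ.* nat w ≡ nat n
  quotient-* n (suc d) = trans (cong ((+ n / suc d) ℚ.*_) (sym (+/1≡nat (suc d)))) (trans (ℚ.toℚᵘ-injective eq) (+/1≡nat n))
    where
    eq : ℚ.toℚᵘ ((+ n / suc d) ℚ.* (+ suc d / 1)) ℚᵘ.≃ ℚ.toℚᵘ (+ n / 1)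
    eq = ℚᵘ.≃-trans (ℚ.toℚᵘ-homo-* (+ n / suc d) (+ suc d / 1))
      (ℚᵘ.≃-trans (ℚᵘ.*-cong (ℚ.toℚᵘ-fromℚᵘ (mkℚᵘ (+ n) d)) (ℚ.toℚᵘ-fromℚᵘ (mkℚᵘ (+ suc d) 0)))
        (ℚᵘ.≃-trans (*≡* (trans (ℤ.*-identityʳ _) (cong ((+ n) ℤ.*_) (cong +_ (sym (ℕ.*-identityʳ (suc d))))))) (ℚᵘ.≃-sym (ℚ.toℚᵘ-fromℚᵘ (mkℚᵘ (+ n) 0)))))

  *-cancel : ∀ {p q} r → 0ℚ ℚ.< r → p ℚ.* r ℚ.≤ q ℚ.* r → p ℚ.≤ q
  *-cancel r 0<r = ℚ.*-cancelʳ-≤-pos r {{ℚ.positive 0<r}}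

  module Bounds (w n : ℕ) .{{_ : NonZero w}} .{{_ : NonZero n}} (w<n : w < n) where
    x : ℚ
    x = + n / w

    1≤w : 1 ℕ.≤ w
    1≤w = ℕ.>-nonZero⁻¹ w

    0<w : 0ℚ ℚ.< nat w
    0<w = ℚ.<-≤-trans (ℚ.positive⁻¹ 1ℚ) (subst (ℚ._≤ nat w) (ℚ.+-identityʳ 1ℚ) (nat-mono 1≤w))

    ≤x : ∀ {p} → p ℚ.* nat w ℚ.≤ nat n → p ℚ.≤ x
    ≤x {p} h = *-cancel (nat w) 0<w (subst (p ℚ.* nat w ℚ.≤_) (sym (quotient-* n w)) h)

    x≤ : ∀ {p} → nat n ℚ.≤ p ℚ.* nat w → x ℚ.≤ p
    x≤ {p} h = *-cancel (nat w) 0<w (subst (ℚ._≤ p ℚ.* nat w) (sym (quotient-* n w)) h)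

    1≤x : 1ℚ ℚ.≤ x
    1≤x = ≤x (subst (ℚ._≤ nat n) (sym (ℚ.*-identityˡ (nat w))) (nat-mono (ℕ.<⇒≤ w<n)))

    ln-nonneg : ∀ k → 0ℚ ℚ.≤ riemann 1ℚ x k
    ln-nonneg k = subst (0ℚ ℚ.≤_) (lower-dyadic 1≤x k) (lower-nonneg (ℚ.positive⁻¹ 1ℚ) (dyadic 1≤x k))

    -- The largest number of groups such that each can have more than `w` vertices.
    m : ℕ
    m = n ℕ./ suc w

    n< : n < suc m * suc w
    n< = subst (_< suc m * suc w) (sym (ℕ.m≡m%n+[m/n]*n n (suc w))) (ℕ.+-monoˡ-< (m * suc w) (ℕ.m%n<n n (suc w)))

    -- Since w + 1 ≤ 2 w; this is the bound on n / w that `ln≤harmonic` asks for.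
    n≤2m : n ℕ.≤ (suc m + suc m) * w
    n≤2m = ℕ.≤-trans (ℕ.<⇒≤ n<) (ℕ.≤-trans (ℕ.*-monoʳ-≤ (suc m) (ℕ.+-monoˡ-≤ w 1≤w))
      (ℕ.≤-reflexive (((∀ m w → (1 + m) * (w + w) ≡ ((1 + m) + (1 + m)) * w) ∋ solve-∀) m w)))

    -- In each summand n / i, rounding down costs at most 1 and the subtraction costs at most w.
    n-harmonic : ∀ m → nat n ℚ.* harmonic m ℚ.≤ nat (divisors n w m + m * suc w)
    n-harmonic zero    = ℚ.≤-reflexive (ℚ.*-zeroʳ (nat n))
    n-harmonic (suc m) = begin
      nat n ℚ.* (harmonic m ℚ.+ recip (nat (suc m)))
        ≡⟨ ℚ.*-distribˡ-+ (nat n) (harmonic m) (recip (nat (suc m))) ⟩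
      nat n ℚ.* harmonic m ℚ.+ nat n ℚ.* recip (nat (suc m))
        ≤⟨ ℚ.+-mono-≤ (n-harmonic m) quotient ⟩
      nat (divisors n w m + m * suc w) ℚ.+ nat (d + suc w)
        ≡⟨ nat-+ (divisors n w m + m * suc w) (d + suc w) ⟨
      nat (divisors n w m + m * suc w + (d + suc w))
        ≡⟨ cong nat (((∀ a b d c → a + b + (d + c) ≡ a + d + (c + b)) ∋ solve-∀) (divisors n w m) (m * suc w) d (suc w)) ⟩
      nat (divisors n w (suc m) + suc m * suc w) ∎
      where
      d = n ℕ./ suc m ℕ.∸ w
      le : n ℕ.≤ (d + suc w) * suc m
      le = ℕ.≤-trans (subst (ℕ._≤ suc (n ℕ./ suc m) * suc m) (sym (ℕ.m≡m%n+[m/n]*n n (suc m)))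
             (ℕ.+-monoˡ-≤ (n ℕ./ suc m * suc m) (ℕ.<⇒≤ (ℕ.m%n<n n (suc m)))))
           (ℕ.*-monoˡ-≤ (suc m) (ℕ.≤-trans (s≤s (ℕ.m≤n+m∸n (n ℕ./ suc m) w)) (ℕ.≤-reflexive (((∀ w d → 1 + (w + d) ≡ d + (1 + w)) ∋ solve-∀) w d))))
      quotient : nat n ℚ.* recip (nat (suc m)) ℚ.≤ nat (d + suc w)
      quotient = *-cancel (nat (suc m)) (nat-pos m) (begin
        (nat n ℚ.* recip (nat (suc m))) ℚ.* nat (suc m)
          ≡⟨ solve 3 (λ n r m → (n :* r) :* m := (m :* r) :* n) refl (nat n) (recip (nat (suc m))) (nat (suc m)) ⟩
        (nat (suc m) ℚ.* recip (nat (suc m))) ℚ.* nat n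
          ≡⟨ cong (ℚ._* nat n) (recip-inverseʳ (>⇒≢ (nat-pos m))) ⟩
        1ℚ ℚ.* nat n
          ≡⟨ ℚ.*-identityˡ (nat n) ⟩
        nat n
          ≤⟨ nat-mono le ⟩
        nat ((d + suc w) * suc m)
          ≡⟨ nat-* (d + suc w) (suc m) ⟩
        nat (d + suc w) ℚ.* nat (suc m) ∎)

    -- The loss 2 n w consists of n w for the summand 1 in `ln≤harmonic`, and of w m (w + 1) ≤ n w
    -- for the losses in `n-harmonic`.
    lower-bound : ∀ s → w * divisors n w m ℕ.≤ s → ∀ k →
      nat (n * w) ℚ.* riemann 1ℚ x k ℚ.≤ nat s ℚ.+ nat (2 * (n * w))
    lower-bound s s≥ k = begin
      nat (n * w) ℚ.* riemann 1ℚ x k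
        ≤⟨ ℚ.*-monoˡ-≤-nonNeg (nat (n * w)) {{ℚ.nonNegative (nat-nonneg (n * w))}} (ln≤harmonic m 1≤x
             (x≤ (subst (λ p → nat n ℚ.≤ p ℚ.* nat w) (nat-+ (suc m) (suc m)) (subst (nat n ℚ.≤_) (nat-* (suc m + suc m) w) (nat-mono n≤2m)))) k) ⟩
      nat (n * w) ℚ.* (harmonic m ℚ.+ 1ℚ)
        ≡⟨ trans (cong (ℚ._* (harmonic m ℚ.+ 1ℚ)) (nat-* n w))
             (solve 3 (λ n w h → (n :* w) :* (h :+ con 1ℚ) := w :* (n :* h :+ n)) refl (nat n) (nat w) (harmonic m)) ⟩
      nat w ℚ.* (nat n ℚ.* harmonic m ℚ.+ nat n)
        ≤⟨ ℚ.*-monoˡ-≤-nonNeg (nat w) {{ℚ.nonNegative (nat-nonneg w)}} (ℚ.+-monoˡ-≤ (nat n) (n-harmonic m)) ⟩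
      nat w ℚ.* (nat (divisors n w m + m * suc w) ℚ.+ nat n)
        ≡⟨ trans (cong (nat w ℚ.*_) (sym (nat-+ (divisors n w m + m * suc w) n))) (sym (nat-* w _)) ⟩
      nat (w * (divisors n w m + m * suc w + n))
        ≤⟨ nat-mono (ℕ.≤-trans (ℕ.*-monoʳ-≤ w (ℕ.+-monoˡ-≤ n (ℕ.+-monoʳ-≤ (divisors n w m) (ℕ.m/n*n≤m n (suc w)))))
             (ℕ.≤-trans (ℕ.≤-reflexive (((∀ w d n → w * (d + n + n) ≡ w * d + 2 * (n * w)) ∋ solve-∀) w (divisors n w m) n)) (ℕ.+-monoˡ-≤ (2 * (n * w)) s≥))) ⟩
      nat (s + 2 * (n * w))
        ≡⟨ nat-+ s (2 * (n * w)) ⟩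
      nat s ℚ.+ nat (2 * (n * w)) ∎

    l₃ : ℕ → ℚ
    l₃ k = riemann 1ℚ (nat 3) k

    R : ℕ → ℚ
    R k = recip (nat 6 ℚ.* l₃ k)

    -- The integrand is at least 1/3 on [1 , 3], so every Riemann sum for ln 3 is at least 2/3.
    6l₃≥4 : ∀ k → nat 4 ℚ.≤ nat 6 ℚ.* l₃ k
    6l₃≥4 k = ℚ.*-monoˡ-≤-nonNeg (nat 6)
      (riemann-≥ (nat 3) (ℚ.positive⁻¹ (nat 3)) 1ℚ (nat 3) k (ℚ.positive⁻¹ 1ℚ) (ℚ.≤ᵇ⇒≤ _) ℚ.≤-refl)

    6l₃>0 : ∀ k → 0ℚ ℚ.< nat 6 ℚ.* l₃ k
    6l₃>0 k = ℚ.<-≤-trans (ℚ.positive⁻¹ (nat 4)) (6l₃≥4 k)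

    R-pos : ∀ k → 0ℚ ℚ.< R k
    R-pos k = recip-pos (6l₃>0 k)

    R≤¼ : ∀ k → R k ℚ.≤ + 1 / 4
    R≤¼ k = recip-antimono (ℚ.positive⁻¹ (nat 4)) (6l₃≥4 k)

    -- `R k` stands for 1/(6 ln 3), so 63 ≤ 190/3 = 76⋅5 (ln 3) R, which turns 5 J ln 3 into 8 ln x
    -- + 1. Here 76⋅8 = 608 = 32⋅19, and R ≤ 1/4 makes the rest at most 19.
    63J≤ : ∀ J k → nat (5 * J) ℚ.* l₃ k ℚ.≤ nat 8 ℚ.* riemann 1ℚ x k ℚ.+ 1ℚ →
      nat 63 ℚ.* nat J ℚ.≤ nat 608 ℚ.* (R k ℚ.* riemann 1ℚ x k) ℚ.+ nat 19
    63J≤ J k h = begin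
      nat 63 ℚ.* nat J
        ≤⟨ *-monoʳ {nat 63} {+ 190 / 3} (nat J) (nat-nonneg J) (ℚ.≤ᵇ⇒≤ _) ⟩
      (+ 190 / 3) ℚ.* nat J
        ≡⟨ solve 1 (λ j → con (+ 190 / 3) :* j := (con (+ 190 / 3) :* j) :* con 1ℚ) refl (nat J) ⟩
      ((+ 190 / 3) ℚ.* nat J) ℚ.* 1ℚ
        ≡⟨ cong (((+ 190 / 3) ℚ.* nat J) ℚ.*_) (recip-inverseʳ (>⇒≢ (6l₃>0 k))) ⟨
      ((+ 190 / 3) ℚ.* nat J) ℚ.* ((nat 6 ℚ.* l₃ k) ℚ.* R k)
        ≡⟨ solve 3 (λ j l r → (con (+ 190 / 3) :* j) :* ((con (nat 6) :* l) :* r) := ((con (nat 5) :* j) :* l) :* (con (nat 76) :* r)) refl (nat J) (l₃ k) (R k) ⟩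
      ((nat 5 ℚ.* nat J) ℚ.* l₃ k) ℚ.* (nat 76 ℚ.* R k)
        ≡⟨ cong (λ z → (z ℚ.* l₃ k) ℚ.* (nat 76 ℚ.* R k)) (nat-* 5 J) ⟨
      (nat (5 * J) ℚ.* l₃ k) ℚ.* (nat 76 ℚ.* R k)
        ≤⟨ *-monoʳ (nat 76 ℚ.* R k) (*-nonneg (nat 76) (R k) (nat-nonneg 76) (ℚ.<⇒≤ (R-pos k))) h ⟩
      (nat 8 ℚ.* riemann 1ℚ x k ℚ.+ 1ℚ) ℚ.* (nat 76 ℚ.* R k)
        ≡⟨ solve 2 (λ l r → (con (nat 8) :* l :+ con 1ℚ) :* (con (nat 76) :* r) := con (nat 608) :* (r :* l) :+ con (nat 76) :* r) refl (riemann 1ℚ x k) (R k) ⟩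
      nat 608 ℚ.* (R k ℚ.* riemann 1ℚ x k) ℚ.+ nat 76 ℚ.* R k
        ≤⟨ ℚ.+-monoʳ-≤ (nat 608 ℚ.* (R k ℚ.* riemann 1ℚ x k)) (ℚ.*-monoˡ-≤-nonNeg (nat 76) (R≤¼ k)) ⟩
      nat 608 ℚ.* (R k ℚ.* riemann 1ℚ x k) ℚ.+ nat 19 ∎

    -- The highest level J = K - 1 has spacing below `n`, so 2ᴶ ≤ n / w and `63J≤` applies to J. The
    -- one level more adds 63, and 19 + 63 = 82.
    63K≤ : ∀ K → (∀ k → k < K → spacing (suc w) k < n) →
      ∃ λ N → ∀ k → N ℕ.≤ k → nat 63 ℚ.* nat K ℚ.≤ nat 608 ℚ.* (R k ℚ.* riemann 1ℚ x k) ℚ.+ nat 82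
    63K≤ zero    _     = 0 , λ k _ → ℚ.+-mono-≤ (*-nonneg (nat 608) (R k ℚ.* riemann 1ℚ x k) (nat-nonneg 608)
      (*-nonneg (R k) (riemann 1ℚ x k) (ℚ.<⇒≤ (R-pos k)) (ln-nonneg k))) (nat-nonneg 82)
    63K≤ (suc J) below = N , λ k N≤k → begin
      nat 63 ℚ.* (1ℚ ℚ.+ nat J)
        ≡⟨ solve 1 (λ j → con (nat 63) :* (con 1ℚ :+ j) := con (nat 63) :* j :+ con (nat 63)) refl (nat J) ⟩
      nat 63 ℚ.* nat J ℚ.+ nat 63
        ≤⟨ ℚ.+-monoˡ-≤ (nat 63) (63J≤ J k (le k N≤k)) ⟩
      (nat 608 ℚ.* (R k ℚ.* riemann 1ℚ x k) ℚ.+ nat 19) ℚ.+ nat 63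
        ≡⟨ ℚ.+-assoc (nat 608 ℚ.* (R k ℚ.* riemann 1ℚ x k)) (nat 19) (nat 63) ⟩
      nat 608 ℚ.* (R k ℚ.* riemann 1ℚ x k) ℚ.+ nat 82 ∎
      where
      2^Jw≤n : 2 ℕ.^ J * w ℕ.≤ n
      2^Jw≤n = ℕ.≤-trans (ℕ.*-monoʳ-≤ (2 ℕ.^ J) (ℕ.≤-trans (ℕ.n≤1+n w) (ℕ.m≤m+n (suc w) _)))
        (ℕ.≤-trans (ℕ.≤-reflexive (sym (quarter-2^ (suc w) J))) (ℕ.≤-trans (ℕ.m≤m+n (quarter (suc w) J) _)
          (ℕ.≤-trans (ℕ.≤-reflexive (sym (spacing≡ (suc w) J))) (ℕ.<⇒≤ (below J ℕ.≤-refl)))))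
      2^J≤x : power (nat 2) J ℚ.≤ x
      2^J≤x = ≤x (subst (ℚ._≤ nat n) (trans (nat-* (2 ℕ.^ J) w) (cong (ℚ._* nat w) (nat-power 2 J))) (nat-mono 2^Jw≤n))
      asymptotic = 5ln3≤8ln 1≤x J 2^J≤x
      N = proj₁ asymptotic
      le = proj₂ asymptotic

    -- The sum 82 + 4000 is rounded up to 4096 = 32⋅128, and w + 1 ≤ 2 w turns 128 (w + 1) n into
    -- 256 n w.
    upper-bound : ∀ s K → 32 * s ℕ.≤ 63 * (suc w * n * K) + 4000 * (suc w * n) → ∀ k →
      nat 63 ℚ.* nat K ℚ.≤ nat 608 ℚ.* (R k ℚ.* riemann 1ℚ x k) ℚ.+ nat 82 →
      nat s ℚ.≤ ((nat 19 ℚ.* R k) ℚ.* nat ((w + 1) * n)) ℚ.* riemann 1ℚ x k ℚ.+ nat (256 * (n * w))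
    upper-bound s K s≤ k h = *-cancel (nat 32) (ℚ.positive⁻¹ (nat 32)) (begin
      nat s ℚ.* nat 32
        ≡⟨ trans (ℚ.*-comm (nat s) (nat 32)) (sym (nat-* 32 s)) ⟩
      nat (32 * s)
        ≤⟨ nat-mono (ℕ.≤-trans s≤ (ℕ.≤-reflexive (((∀ w n K → 63 * ((1 + w) * n * K) + 4000 * ((1 + w) * n) ≡ ((w + 1) * n) * (63 * K + 4000)) ∋ solve-∀) w n K))) ⟩
      nat (D * (63 * K + 4000))
        ≡⟨ trans (nat-* D (63 * K + 4000)) (cong (nat D ℚ.*_) (trans (nat-+ (63 * K) 4000) (cong (ℚ._+ nat 4000) (nat-* 63 K)))) ⟩
      nat D ℚ.* (nat 63 ℚ.* nat K ℚ.+ nat 4000)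
        ≤⟨ ℚ.*-monoˡ-≤-nonNeg (nat D) {{ℚ.nonNegative (nat-nonneg D)}} (ℚ.+-monoˡ-≤ (nat 4000) h) ⟩
      nat D ℚ.* ((nat 608 ℚ.* (R k ℚ.* lx) ℚ.+ nat 82) ℚ.+ nat 4000)
        ≤⟨ ℚ.*-monoˡ-≤-nonNeg (nat D) {{ℚ.nonNegative (nat-nonneg D)}} (ℚ.≤-trans (ℚ.≤-reflexive (ℚ.+-assoc (nat 608 ℚ.* (R k ℚ.* lx)) (nat 82) (nat 4000)))
             (ℚ.+-monoʳ-≤ (nat 608 ℚ.* (R k ℚ.* lx)) (ℚ.≤ᵇ⇒≤ {nat 4082} {nat 4096} _))) ⟩
      nat D ℚ.* (nat 608 ℚ.* (R k ℚ.* lx) ℚ.+ nat 4096)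
        ≡⟨ solve 3 (λ d r l → d :* (con (nat 608) :* (r :* l) :+ con (nat 4096)) := (((con (nat 19) :* r) :* d) :* l) :* con (nat 32) :+ (con (nat 128) :* d) :* con (nat 32)) refl (nat D) (R k) lx ⟩
      (((nat 19 ℚ.* R k) ℚ.* nat D) ℚ.* lx) ℚ.* nat 32 ℚ.+ (nat 128 ℚ.* nat D) ℚ.* nat 32
        ≡⟨ ℚ.*-distribʳ-+ (nat 32) (((nat 19 ℚ.* R k) ℚ.* nat D) ℚ.* lx) (nat 128 ℚ.* nat D) ⟨
      (((nat 19 ℚ.* R k) ℚ.* nat D) ℚ.* lx ℚ.+ nat 128 ℚ.* nat D) ℚ.* nat 32
        ≤⟨ *-monoʳ (nat 32) (nat-nonneg 32) (ℚ.+-monoʳ-≤ (((nat 19 ℚ.* R k) ℚ.* nat D) ℚ.* lx)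
             (subst (ℚ._≤ nat (256 * (n * w))) (nat-* 128 D) (nat-mono 128D≤))) ⟩
      (((nat 19 ℚ.* R k) ℚ.* nat D) ℚ.* lx ℚ.+ nat (256 * (n * w))) ℚ.* nat 32 ∎)
      where
      D = (w + 1) * n
      lx = riemann 1ℚ x k
      128D≤ : 128 * D ℕ.≤ 256 * (n * w)
      128D≤ = ℕ.≤-trans (ℕ.*-monoʳ-≤ 128 (ℕ.*-monoˡ-≤ n (ℕ.+-monoʳ-≤ w 1≤w)))
        (ℕ.≤-reflexive (((∀ n w → 128 * ((w + w) * n) ≡ 256 * (n * w)) ∋ solve-∀) n w))

  grow : ∀ {p ε} → 0ℚ ℚ.< ε → p ℚ.≤ p ℚ.+ ε
  grow {p} 0<ε = subst (ℚ._≤ p ℚ.+ _) (ℚ.+-identityʳ p) (ℚ.+-monoʳ-≤ p (ℚ.<⇒≤ 0<ε))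

  shift : ∀ {a c d} b → a ℚ.≤ b ℚ.+ c → d ≡ c → a ℚ.+ ℚ.- d ℚ.≤ b
  shift {a} {c} b h refl = subst (a ℚ.+ ℚ.- c ℚ.≤_) (solve 2 (λ b c → (b :+ c) :+ (:- c) := b) refl b c) (ℚ.+-monoˡ-≤ (ℚ.- c) h)

  bounds : ∀ (w n s : ℕ) .{{_ : NonZero w}} .{{_ : NonZero n}} → w < n → IsS w n s →
    (fromℕᴿ (n * w) *ᴿ ln (+ n / w) -ᴿ fromℕᴿ (2 * (n * w)) ≤ᴿ fromℕᴿ s)
    ×
    (fromℕᴿ s ≤ᴿ (fromℕᴿ 19 ÷ᴿ (fromℕᴿ 6 *ᴿ ln (+ 3 / 1))) *ᴿ fromℕᴿ ((w + 1) * n) *ᴿ ln (+ n / w) +ᴿ fromℕᴿ (256 * (n * w)))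
  bounds w n s w<n ((G , universal , edges≡s) , minimal) =
      (λ ε 0<ε → 0 , λ k _ → ℚ.≤-trans (shift (+ s / 1) (subst₂ (λ a b → a ℚ.* riemann 1ℚ x k ℚ.≤ b ℚ.+ nat (2 * (n * w)))
          (sym (+/1≡nat (n * w))) (sym (+/1≡nat s)) (lower-bound s s≥ k)) (+/1≡nat (2 * (n * w)))) (grow 0<ε))
    -- The lower bound holds for all terms of the sequences, the upper one from the index on at
    -- which the upper and lower sums for ln (n / w) are close enough.
    , (λ ε 0<ε → proj₁ large , λ k N≤k → ℚ.≤-trans (subst₂ ℚ._≤_ (sym (+/1≡nat s))
          (cong₂ (λ a b → ((nat 19 ℚ.* R k) ℚ.* a) ℚ.* riemann 1ℚ x k ℚ.+ b) (sym (+/1≡nat ((w + 1) * n))) (sym (+/1≡nat (256 * (n * w)))))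
          (upper-bound s K s≤ k (proj₂ large k N≤k))) (grow 0<ε))
    where
    open Bounds w n w<n
    s≥ : w * divisors n w m ℕ.≤ s
    s≥ = subst (w * divisors n w m ℕ.≤_) edges≡s (edges≥ 1≤w G universal m (ℕ.m/n*n≤m n (suc w)))
    K : ℕ
    K = proj₁ (UniversalGraph.result n w)
    s≤ : 32 * s ℕ.≤ 63 * (suc w * n * K) + 4000 * (suc w * n)
    s≤ = let _ , _ , U , U-universal , U-size = UniversalGraph.result n w in
      ℕ.≤-trans (ℕ.*-monoʳ-≤ 32 (minimal _ (U , U-universal , refl))) U-size
    large = 63K≤ K (proj₁ (proj₂ (UniversalGraph.result n w)))

open import Defs
open import Data.Integer using (+_)
open import Data.Nat using (ℕ; NonZero; _+_; _*_; _<_)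
open import Data.Product using (Σ-syntax; _×_)
open import Data.Rational using (_/_)
open Estimates using (bounds)

theorem3 : Σ[ C₁ ∈ ℕ ] Σ[ C₂ ∈ ℕ ]
    (∀ (w n s : ℕ) .{{_ : NonZero w}} .{{_ : NonZero n}} → w < n → IsS w n s →
    (fromℕᴿ (n * w) *ᴿ ln (+ n / w) -ᴿ fromℕᴿ (C₁ * (n * w)) ≤ᴿ fromℕᴿ s)
    ×
    (fromℕᴿ s ≤ᴿ (fromℕᴿ 19 ÷ᴿ (fromℕᴿ 6 *ᴿ ln (+ 3 / 1))) *ᴿ fromℕᴿ ((w + 1) * n) *ᴿ ln (+ n / w) +ᴿ fromℕᴿ (C₂ * (n * w))))
theorem3 = 2 , 256 , bounds
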